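{- Let $G$ be a graph of order $n$. Then $\lambda(G)=n-3$ if and only if $G$ is one of the following graphs: 1. two parallel paths with an additional $K_1$ component; 2. $P_4$ or $P_5$; 3. two parallel paths such that any standard drawing has one of the following forms: (a) $P_1=\{x\}$ and $P_k$ where $k\ge 3$, and (i) for some $u,v,w$ that form a subpath of $P_k$, $N(x)=\{u,w\}$ or $N(x)=\{u,v,w\}$, or (ii) for an end vertex $v$ of $P_k$ with neighbor $w$ on $P_k$, $N(x)=\{w\}$ or $N(x)=\{v,w\}$; (b) $P_2=uv$ and $P_k$ with $N(u)\cap V(P_k)=N(v)\cap V(P_k)$, and if $k=1$, then $ux,vx\in E(G)$ where $V(P_1)=\{x\}$; (c) $P_3=uvw$ and $P_k$ where $N(u)=N(w)=\{v\}$ or $N(u)=N(w)=\{v,x\}$ for some $x$ on $P_k$; (d) $P_k=v_1v_2\cdots v_k$ and $P_j=w_1w_2\cdots w_j$ where $k,j\ge 2$, and the set of edges between $P_k$ and $P_j$ is one of $\{v_{k-1}w_1,\,v_kw_2\}$, $\{v_{k-1}w_1,\,v_kw_2,\,v_{k-1}w_2\}$, or $\{v_{k-1}w_1,\,v_kw_2,\,v_kw_1\}$.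
   Context: Graphs are finite, simple (no loops or multiple edges), undirected; $n=|V(G)|$ is the order of $G$ (at least 1). $N(v)$ denotes the open neighborhood of $v$ in $G$. $P_m$ is the path on $m$ vertices and $K_1$ the one-vertex graph. Standard zero forcing: a subset $S\subseteq V(G)$ is colored blue and all other vertices white. Standard color change rule: if a blue vertex has exactly one white neighbor, then that white neighbor becomes blue. $S$ is a zero forcing set if repeated application of the rule eventually turns all vertices blue. The zero forcing span $\lambda(G)$ is the number of distinct cardinalities $k$ for which there exist $Z,F\subseteq V(G)$ with $|Z|=|F|=k$ such that $Z$ is a zero forcing set and $F$ is not a zero forcing set. $G$ is a graph of two parallel paths if $G$ itself is not a path, and $V(G)$ can be partitioned into subsets $V_1$ and $V_2$ such that the subgraphs induced by $V_1$ and $V_2$ are paths, and $G$ can be drawn in the plane so that the paths induced by $V_1$ and $V_2$ are parallel line segments, and edges between $V_1$ and $V_2$ can be drawn as straight line segments that do not cross. Such a drawing is a standard drawing. In item 3 the two listed paths are the two paths (induced by $V_1$ and $V_2$) of the standard drawing.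
   Formalization: In 3(c), when N(u)=N(w)={v} and k=1, it is also required that v be adjacent to the vertex of P_1; this excludes only P_3 with an isolated vertex, whose span is 2 rather than n-3=1. Drawings use rational coordinates, which admit the same pairs of paths. -}

module Defs where

open import Data.Bool.Properties using () renaming (_≟_ to _≟ᵇ_)
open import Data.Empty using () renaming (⊥ to Empty)
open import Data.Fin using (Fin; zero; suc; _<_; toℕ; fromℕ; inject₁)
open import Data.Fin.Properties using (any?; all?) renaming (_≟_ to _≟ᶠ_)
open import Data.Fin.Subset using (Subset; _∈_; _∉_; _⊆_; _⊃_; _∪_; _∩_; ⁅_⁆; ⊤; ⊥; ∣_∣)
open import Data.Fin.Subset.Induction using (⊃-wellFounded; Acc; acc)
open import Data.Fin.Subset.Properties
  using (_∈?_; anySubset?; p⊆p∪q; q⊆p∪q; x∈p∪q⁻; x∈⁅x⁆; x∈⁅y⁆⇒x≡y; ⊆-antisym; ⊆⊤)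
open import Data.List using (List; []; _∷_; length; filter; upTo)
import Data.List.Membership.Propositional as List
open import Data.Nat using (ℕ; suc; _≤_)
open import Data.Nat.Properties using (1+n≢n) renaming (_≟_ to _≟ⁿ_)
open import Data.Product using (Σ; ∃; ∃-syntax; _×_; _,_)
open import Data.Rational as ℚ using (ℚ; 0ℚ; 1ℚ)
open import Data.Sum using (_⊎_; inj₁; inj₂; swap)
open import Data.Vec using (tabulate)
open import Data.Vec.Properties using () renaming (≡-dec to ≡-decᵛ)
open import Function.Bundles using (_⇔_)
open import Function.Definitions using (Injective; Bijective)
open import Level using (0ℓ)
open import Relation.Binary.Construct.Closure.ReflexiveTransitive using (Star; ε; _◅_)
open import Relation.Binary.Core using (Rel)
open import Relation.Binary.Definitions using (Decidable; Symmetric; Irreflexive)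
open import Relation.Binary.PropositionalEquality using (_≡_; _≢_; refl; sym; subst)
open import Relation.Nullary using (¬_; Dec; yes; no; does)
open import Relation.Nullary.Decidable using (_×-dec_; _⊎-dec_; _→-dec_; ¬?; map′)

private
  variable
    k m n : ℕ

record Graph (n : ℕ) : Set₁ where
  infix 4 _~_
  field
    _~_         : Rel (Fin n) 0ℓ
    _~?_        : Decidable _~_
    symmetric   : Symmetric _~_
    irreflexive : Irreflexive _≡_ _~_

infix 4 _≅_

_≅_ : Graph m → Graph n → Set
_≅_ {m} {n} G H = Σ (Fin m → Fin n) λ f →
  Bijective _≡_ _≡_ f × (∀ x y → Graph._~_ G x y ⇔ Graph._~_ H (f x) (f y))

P : (m : ℕ) → Graph m
P m = record
  { _~_         = λ i j → toℕ j ≡ suc (toℕ i) ⊎ toℕ i ≡ suc (toℕ j)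
  ; _~?_        = λ i j → (toℕ j ≟ⁿ suc (toℕ i)) ⊎-dec (toℕ i ≟ⁿ suc (toℕ j))
  ; symmetric   = swap
  ; irreflexive = λ where
      refl (inj₁ eq) → 1+n≢n (sym eq)
      refl (inj₂ eq) → 1+n≢n (sym eq)
  }

infix 6 _∪K₁

_∪K₁ : Graph m → Graph (suc m)
_∪K₁ {m} G = record
  { _~_         = adj
  ; _~?_        = adj?
  ; symmetric   = λ {x} {y} → adj-sym x y
  ; irreflexive = λ {x} {y} → adj-irr x y
  }
  where
  open Graph G

  adj : Rel (Fin (suc m)) 0ℓ
  adj zero    _       = Empty
  adj (suc _) zero    = Empty
  adj (suc x) (suc y) = x ~ y

  adj? : Decidable adj
  adj? zero    _       = no λ ()
  adj? (suc _) zero    = no λ ()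
  adj? (suc x) (suc y) = x ~? y

  adj-sym : ∀ x y → adj x y → adj y x
  adj-sym (suc x) (suc y) = symmetric

  adj-irr : ∀ x y → x ≡ y → ¬ adj x y
  adj-irr (suc x) (suc .x) refl = irreflexive refl

------------------------------------------------------------------------
-- Zero forcing

module _ (G : Graph n) where
  open Graph G

  N : Fin n → Subset n
  N x = tabulate λ y → does (x ~? y)

  Forces : Subset n → Fin n → Fin n → Set
  Forces B u w = u ∈ B × u ~ w × w ∉ B × (∀ x → u ~ x → x ∉ B → x ≡ w)

  data Step (B : Subset n) : Subset n → Set where
    force : ∀ {u w} → Forces B u w → Step B (B ∪ ⁅ w ⁆)

  ZeroForcing : Subset n → Set
  ZeroForcing S = Star Step S ⊤

  forces? : ∀ B u w → Dec (Forces B u w)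
  forces? B u w = (u ∈? B) ×-dec (u ~? w) ×-dec ¬? (w ∈? B) ×-dec
    all? (λ x → (u ~? x) →-dec (¬? (x ∈? B) →-dec (x ≟ᶠ w)))

  ZeroForcing-mono : ∀ {B C} → B ⊆ C → ZeroForcing B → ZeroForcing C
  ZeroForcing-mono {C = C} B⊆C ε =
    subst ZeroForcing (⊆-antisym B⊆C ⊆⊤) ε
  ZeroForcing-mono {B} {C} B⊆C (force {u} {w} (u∈B , u~w , w∉B , only) ◅ rest)
    with w ∈? C
  ... | yes w∈C = ZeroForcing-mono B∪w⊆C rest
    where
    B∪w⊆C : B ∪ ⁅ w ⁆ ⊆ C
    B∪w⊆C x∈ with x∈p∪q⁻ B ⁅ w ⁆ x∈
    ... | inj₁ x∈B = B⊆C x∈B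
    ... | inj₂ x∈w = subst (_∈ C) (sym (x∈⁅y⁆⇒x≡y w x∈w)) w∈C
  ... | no w∉C =
    force (B⊆C u∈B , u~w , w∉C , λ x u~x x∉C → only x u~x (λ x∈B → x∉C (B⊆C x∈B)))
      ◅ ZeroForcing-mono B∪w⊆C∪w rest
    where
    B∪w⊆C∪w : B ∪ ⁅ w ⁆ ⊆ C ∪ ⁅ w ⁆
    B∪w⊆C∪w x∈ with x∈p∪q⁻ B ⁅ w ⁆ x∈
    ... | inj₁ x∈B = p⊆p∪q ⁅ w ⁆ (B⊆C x∈B)
    ... | inj₂ x∈w = q⊆p∪q C ⁅ w ⁆ x∈w

  zeroForcing? : ∀ S → Dec (ZeroForcing S)
  zeroForcing? S = go S (⊃-wellFounded S)
    where
    go : ∀ B → Acc _⊃_ B → Dec (ZeroForcing B)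
    go B (acc rec) with any? (λ u → any? (forces? B u))
    ... | yes (u , w , f@(_ , _ , w∉B , _)) =
      map′ (force f ◅_) (ZeroForcing-mono (p⊆p∪q ⁅ w ⁆))
        (go (B ∪ ⁅ w ⁆) (rec (p⊆p∪q ⁅ w ⁆ , w , q⊆p∪q B ⁅ w ⁆ (x∈⁅x⁆ w) , w∉B)))
    ... | no stuck with ≡-decᵛ _≟ᵇ_ B ⊤
    ...   | yes refl = yes ε
    ...   | no B≢⊤   = no λ where
      ε             → B≢⊤ refl
      (force f ◅ _) → stuck (_ , _ , f)

  SpanSize : ℕ → Set
  SpanSize k = (∃[ Z ] ∣ Z ∣ ≡ k × ZeroForcing Z) × (∃[ F ] ∣ F ∣ ≡ k × ¬ ZeroForcing F)

  spanSize? : ∀ k → Dec (SpanSize k)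
  spanSize? k =
    anySubset? (λ Z → (∣ Z ∣ ≟ⁿ k) ×-dec zeroForcing? Z) ×-dec
    anySubset? (λ F → (∣ F ∣ ≟ⁿ k) ×-dec ¬? (zeroForcing? F))

  -- A subset of Fin n has size at most n, so testing 0, …, n covers every
  -- possible k.
  span : ℕ
  span = length (filter spanSize? (upTo (suc n)))

------------------------------------------------------------------------
-- Plane geometry
--
-- Coordinates are rational.  Which edges of a standard drawing cross depends
-- only on the order of the vertices along the two lines, and every such order
-- occurs over ℚ, so the real plane gives the same pairs of paths.

Point : Set
Point = ℚ × ℚ

infixl 6 _⊕_ _⊖_
infixr 7 _⊙_

_⊕_ _⊖_ : Point → Point → Point
(x , y) ⊕ (x′ , y′) = x ℚ.+ x′ , y ℚ.+ y′
(x , y) ⊖ (x′ , y′) = x ℚ.- x′ , y ℚ.- y′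

_⊙_ : ℚ → Point → Point
c ⊙ (x , y) = c ℚ.* x , c ℚ.* y

det : Point → Point → ℚ
det (x , y) (x′ , y′) = x ℚ.* y′ ℚ.- y ℚ.* x′

OnSegment : Point → Point → Point → Set
OnSegment a b p = ∃[ c ] 0ℚ ℚ.≤ c × c ℚ.≤ 1ℚ × p ≡ ((1ℚ ℚ.- c) ⊙ a) ⊕ (c ⊙ b)

StrictlyIncreasing : (Fin k → ℚ) → Set
StrictlyIncreasing s = ∀ {i j} → i < j → s i ℚ.< s j

------------------------------------------------------------------------
-- Two parallel paths

-- The subgraph of G induced by V is a path on k ≥ 1 vertices, listed in
-- their order along the path.  Every path has both orderings.
record PathOrder (G : Graph n) (V : Subset n) (k : ℕ) : Set where
  field
    vertex    : Fin k → Fin n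
    nonempty  : 1 ≤ k
    injective : Injective _≡_ _≡_ vertex
    image     : ∀ x → x ∈ V ⇔ (∃[ i ] vertex i ≡ x)
    induced   : ∀ i j → Graph._~_ (P k) i j ⇔ Graph._~_ G (vertex i) (vertex j)

open PathOrder public using (vertex)

record StandardDrawing (G : Graph n) : Set where
  open Graph G
  field
    V₁ V₂    : Subset n
    cover    : V₁ ∪ V₂ ≡ ⊤
    disjoint : V₁ ∩ V₂ ≡ ⊥

    {k₁ k₂}  : ℕ
    path₁    : PathOrder G V₁ k₁
    path₂    : PathOrder G V₂ k₂

    position : Fin n → Point

    -- The two paths lie on the distinct parallel lines a + ℚd and b + ℚd, each
    -- traversed in the direction d.  Using one d for both is no restriction
    -- because path₂ may be taken in either ordering.
    a b d          : Point
    distinct-lines : det (b ⊖ a) d ≢ 0ℚ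
    s              : Fin k₁ → ℚ
    t              : Fin k₂ → ℚ
    s-increasing   : StrictlyIncreasing s
    t-increasing   : StrictlyIncreasing t
    on-line₁       : ∀ i → position (vertex path₁ i) ≡ a ⊕ (s i ⊙ d)
    on-line₂       : ∀ j → position (vertex path₂ j) ≡ b ⊕ (t j ⊙ d)

    -- Different edges between V₁ and V₂ meet at most in a common end.
    noncrossing :
      ∀ {x y x′ y′} → x ∈ V₁ → y ∈ V₂ → x′ ∈ V₁ → y′ ∈ V₂ →
      x ~ y → x′ ~ y′ → ¬ (x ≡ x′ × y ≡ y′) →
      ∀ p → OnSegment (position x) (position y) p →
      OnSegment (position x′) (position y′) p →
      (x ≡ x′ × p ≡ position x) ⊎ (y ≡ y′ × p ≡ position y)

IsPath : Graph n → Set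
IsPath {n} G = G ≅ P n

TwoParallelPaths : Graph n → Set
TwoParallelPaths G = ¬ IsPath G × StandardDrawing G

------------------------------------------------------------------------
-- The forms of a standard drawing with paths V₁ and V₂

module _ (G : Graph n) (V₁ V₂ : Subset n) where
  open Graph G

  -- P₁ = {x}; the end vertex of P_k is the first one of a suitable ordering.
  FormA : Set
  FormA = ∃[ x ] V₁ ≡ ⁅ x ⁆ × ∃[ m ] Σ (PathOrder G V₂ (suc (suc (suc m)))) λ q →
    (∃[ i ] let u = vertex q (inject₁ (inject₁ i))
                v = vertex q (inject₁ (suc i))
                w = vertex q (suc (suc i))
            in N G x ≡ ⁅ u ⁆ ∪ ⁅ w ⁆ ⊎ N G x ≡ ⁅ u ⁆ ∪ ⁅ v ⁆ ∪ ⁅ w ⁆)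
    ⊎
    (let v = vertex q zero
         w = vertex q (suc zero)
     in N G x ≡ ⁅ w ⁆ ⊎ N G x ≡ ⁅ v ⁆ ∪ ⁅ w ⁆)

  FormB : Set
  FormB = Σ (PathOrder G V₁ 2) λ p → ∃[ k ] PathOrder G V₂ k ×
    (let u = vertex p zero
         v = vertex p (suc zero)
     in N G u ∩ V₂ ≡ N G v ∩ V₂ ×
        (k ≡ 1 → ∀ x → x ∈ V₂ → u ~ x × v ~ x))

  -- The clause for k ≡ 1 keeps out P₃ ∪ K₁ only.  That graph of order 4 has
  -- N u ≡ N w ≡ ⁅ v ⁆, but its span is 2 (attained by the sizes 2 and 3).
  FormC : Set
  FormC = Σ (PathOrder G V₁ 3) λ p → ∃[ k ] PathOrder G V₂ k ×
    (let u = vertex p zero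
         v = vertex p (suc zero)
         w = vertex p (suc (suc zero))
     in (N G u ≡ ⁅ v ⁆ × N G w ≡ ⁅ v ⁆ × (k ≡ 1 → ∀ x → x ∈ V₂ → v ~ x))
        ⊎
        (∃[ x ] x ∈ V₂ × N G u ≡ ⁅ v ⁆ ∪ ⁅ x ⁆ × N G w ≡ ⁅ v ⁆ ∪ ⁅ x ⁆))

  EdgesBetween : ∀ {k j} → PathOrder G V₁ k → PathOrder G V₂ j →
                 List (Fin k × Fin j) → Set
  EdgesBetween p q es =
    ∀ i j → vertex p i ~ vertex q j ⇔ (i , j) List.∈ es

  FormD : Set
  FormD = ∃[ k ] ∃[ j ]
    Σ (PathOrder G V₁ (suc (suc k))) λ p →
    Σ (PathOrder G V₂ (suc (suc j))) λ q →
    (let penult = inject₁ (fromℕ k)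
         last   = fromℕ (suc k)
         first  = zero
         second = suc zero
     in EdgesBetween p q ((penult , first) ∷ (last , second) ∷ [])
        ⊎ EdgesBetween p q ((penult , first) ∷ (last , second) ∷ (penult , second) ∷ [])
        ⊎ EdgesBetween p q ((penult , first) ∷ (last , second) ∷ (last , first) ∷ []))

  Form : Set
  Form = FormA ⊎ FormB ⊎ FormC ⊎ FormD

-- The two paths of a drawing are unordered.
HasForm : {G : Graph n} → StandardDrawing G → Set
HasForm {G = G} D = Form G V₁ V₂ ⊎ Form G V₂ V₁
  where open StandardDrawing D

module Submission where

-- Let z be the least size of a zero forcing set and b the least size of a fort,
-- a nonempty set W such that no vertex outside W has exactly one neighbour in W.
-- The complements of forts are the stalled sets, so the largest set that does
-- not force has n - b vertices and λ(G) = n + 1 - z - b.  Hence λ(G) = n - 3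
-- means z + b = 4.
--
-- (z, b) = (3, 1): a fort of size 1 is an isolated vertex, and deleting it
-- lowers z to 2.  (z, b) = (1, 3): z = 1 characterises paths, and a fort of a
-- path contains both ends and one of any two consecutive vertices.
-- (z, b) = (2, 2): without isolated vertices a fort of size 2 is a pair of twins,
-- and the forms list the possible positions of twins on two parallel paths.
--
-- That z ≤ 2 characterises two parallel paths (Row's theorem) is seen by listing
-- the vertices forced from each of the two seeds.  A vertex that has forced has
-- only blue neighbours, so both chains are induced paths and the edges between
-- them do not cross.  Conversely, when two paths are swept from their first
-- vertices, both sides can be blocked only by a pair of crossing edges.

open import Defs
open import Data.Fin as F using (Fin; zero; suc; toℕ; fromℕ; fromℕ<; inject₁; opposite; punchIn; punchOut)
open import Data.Fin.Patterns using (0F; 1F; 2F; 3F; 4F)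
open import Data.Fin.Properties as F using
  (any?; injective⇒≤; opposite-involutive; opposite-prop; punchIn-injective; punchIn-punchOut; punchInᵢ≢i;
   toℕ-fromℕ; toℕ-fromℕ<; toℕ-injective; toℕ-inject₁; toℕ<n)
  renaming (_≟_ to _≟ᶠ_)
open import Data.Fin.Relation.Unary.Top using (view; ‵fromℕ; ‵inject₁)
open import Data.Fin.Subset using
  (Subset; inside; outside; _∈_; _∉_; _⊆_; _⊃_; _∪_; _∩_; ⁅_⁆; ⊤; ⊥; ∁; ∣_∣)
open import Data.Fin.Subset.Induction using (⊃-wellFounded; Acc; acc)
open import Data.Fin.Subset.Properties
open import Data.List as List using (List; []; _∷_; length; filter; upTo)
import Data.List.Membership.DecPropositional as DecMembership
open import Data.List.Membership.Propositional using () renaming (_∈_ to _∈ˡ_)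
open import Data.List.Membership.Propositional.Properties using (∈-map⁺; ∈-map⁻)
open import Data.List.Properties using (filter-++; length-++; length-map; upTo-∷ʳ)
open import Data.List.Relation.Unary.Any using (here; there)
open import Data.Nat as ℕ using (ℕ; zero; suc; _+_; _∸_; _⊓_; _≤_; _<_; z≤n; s≤s; s≤s⁻¹)
open import Data.Nat.Properties as ℕ
open import Data.Product using (∃; ∃-syntax; _×_; _,_; proj₁; proj₂)
open import Data.Rational as ℚ using (ℚ; 0ℚ; 1ℚ)
import Data.Rational.Properties as ℚ
open import Data.Rational.Solver using (module +-*-Solver)
open import Data.Sum as Sum using (_⊎_; inj₁; inj₂; [_,_]′)
open import Data.Vec using ([]; _∷_; tabulate) renaming (here to hereᵛ; there to thereᵛ)
open import Data.Vec.Functional using () renaming (_∷_ to _◂_)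
open import Data.Vec.Properties using (lookup∘tabulate; []=⇒lookup; lookup⇒[]=)
open import Function.Base using (_∘_; id; case_of_)
open import Function.Bundles using (_⇔_; mk⇔; module Equivalence)
open import Function.Definitions using (Injective; Surjective)
open import Level using (0ℓ)
open import Relation.Binary.Construct.Closure.ReflexiveTransitive using (ε; _◅_)
open import Relation.Binary.Definitions using (tri<; tri≈; tri>)
open import Relation.Binary.PropositionalEquality
open import Relation.Nullary using (¬_; Dec; yes; no; does; contradiction)
open import Relation.Nullary.Decidable using (_×-dec_; ¬?; dec-true; decidable-stable)
open import Relation.Unary using (Pred; Decidable)

open Equivalence using (to; from)
open +-*-Solver using (solve; con; _:=_; _:+_; _:*_; _:-_)

-- Finite sets and counting

-- The formula for λ(G) rests on monotonicity: supersets of forcing sets force and subsets of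
-- failing sets fail, so the sizes that count form the interval from z to n - b. A set of z - 1
-- vertices fails, hence z - 1 ≤ n - b, which keeps the truncated subtractions exact. Twins do not
-- depend on a drawing, whereas the forms must hold in every drawing. The geometry is therefore
-- reduced to one order condition, that the edges between the paths are monotone in the indices, and
-- the twins are located in an arbitrary drawing from this condition. Twins on the same path are
-- also twins of that path, which leaves the two vertices of an edge (b) or the ends of a path on
-- three vertices (c). Twins on different paths sit at opposite ends unless one of the paths is a
-- single vertex, which separates (d) from (a); a vertex facing an edge gives either a triangle,
-- which falls under (b), or a path. In the other direction a form in one drawing already exhibits
-- twins and excludes isolated vertices.

∈-tabulate : ∀ {n} {Q : Pred (Fin n) 0ℓ} (Q? : Decidable Q) {x} → x ∈ tabulate (does ∘ Q?) ⇔ Q x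
∈-tabulate Q? {x} = mk⇔ f g
  where
  f : x ∈ tabulate (does ∘ Q?) → _
  f x∈ with Q? x | trans (sym (lookup∘tabulate (does ∘ Q?) x)) ([]=⇒lookup x∈)
  ... | yes Qx | _ = Qx
  g : _ → x ∈ tabulate (does ∘ Q?)
  g Qx = lookup⇒[]= x _ (trans (lookup∘tabulate (does ∘ Q?) x) (dec-true (Q? x) Qx))

elements : ∀ {n} → Subset n → List (Fin n)
elements []            = []
elements (inside  ∷ p) = zero ∷ List.map suc (elements p)
elements (outside ∷ p) = List.map suc (elements p)

length-elements : ∀ {n} (p : Subset n) → length (elements p) ≡ ∣ p ∣
length-elements []            = refl
length-elements (inside  ∷ p) = cong suc (trans (length-map suc (elements p)) (length-elements p))
length-elements (outside ∷ p) = trans (length-map suc (elements p)) (length-elements p)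

∈-elements⁺ : ∀ {n} {p : Subset n} {x} → x ∈ p → x ∈ˡ elements p
∈-elements⁺ hereᵛ                      = here refl
∈-elements⁺ (thereᵛ {y = inside}  x∈p) = there (∈-map⁺ suc (∈-elements⁺ x∈p))
∈-elements⁺ (thereᵛ {y = outside} x∈p) = ∈-map⁺ suc (∈-elements⁺ x∈p)

∈-elements⁻ : ∀ {n} (p : Subset n) {x} → x ∈ˡ elements p → x ∈ p
∈-elements⁻ (inside  ∷ p) (here refl) = hereᵛ
∈-elements⁻ (inside  ∷ p) (there x∈) with ∈-map⁻ suc x∈
... | _ , y∈ , refl = thereᵛ (∈-elements⁻ p y∈)
∈-elements⁻ (outside ∷ p) x∈ with ∈-map⁻ suc x∈
... | _ , y∈ , refl = thereᵛ (∈-elements⁻ p y∈)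

fromList : ∀ {n} → List (Fin n) → Subset n
fromList []       = ⊥
fromList (x ∷ xs) = fromList xs ∪ ⁅ x ⁆

∣p∪⁅x⁆∣≤1+∣p∣ : ∀ {n} (p : Subset n) x → ∣ p ∪ ⁅ x ⁆ ∣ ≤ suc ∣ p ∣
∣p∪⁅x⁆∣≤1+∣p∣ (inside  ∷ p) zero    rewrite ∪-identityʳ p = n≤1+n _
∣p∪⁅x⁆∣≤1+∣p∣ (outside ∷ p) zero    rewrite ∪-identityʳ p = ≤-refl
∣p∪⁅x⁆∣≤1+∣p∣ (inside  ∷ p) (suc x) = s≤s (∣p∪⁅x⁆∣≤1+∣p∣ p x)
∣p∪⁅x⁆∣≤1+∣p∣ (outside ∷ p) (suc x) = ∣p∪⁅x⁆∣≤1+∣p∣ p x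

∣fromList∣≤length : ∀ {n} (xs : List (Fin n)) → ∣ fromList xs ∣ ≤ length xs
∣fromList∣≤length {n} []   = ≤-reflexive (∣⊥∣≡0 n)
∣fromList∣≤length (x ∷ xs) =
  ≤-trans (∣p∪⁅x⁆∣≤1+∣p∣ (fromList xs) x) (s≤s (∣fromList∣≤length xs))

∈-fromList⁺ : ∀ {n} {xs : List (Fin n)} {x} → x ∈ˡ xs → x ∈ fromList xs
∈-fromList⁺ {xs = y ∷ xs} (here refl) = q⊆p∪q (fromList xs) ⁅ y ⁆ (x∈⁅x⁆ y)
∈-fromList⁺ {xs = y ∷ xs} (there x∈) = p⊆p∪q ⁅ y ⁆ (∈-fromList⁺ x∈)

∣p∣+∣∁p∣≡n : ∀ {n} (p : Subset n) → ∣ p ∣ + ∣ ∁ p ∣ ≡ n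
∣p∣+∣∁p∣≡n p rewrite ∣∁p∣≡n∸∣p∣ p = m+[n∸m]≡n (∣p∣≤n p)

superset-of-size : ∀ {n} (p : Subset n) k → ∣ p ∣ ≤ k → k ≤ n → ∃[ q ] p ⊆ q × ∣ q ∣ ≡ k
superset-of-size []            zero    _        _         = [] , id , refl
superset-of-size (inside  ∷ p) (suc k) (s≤s ≤k) (s≤s k≤n) with superset-of-size p k ≤k k≤n
... | q , p⊆q , eq = inside ∷ q , in⊆in p⊆q , cong suc eq
superset-of-size {suc n} (outside ∷ p) k ≤k k≤n with k ℕ.≤? n
... | yes k≤n′ with superset-of-size p k ≤k k≤n′
...   | q , p⊆q , eq = outside ∷ q , out⊆ p⊆q , eq
superset-of-size {suc n} (outside ∷ p) k ≤k k≤n | no k≰n =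
  ⊤ , ⊆⊤ , trans (∣⊤∣≡n _) (≤-antisym (≰⇒> k≰n) k≤n)

subset-of-size : ∀ {n} (p : Subset n) k → k ≤ ∣ p ∣ → ∃[ q ] q ⊆ p × ∣ q ∣ ≡ k
subset-of-size {n} p         zero    _        = ⊥ , ⊥⊆ , ∣⊥∣≡0 n
subset-of-size (inside  ∷ p) (suc k) (s≤s k≤) with subset-of-size p k k≤
... | q , q⊆p , eq = inside ∷ q , in⊆in q⊆p , cong suc eq
subset-of-size (outside ∷ p) (suc k) k≤ with subset-of-size p (suc k) k≤
... | q , q⊆p , eq = outside ∷ q , out⊆ q⊆p , eq

-- Source of both z and b. The equivalence at every `k` packs membership and minimality into one
-- statement, which is the shape in which they are used.
least : ∀ {Q : ℕ → Set} → (∀ k → Dec (Q k)) → (∀ {j k} → j ≤ k → Q j → Q k) →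
        ∀ n → Q n → ∃[ z ] (∀ k → Q k ⇔ z ≤ k)
least Q? up zero    Q0 = 0 , λ k → mk⇔ (λ _ → z≤n) (λ _ → up z≤n Q0)
least {Q} Q? up (suc n) Qn with Q? 0
... | yes Q0 = 0 , λ k → mk⇔ (λ _ → z≤n) (λ _ → up z≤n Q0)
... | no ¬Q0 with least {Q ∘ suc} (Q? ∘ suc) (up ∘ s≤s) n Qn
...   | z , iff = suc z , λ where
  zero    → mk⇔ (λ Q0 → contradiction Q0 ¬Q0) (λ ())
  (suc k) → mk⇔ (s≤s ∘ to (iff k)) (from (iff k) ∘ s≤s⁻¹)

-- The bound `h` is exclusive, so the sizes from z to n - b are counted with `l` = z and `h` = 1 + n
-- - b, and an empty interval comes out as 0 by truncation.
length-filter-upTo : ∀ {Q : ℕ → Set} (Q? : ∀ k → Dec (Q k)) l h m →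
  (∀ k → k < m → Q k ⇔ (l ≤ k × k < h)) → length (filter Q? (upTo m)) ≡ (m ⊓ h) ∸ l
length-filter-upTo Q? l h zero    iff = sym (0∸n≡0 l)
length-filter-upTo Q? l h (suc m) iff =
  begin
    length (filter Q? (upTo (suc m)))
  ≡⟨ cong (length ∘ filter Q?) (upTo-∷ʳ m) ⟨
    length (filter Q? (upTo m List.++ m ∷ []))
  ≡⟨ cong length (filter-++ Q? (upTo m) (m ∷ [])) ⟩
    length (filter Q? (upTo m) List.++ filter Q? (m ∷ []))
  ≡⟨ length-++ (filter Q? (upTo m)) ⟩
    length (filter Q? (upTo m)) + length (filter Q? (m ∷ []))
  ≡⟨ cong (_+ length (filter Q? (m ∷ []))) (length-filter-upTo Q? l h m (λ k → iff k ∘ m<n⇒m<1+n)) ⟩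
    (m ⊓ h) ∸ l + length (filter Q? (m ∷ []))
  ≡⟨ last ⟩
    (suc m ⊓ h) ∸ l
  ∎
  where
  open ≡-Reasoning
  last : (m ⊓ h) ∸ l + length (filter Q? (m ∷ [])) ≡ (suc m ⊓ h) ∸ l
  last with Q? m
  ... | yes Qm with l≤m , m<h ← to (iff m ≤-refl) Qm
    rewrite m≤n⇒m⊓n≡m (<⇒≤ m<h) | m≤n⇒m⊓n≡m m<h = trans (+-comm _ 1) (sym (+-∸-assoc 1 l≤m))
  ... | no ¬Qm with l ℕ.≤? m
  ...   | no l≰m
    rewrite m≤n⇒m∸n≡0 (≤-trans (m⊓n≤m (suc m) h) (≰⇒> l≰m))
          | m≤n⇒m∸n≡0 (≤-trans (m⊓n≤m m h) (<⇒≤ (≰⇒> l≰m))) = refl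
  ...   | yes l≤m with m ℕ.<? h
  ...     | yes m<h = contradiction (from (iff m ≤-refl) (l≤m , m<h)) ¬Qm
  ...     | no m≮h
    rewrite m≥n⇒m⊓n≡n (≮⇒≥ m≮h) | m≥n⇒m⊓n≡n (m≤n⇒m≤1+n (≮⇒≥ m≮h)) = +-identityʳ _

-- Forcing closure, forts and the span

module _ {n} (G : Graph n) where
  open Graph G

  -- The final blue set as an inductive closure. It fixes no order of the forces and allows a vertex
  -- to be derived repeatedly, so forcing can be proved vertex by vertex, without a chain of
  -- subsets.
  data Derived (S : Pred (Fin n) 0ℓ) : Pred (Fin n) 0ℓ where
    seed   : ∀ {v} → S v → Derived S v
    forced : ∀ {u w} → Derived S u → u ~ w → (∀ x → u ~ x → x ≢ w → Derived S x) → Derived S w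

  Fort : Pred (Fin n) 0ℓ → Set
  Fort W = ∃ W × (∀ {v w} → ¬ W v → W w → v ~ w → ∃[ x ] x ≢ w × W x × v ~ x)

  -- Lists may repeat vertices and may be shorter than `k`. This makes the property upward closed in
  -- `k`, and its threshold is the minimum size; the same holds for `FortOf`.
  ForcedBy : ℕ → Set
  ForcedBy k = ∃[ xs ] length xs ≤ k × (∀ v → Derived (_∈ˡ xs) v)

  FortOf : ℕ → Set
  FortOf k = ∃[ ws ] length ws ≤ k × Fort (_∈ˡ ws)

  derived-mono : ∀ {S T} → (∀ {x} → S x → T x) → ∀ {v} → Derived S v → Derived T v
  derived-mono S⊆T (seed Sv)           = seed (S⊆T Sv)
  derived-mono S⊆T (forced d u~w rest) =
    forced (derived-mono S⊆T d) u~w λ x u~x x≢w → derived-mono S⊆T (rest x u~x x≢w)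

  -- Whoever forces the first vertex of the fort lies outside the fort and has a second neighbour in
  -- it, which would have to be blue before.
  derived∉fort : ∀ {S W} → Fort W → (∀ v → S v → ¬ W v) → ∀ {v} → Derived S v → ¬ W v
  derived∉fort fort S∩W (seed Sv) = S∩W _ Sv
  derived∉fort fort@(_ , two) S∩W (forced d u~w rest) Ww
    with x , x≢w , Wx , u~x ← two (derived∉fort fort S∩W d) Ww u~w =
    derived∉fort fort S∩W (rest x u~x x≢w) Wx

  zeroForcing⇒derived : ∀ {S B} → ZeroForcing G B → (∀ {v} → v ∈ B → Derived S v) →
                        ∀ v → Derived S v
  zeroForcing⇒derived ε B⊆ v = B⊆ ∈⊤
  zeroForcing⇒derived {S} {B} (force {u} {w} (u∈B , u~w , _ , only) ◅ steps) B⊆ =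
    zeroForcing⇒derived steps λ {v} v∈ →
      [ B⊆ , (λ v∈w → subst (Derived S) (sym (x∈⁅y⁆⇒x≡y w v∈w)) d-w) ]′
      (x∈p∪q⁻ B ⁅ w ⁆ v∈)
    where
    d-w : Derived S w
    d-w = forced (B⊆ u∈B) u~w λ x u~x x≢w →
      B⊆ (decidable-stable (x ∈? B) λ x∉B → x≢w (only x u~x x∉B))

  -- Forces are applied as long as there are any; the larger set still fails, because `B` could
  -- start with the same force. When no force is left, some vertex is white and no blue vertex has
  -- exactly one white neighbour, so the white vertices form the fort.
  ¬zeroForcing⇒fort : ∀ {B} → ¬ ZeroForcing G B → ∃[ C ] B ⊆ C × Fort (_∉ C)
  ¬zeroForcing⇒fort {B} ¬zf = go B (⊃-wellFounded B) ¬zf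
    where
    go : ∀ B → Acc _⊃_ B → ¬ ZeroForcing G B → ∃[ C ] B ⊆ C × Fort (_∉ C)
    go B (acc rec) ¬zf with any? (λ u → any? (forces? G B u))
    ... | yes (u , w , f@(_ , _ , w∉B , _))
      with C , B∪w⊆C , fort ← go (B ∪ ⁅ w ⁆)
        (rec (p⊆p∪q ⁅ w ⁆ , w , q⊆p∪q B ⁅ w ⁆ (x∈⁅x⁆ w) , w∉B)) (λ zf → ¬zf (force f ◅ zf)) =
      C , B∪w⊆C ∘ p⊆p∪q ⁅ w ⁆ , fort
    ... | no stuck = B , id , nonempty , two
      where
      nonempty : ∃ (_∉ B)
      nonempty with any? (λ x → ¬? (x ∈? B))
      ... | yes found = found
      ... | no  none  = contradiction (subst (ZeroForcing G) (sym B≡⊤) ε) ¬zf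
        where
        B≡⊤ : B ≡ ⊤
        B≡⊤ = ⊆-antisym ⊆⊤ (λ {x} _ → decidable-stable (x ∈? B) λ x∉B → none (x , x∉B))
      two : ∀ {v w} → ¬ v ∉ B → w ∉ B → v ~ w → ∃[ x ] x ≢ w × x ∉ B × v ~ x
      two {v} {w} v∈B w∉B v~w
        with any? (λ x → ¬? (x ≟ᶠ w) ×-dec ¬? (x ∈? B) ×-dec (v ~? x))
      ... | yes found = found
      ... | no  none  = contradiction
        (v , w , decidable-stable (v ∈? B) v∈B , v~w , w∉B ,
          λ x v~x x∉B → decidable-stable (x ≟ᶠ w) λ x≢w → none (x , x≢w , x∉B , v~x)) stuck

  fort⇒¬zeroForcing : ∀ {W B} → Fort W → (∀ v → v ∈ B → ¬ W v) → ¬ ZeroForcing G B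
  fort⇒¬zeroForcing fort@((w , Ww) , _) B∩W zf =
    derived∉fort fort B∩W (zeroForcing⇒derived zf seed w) Ww

  -- If `B` failed, it would miss a fort, and the derivations would enter that fort. The detour
  -- through forts spares arranging the derivations into a sequence of steps.
  derived⇒zeroForcing : ∀ {S B} → (∀ v → S v → v ∈ B) → (∀ v → Derived S v) → ZeroForcing G B
  derived⇒zeroForcing {B = B} S⊆B all with zeroForcing? G B
  ... | yes zf = zf
  ... | no ¬zf with C , B⊆C , fort@((w , w∉C) , _) ← ¬zeroForcing⇒fort ¬zf =
    contradiction w∉C (derived∉fort fort (λ v Sv v∉C → v∉C (B⊆C (S⊆B v Sv))) (all w))

  private
    ForcingSize FailedCosize : ℕ → Set
    ForcingSize k = ∃[ Z ] ∣ Z ∣ ≤ k × ZeroForcing G Z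
    FailedCosize k = ∃[ F ] n ≤ ∣ F ∣ + k × ¬ ZeroForcing G F

    forcedBy⇔ : ∀ k → ForcedBy k ⇔ ForcingSize k
    forcedBy⇔ k = mk⇔
      (λ (xs , ≤k , all) → fromList xs , ≤-trans (∣fromList∣≤length xs) ≤k ,
        derived⇒zeroForcing (λ _ → ∈-fromList⁺) all)
      (λ (Z , ≤k , zf) → elements Z , subst (_≤ k) (sym (length-elements Z)) ≤k ,
        zeroForcing⇒derived zf (seed ∘ ∈-elements⁺))

    fortOf⇔ : ∀ k → FortOf k ⇔ FailedCosize k
    fortOf⇔ k = mk⇔ f g
      where
      f : FortOf k → FailedCosize k
      f (ws , ≤k , fort) = ∁ (fromList ws) , size ,
        fort⇒¬zeroForcing fort (λ v v∈∁ v∈ws → x∈∁p⇒x∉p v∈∁ (∈-fromList⁺ v∈ws))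
        where
        open ≤-Reasoning
        size : n ≤ ∣ ∁ (fromList ws) ∣ + k
        size = begin
          n                                           ≡⟨ ∣p∣+∣∁p∣≡n (fromList ws) ⟨
          ∣ fromList ws ∣ + ∣ ∁ (fromList ws) ∣       ≤⟨ +-monoˡ-≤ _ (≤-trans (∣fromList∣≤length ws) ≤k) ⟩
          k + ∣ ∁ (fromList ws) ∣                     ≡⟨ +-comm k _ ⟩
          ∣ ∁ (fromList ws) ∣ + k                     ∎
      g : FailedCosize k → FortOf k
      g (F , ≤k , ¬zf) with C , F⊆C , (w , w∉C) , two ← ¬zeroForcing⇒fort ¬zf =
        elements (∁ C) , size , (w , in-fort w∉C) , λ v∉ w∈ v~w →
          let x , x≢w , x∉C , v~x = two (v∉ ∘ in-fort) (x∈∁p⇒x∉p (∈-elements⁻ (∁ C) w∈)) v~w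
          in x , x≢w , in-fort x∉C , v~x
        where
        in-fort : ∀ {x} → x ∉ C → x ∈ˡ elements (∁ C)
        in-fort = ∈-elements⁺ ∘ x∉p⇒x∈∁p
        size : length (elements (∁ C)) ≤ k
        size rewrite length-elements (∁ C) = +-cancelˡ-≤ ∣ C ∣ _ _
          (≤-trans (≤-reflexive (∣p∣+∣∁p∣≡n C)) (≤-trans ≤k (+-monoˡ-≤ k (p⊆q⇒∣p∣≤∣q∣ F⊆C))))

    ¬zeroForcing-⊥ : 1 ≤ n → ¬ ZeroForcing G ⊥
    ¬zeroForcing-⊥ (s≤s _) zf = case zeroForcing⇒derived {S = _∈ ⊥} zf seed zero of nothing-derived
      where
      nothing-derived : ∀ {v} → ¬ Derived (_∈ ⊥) v
      nothing-derived (seed v∈⊥)     = ∉⊥ v∈⊥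
      nothing-derived (forced d _ _) = nothing-derived d

  module _ (1≤n : 1 ≤ n) where
    private
      forcing : ∃[ z ] (∀ k → ForcingSize k ⇔ z ≤ k)
      forcing = least
        (λ k → anySubset? (λ Z → (∣ Z ∣ ℕ.≤? k) ×-dec zeroForcing? G Z))
        (λ j≤k (Z , ≤j , zf) → Z , ≤-trans ≤j j≤k , zf)
        n (⊤ , ≤-reflexive (∣⊤∣≡n n) , ε)

      failing : ∃[ b ] (∀ k → FailedCosize k ⇔ b ≤ k)
      failing = least
        (λ k → anySubset? (λ F → (n ℕ.≤? ∣ F ∣ + k) ×-dec ¬? (zeroForcing? G F)))
        (λ j≤k (F , ≤j , ¬zf) → F , ≤-trans ≤j (+-monoʳ-≤ ∣ F ∣ j≤k) , ¬zf)
        n (⊥ , m≤n+m n ∣ ⊥ {n} ∣ , ¬zeroForcing-⊥ 1≤n)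

    minForcing minFort : ℕ
    minForcing = proj₁ forcing
    minFort = proj₁ failing

    forcedBy⇔z≤ : ∀ k → ForcedBy k ⇔ minForcing ≤ k
    forcedBy⇔z≤ k = mk⇔ (to (proj₂ forcing k) ∘ to (forcedBy⇔ k))
                        (from (forcedBy⇔ k) ∘ from (proj₂ forcing k))

    fortOf⇔b≤ : ∀ k → FortOf k ⇔ minFort ≤ k
    fortOf⇔b≤ k = mk⇔ (to (proj₂ failing k) ∘ to (fortOf⇔ k))
                      (from (fortOf⇔ k) ∘ from (proj₂ failing k))

    1≤z : 1 ≤ minForcing
    1≤z = ≰⇒> λ z≤0 → case from (forcedBy⇔z≤ 0) z≤0 of λ where
      ([] , _ , all) → ¬zeroForcing-⊥ 1≤n (derived⇒zeroForcing (λ _ ()) all)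

    1≤b : 1 ≤ minFort
    1≤b = ≰⇒> λ b≤0 → case from (fortOf⇔b≤ 0) b≤0 of λ where
      ([] , _ , (_ , ()) , _)

    private
      fort≤n : minFort ≤ n
      fort≤n = to (proj₂ failing n) (⊥ , m≤n+m n ∣ ⊥ {n} ∣ , ¬zeroForcing-⊥ 1≤n)

      forcing≤n : minForcing ≤ n
      forcing≤n = to (proj₂ forcing n) (⊤ , ≤-reflexive (∣⊤∣≡n n) , ε)

      -- Some set has z - 1 vertices and fails by minimality of z, so b ≤ n - (z - 1). The bound
      -- rules out that the truncated difference in the span hides a deficit.
      z+b≤1+n : minForcing + minFort ≤ suc n
      z+b≤1+n with minForcing in eq
      ... | zero   = m≤n⇒m≤1+n fort≤n
      ... | suc z′ with superset-of-size ⊥ z′ (subst (_≤ z′) (sym (∣⊥∣≡0 n)) z≤n)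
                          (≤-trans (n≤1+n z′) (subst (_≤ n) eq forcing≤n))
      ...   | p , _ , ∣p∣≡z′ = s≤s (≤-trans
        (+-monoʳ-≤ z′ (to (proj₂ failing (n ∸ z′))
          (p , ≤-reflexive (sym (trans (cong (_+ (n ∸ z′)) ∣p∣≡z′) (m+[n∸m]≡n z′≤n))) , ¬zf)))
        (≤-reflexive (m+[n∸m]≡n z′≤n)))
        where
        z′≤n : z′ ≤ n
        z′≤n = ≤-trans (n≤1+n z′) (subst (_≤ n) eq forcing≤n)
        ¬zf : ¬ ZeroForcing G p
        ¬zf zf = 1+n≰n (subst (_≤ z′) eq (to (proj₂ forcing z′) (p , ≤-reflexive ∣p∣≡z′ , zf)))

      -- For sufficiency, a forcing set of at most `k` vertices is enlarged to size `k`, and a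
      -- failing set of at least n - b vertices is cut down to size `k`; monotonicity preserves both
      -- properties.
      spanSize⇔ : ∀ k → k < suc n → SpanSize G k ⇔ (minForcing ≤ k × k < suc n ∸ minFort)
      spanSize⇔ k (s≤s k≤n) = mk⇔ f g
        where
        f : SpanSize G k → minForcing ≤ k × k < suc n ∸ minFort
        f ((Z , ∣Z∣≡k , zf) , (F , ∣F∣≡k , ¬zf)) =
          to (proj₂ forcing k) (Z , ≤-reflexive ∣Z∣≡k , zf) ,
          m+n≤o⇒m≤o∸n (suc k) (s≤s (≤-trans
            (+-monoʳ-≤ k (to (proj₂ failing (n ∸ k))
              (F , ≤-reflexive (sym (trans (cong (_+ (n ∸ k)) ∣F∣≡k) (m+[n∸m]≡n k≤n))) , ¬zf)))
            (≤-reflexive (m+[n∸m]≡n k≤n))))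
        g : minForcing ≤ k × k < suc n ∸ minFort → SpanSize G k
        g (z≤k , k<) with from (proj₂ forcing k) z≤k | from (proj₂ failing minFort) ≤-refl
        ... | Z , ∣Z∣≤k , zf | F , n≤ , ¬zf
          with superset-of-size Z k ∣Z∣≤k k≤n | subset-of-size F k k≤∣F∣
          where
          k+b≤n : k + minFort ≤ n
          k+b≤n = s≤s⁻¹ (m≤o∸n⇒m+n≤o (suc k) (m≤n⇒m≤1+n fort≤n) k<)
          k≤∣F∣ : k ≤ ∣ F ∣
          k≤∣F∣ = +-cancelʳ-≤ minFort k ∣ F ∣ (≤-trans k+b≤n n≤)
        ... | Z′ , Z⊆Z′ , ∣Z′∣≡k | F′ , F′⊆F , ∣F′∣≡k =
          (Z′ , ∣Z′∣≡k , ZeroForcing-mono G Z⊆Z′ zf) ,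
          (F′ , ∣F′∣≡k , λ zf′ → ¬zf (ZeroForcing-mono G F′⊆F zf′))

    span+[z+b]≡1+n : span G + (minForcing + minFort) ≡ suc n
    span+[z+b]≡1+n = begin
      span G + (minForcing + minFort)
        ≡⟨ cong (_+ (minForcing + minFort))
             (length-filter-upTo (spanSize? G) minForcing (suc n ∸ minFort) (suc n) spanSize⇔) ⟩
      suc n ⊓ (suc n ∸ minFort) ∸ minForcing + (minForcing + minFort)
        ≡⟨ cong (λ m → m ∸ minForcing + (minForcing + minFort)) (m≥n⇒m⊓n≡n (m∸n≤m (suc n) minFort)) ⟩
      suc n ∸ minFort ∸ minForcing + (minForcing + minFort)
        ≡⟨ cong (_+ (minForcing + minFort))
             (trans (∸-+-assoc (suc n) minFort minForcing)
                    (cong (suc n ∸_) (+-comm minFort minForcing))) ⟩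
      suc n ∸ (minForcing + minFort) + (minForcing + minFort)
        ≡⟨ m∸n+n≡m z+b≤1+n ⟩
      suc n
        ∎
      where open ≡-Reasoning

    span+3≡n⇔z+b≡4 : (span G + 3 ≡ n) ⇔ (minForcing + minFort ≡ 4)
    span+3≡n⇔z+b≡4 = mk⇔
      (λ eq → +-cancelˡ-≡ (span G) _ _ (trans span+[z+b]≡1+n (trans (cong suc (sym eq)) (sym (+-suc _ 3)))))
      (λ eq → suc-injective (trans (sym (+-suc _ 3)) (trans (cong (span G +_) (sym eq)) span+[z+b]≡1+n)))

-- Forcing chains

_~[_]_ : ∀ {n} → Fin n → Graph n → Fin n → Set
x ~[ G ] y = Graph._~_ G x y

-- During forcing, p and q list the two chains from the newest vertex to the
-- oldest one, so all neighbours of a vertex of positive index are in the blue set B.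
record TwoPaths {n} (G : Graph n) (B : Subset n) (k l : ℕ) : Set where
  open Graph G
  field
    p           : Fin k → Fin n
    q           : Fin l → Fin n
    p-injective : Injective _≡_ _≡_ p
    q-injective : Injective _≡_ _≡_ q
    apart       : ∀ i j → p i ≢ q j
    p∈B         : ∀ i → p i ∈ B
    q∈B         : ∀ j → q j ∈ B
    covers      : ∀ {x} → x ∈ B → (∃[ i ] p i ≡ x) ⊎ (∃[ j ] q j ≡ x)
    p-induced   : ∀ i i′ → (i ~[ P k ] i′) ⇔ (p i ~ p i′)
    q-induced   : ∀ j j′ → (j ~[ P l ] j′) ⇔ (q j ~ q j′)
    ordered     : ∀ {i j i′ j′} → p i ~ q j → p i′ ~ q j′ → i F.< i′ → j F.≤ j′
    p-spent     : ∀ {i x} → 0 < toℕ i → p i ~ x → x ∈ B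
    q-spent     : ∀ {j x} → 0 < toℕ j → q j ~ x → x ∈ B

m+1+n≡o⇒m<o : ∀ {m n o} → m + suc n ≡ o → m < o
m+1+n≡o⇒m<o {m} {n} refl = m<m+n m (s≤s z≤n)

dedupe : ∀ {n} {a x : Fin n} → x ∈ˡ a ∷ a ∷ [] → x ∈ˡ a ∷ []
dedupe (here eq)  = here eq
dedupe (there x∈) = x∈

module _ {n} {G : Graph n} where
  open Graph G
  open TwoPaths

  ~⇒≢ : ∀ {x y} → x ~ y → x ≢ y
  ~⇒≢ x~y x≡y = irreflexive x≡y x~y

  swap-paths : ∀ {B k l} → TwoPaths G B k l → TwoPaths G B l k
  swap-paths C = record
    { p = q C ; q = p C ; p-injective = q-injective C ; q-injective = p-injective C
    ; apart = λ j i eq → apart C i j (sym eq) ; p∈B = q∈B C ; q∈B = p∈B C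
    ; covers = Sum.swap ∘ covers C ; p-induced = q-induced C ; q-induced = p-induced C
    ; ordered = λ e e′ j<j′ → ≮⇒≥ λ i′<i → <⇒≱ j<j′ (ordered C (symmetric e′) (symmetric e) i′<i)
    ; p-spent = q-spent C ; q-spent = p-spent C
    }

  empty-paths : TwoPaths G ⊥ 0 0
  empty-paths = record
    { p = λ () ; q = λ () ; p-injective = λ { {()} } ; q-injective = λ { {()} } ; apart = λ ()
    ; p∈B = λ () ; q∈B = λ () ; covers = λ x∈⊥ → contradiction x∈⊥ ∉⊥ ; p-induced = λ ()
    ; q-induced = λ () ; ordered = λ { {()} } ; p-spent = λ { {()} } ; q-spent = λ { {()} } }

  -- Serves both to start a chain and to lengthen one: for `k` = 0 the last two hypotheses are
  -- vacuous. No crossing arises because `w` was white: vertices of `q` with positive index have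
  -- only blue neighbours, so on that chain `w` can be adjacent to index 0 alone.
  prepend : ∀ {B k l w} (C : TwoPaths G B k l) → w ∉ B →
    (∀ i → (toℕ i ≡ 0) ⇔ (w ~ p C i)) →
    (∀ i x → p C i ~ x → x ∈ B ∪ ⁅ w ⁆) →
    TwoPaths G (B ∪ ⁅ w ⁆) (suc k) l
  prepend {B} {k} {l} {w} C w∉B w~p p-closed = record
    { p = w ◂ p C
    ; q = q C
    ; p-injective = λ {i} {i′} → inj i i′
    ; q-injective = q-injective C
    ; apart = λ where
        zero    j eq → w∉B (subst (_∈ B) (sym eq) (q∈B C j))
        (suc i) j eq → apart C i j eq
    ; p∈B = λ where
        zero    → q⊆p∪q B ⁅ w ⁆ (x∈⁅x⁆ w)
        (suc i) → p⊆p∪q ⁅ w ⁆ (p∈B C i)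
    ; q∈B = p⊆p∪q ⁅ w ⁆ ∘ q∈B C
    ; covers = λ x∈ → cov (x∈p∪q⁻ B ⁅ w ⁆ x∈)
    ; p-induced = ind
    ; q-induced = q-induced C
    ; ordered = λ {i} {j} {i′} {j′} → ord i j i′ j′
    ; p-spent = λ { {suc i} _ → p-closed i _ }
    ; q-spent = λ 0<j e → p⊆p∪q ⁅ w ⁆ (q-spent C 0<j e)
    }
    where
    inj : ∀ i i′ → (w ◂ p C) i ≡ (w ◂ p C) i′ → i ≡ i′
    inj zero    zero     eq = refl
    inj zero    (suc i′) eq = contradiction (subst (_∈ B) (sym eq) (p∈B C i′)) w∉B
    inj (suc i) zero     eq = contradiction (subst (_∈ B) eq (p∈B C i)) w∉B
    inj (suc i) (suc i′) eq = cong suc (p-injective C eq)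
    cov : ∀ {x} → x ∈ B ⊎ x ∈ ⁅ w ⁆ → (∃[ i ] (w ◂ p C) i ≡ x) ⊎ (∃[ j ] q C j ≡ x)
    cov (inj₁ x∈B) = Sum.map₁ (λ (i , eq) → suc i , eq) (covers C x∈B)
    cov (inj₂ x∈w) = inj₁ (zero , sym (x∈⁅y⁆⇒x≡y w x∈w))
    ind : ∀ i i′ → (i ~[ P (suc k) ] i′) ⇔ ((w ◂ p C) i ~ (w ◂ p C) i′)
    ind zero zero = mk⇔ (λ { (inj₁ ()) ; (inj₂ ()) }) (λ w~w → contradiction refl (~⇒≢ w~w))
    ind zero (suc i′) = mk⇔
      (λ { (inj₁ eq) → to (w~p i′) (suc-injective eq) ; (inj₂ ()) })
      (λ w~ → inj₁ (cong suc (from (w~p i′) w~)))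
    ind (suc i) zero = mk⇔
      (λ { (inj₁ ()) ; (inj₂ eq) → symmetric (to (w~p i) (suc-injective eq)) })
      (λ ~w → inj₂ (cong suc (from (w~p i) (symmetric ~w))))
    ind (suc i) (suc i′) = mk⇔
      (to (p-induced C i i′) ∘ Sum.map suc-injective suc-injective)
      (Sum.map (cong suc) (cong suc) ∘ from (p-induced C i i′))
    ord : ∀ i j i′ j′ → (w ◂ p C) i ~ q C j → (w ◂ p C) i′ ~ q C j′ → i F.< i′ → j F.≤ j′
    ord zero zero (suc i′) j′ e e′ _ = z≤n
    ord zero (suc j) (suc i′) j′ e e′ _ = contradiction (q-spent C (s≤s z≤n) (symmetric e)) w∉B
    ord (suc i) j (suc i′) j′ e e′ (s≤s i<i′) = ordered C e e′ i<i′

  -- Only the newest vertex of a chain can force, the older ones having no white neighbour.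
  -- Afterwards it is spent too, since `w` was its only white neighbour.
  extend-paths : ∀ {B k l w} (C : TwoPaths G B k l) {i} → Forces G B (p C i) w →
    ∃[ k′ ] TwoPaths G (B ∪ ⁅ w ⁆) k′ l
  extend-paths C {suc i} (_ , u~w , w∉B , _) = contradiction (p-spent C (s≤s z≤n) u~w) w∉B
  extend-paths {B} {suc k} {w = w} C {zero} (_ , u~w , w∉B , only) =
    suc (suc k) , prepend C w∉B newest closed
    where
    newest : ∀ i → (toℕ i ≡ 0) ⇔ (w ~ p C i)
    newest zero    = mk⇔ (λ _ → symmetric u~w) (λ _ → refl)
    newest (suc i) = mk⇔ (λ ()) λ e → contradiction (p-spent C (s≤s z≤n) (symmetric e)) w∉B
    closed : ∀ i x → p C i ~ x → x ∈ B ∪ ⁅ w ⁆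
    closed zero    x e with x ∈? B
    ... | yes x∈B = p⊆p∪q ⁅ w ⁆ x∈B
    ... | no  x∉B = q⊆p∪q B ⁅ w ⁆ (subst (_∈ ⁅ w ⁆) (sym (only x e x∉B)) (x∈⁅x⁆ w))
    closed (suc i) x e = p⊆p∪q ⁅ w ⁆ (p-spent C (s≤s z≤n) e)

  seed-path : ∀ {B l w} → TwoPaths G B 0 l → w ∉ B → TwoPaths G (B ∪ ⁅ w ⁆) 1 l
  seed-path C w∉B = prepend C w∉B (λ ()) (λ ())

  -- A chain never starts during forcing. The clause about `l ≡ 0` records this, and with one seed
  -- it leaves a single path.
  zeroForcing⇒paths : ∀ {B k l} → ZeroForcing G B → TwoPaths G B k l →
    ∃[ k′ ] ∃[ l′ ] TwoPaths G ⊤ k′ l′ × (l ≡ 0 → l′ ≡ 0)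
  zeroForcing⇒paths ε C = _ , _ , C , id
  zeroForcing⇒paths {l = l} (force {u} {w} f@(u∈B , _) ◅ steps) C with covers C u∈B
  ... | inj₁ (i , refl) with _ , C′ ← extend-paths C f = zeroForcing⇒paths steps C′
  ... | inj₂ (j , refl) with _ , C′ ← extend-paths (swap-paths C) f
    with k″ , l″ , C″ , _ ← zeroForcing⇒paths steps (swap-paths C′) =
    k″ , l″ , C″ , λ { refl → contradiction j λ () }

  forcedBy1⇒paths : ForcedBy G 1 → ∃[ k ] TwoPaths G ⊤ k 0
  forcedBy1⇒paths ([] , _ , all)
    with k , l , C , l≡0 ← zeroForcing⇒paths (derived⇒zeroForcing G (λ _ ()) all) empty-paths
    with refl ← l≡0 refl = k , C
  forcedBy1⇒paths (a ∷ [] , _ , all)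
    with k , l , C , l≡0 ← zeroForcing⇒paths
      (derived⇒zeroForcing G (λ _ → ∈-fromList⁺) all) (seed-path empty-paths ∉⊥)
    with refl ← l≡0 refl = k , C
  forcedBy1⇒paths (_ ∷ _ ∷ _ , s≤s () , _)

  forcedBy2⇒paths : ForcedBy G 2 → ∃[ k ] ∃[ l ] TwoPaths G ⊤ k l
  forcedBy2⇒paths (a ∷ b ∷ [] , _ , all) with a ≟ᶠ b
  ... | no a≢b
    with k , l , C , _ ← zeroForcing⇒paths (derived⇒zeroForcing G (λ _ → ∈-fromList⁺) all)
      (seed-path (swap-paths (seed-path empty-paths ∉⊥))
        (a≢b ∘ [ (λ a∈⊥ → contradiction a∈⊥ ∉⊥) , x∈⁅y⁆⇒x≡y b ]′ ∘ x∈p∪q⁻ ⊥ ⁅ b ⁆)) = k , l , C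
  ... | yes refl
    with k , C ← forcedBy1⇒paths (a ∷ [] , s≤s z≤n , λ v → derived-mono G dedupe (all v)) =
      k , 0 , C
  forcedBy2⇒paths ([] , _ , all) with k , C ← forcedBy1⇒paths ([] , z≤n , all) = k , 0 , C
  forcedBy2⇒paths (a ∷ [] , _ , all) with k , C ← forcedBy1⇒paths (a ∷ [] , s≤s z≤n , all) =
    k , 0 , C
  forcedBy2⇒paths (_ ∷ _ ∷ _ ∷ _ , s≤s (s≤s ()) , _)

  module _ {S : Pred (Fin n) 0ℓ} where

    private
      -- Vertex w of the first path is forced by its predecessor u, unless u still
      -- has a neighbour q j that is not derived yet.
      advance : ∀ {k l} (C : TwoPaths G ⊤ k l) b →
        (∀ j → toℕ j < b → Derived G S (q C j)) →
        (w : Fin k) → (∀ i → i F.< w → Derived G S (p C i)) →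
        ∀ {u} → toℕ w ≡ suc (toℕ u) → ¬ (∃[ j ] (p C u ~ q C j × b ≤ toℕ j)) →
        Derived G S (p C w)
      advance C b q-known w p-known {u} w≡1+u blocked =
        forced (p-known u (≤-reflexive (sym w≡1+u))) (to (p-induced C u w) (inj₁ w≡1+u)) rest
        where
        rest : ∀ x → p C u ~ x → x ≢ p C w → Derived G S x
        rest x u~x x≢w with covers C (∈⊤ {x = x})
        ... | inj₂ (j , refl) = q-known j (≰⇒> λ b≤j → blocked (j , u~x , b≤j))
        ... | inj₁ (i , refl) with from (p-induced C u i) u~x
        ...   | inj₁ i≡1+u =
              contradiction (cong (p C) (toℕ-injective (trans i≡1+u (sym w≡1+u)))) x≢w
        ...   | inj₂ u≡1+i =
              p-known i (≤-trans (≤-reflexive (sym u≡1+i)) (≤-trans (n≤1+n _) (≤-reflexive (sym w≡1+u))))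

      -- The second alternative keeps the edge that blocks the first path: it leaves the last
      -- derived vertex and ends at or beyond the front of the other path. Two such edges, one from
      -- each side, cross.
      advance? : ∀ {k l} (C : TwoPaths G ⊤ k l) → (∀ i → toℕ i ≡ 0 → Derived G S (p C i)) →
        ∀ a b → a < k →
        (∀ i → toℕ i < a → Derived G S (p C i)) → (∀ j → toℕ j < b → Derived G S (q C j)) →
        (∀ i → toℕ i < suc a → Derived G S (p C i)) ⊎
        (∃[ u ] ∃[ j ] suc (toℕ u) ≡ a × p C u ~ q C j × b ≤ toℕ j)
      advance? C p-seed zero b _ _ _ = inj₁ λ i i<1 → p-seed i (n<1⇒n≡0 i<1)
      advance? C p-seed (suc a) b a<k p-known q-known
        with any? (λ j → (p C u ~? q C j) ×-dec (b ℕ.≤? toℕ j))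
        where u = fromℕ< (<-trans (n<1+n a) a<k)
      ... | yes (j , u~j , b≤j) = inj₂ (_ , j , cong suc (toℕ-fromℕ< _) , u~j , b≤j)
      ... | no blocked = inj₁ λ i i<2+a → case m<1+n⇒m<n∨m≡n i<2+a of λ where
        (inj₁ i<1+a) → p-known i i<1+a
        (inj₂ i≡1+a) → advance C b q-known i
          (λ i′ i′<i → p-known i′ (subst (toℕ i′ <_) i≡1+a i′<i))
          (trans i≡1+a (cong suc (sym (toℕ-fromℕ< _)))) blocked

      -- Here `a` and `b` count the derived vertices at the start of the two paths, and `c` and `d`
      -- count the rest, so that every advance is a structural recursive call.
      sweep : ∀ {k l} (C : TwoPaths G ⊤ k l) →
        (∀ i → toℕ i ≡ 0 → Derived G S (p C i)) → (∀ j → toℕ j ≡ 0 → Derived G S (q C j)) →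
        ∀ a b c d → a + c ≡ k → b + d ≡ l →
        (∀ i → toℕ i < a → Derived G S (p C i)) → (∀ j → toℕ j < b → Derived G S (q C j)) →
        ∀ v → Derived G S v
      sweep C p-seed q-seed a b zero zero a+c≡k b+d≡l p-known q-known v with covers C (∈⊤ {x = v})
      ... | inj₁ (i , refl) =
            p-known i (subst (toℕ i <_) (trans (sym a+c≡k) (+-identityʳ a)) (toℕ<n i))
      ... | inj₂ (j , refl) =
            q-known j (subst (toℕ j <_) (trans (sym b+d≡l) (+-identityʳ b)) (toℕ<n j))
      sweep C p-seed q-seed a b zero (suc d) a+c≡k b+d≡l p-known q-known
        with advance? (swap-paths C) q-seed b a (m+1+n≡o⇒m<o b+d≡l) q-known p-known
      ... | inj₁ q-known′ = sweep C p-seed q-seed a (suc b) zero d a+c≡k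
        (trans (sym (+-suc b d)) b+d≡l) p-known q-known′
      ... | inj₂ (_ , i , _ , _ , a≤i) = contradiction
        (subst (toℕ i <_) (trans (sym a+c≡k) (+-identityʳ a)) (toℕ<n i)) (≤⇒≯ a≤i)
      sweep C p-seed q-seed a b (suc c) d a+c≡k b+d≡l p-known q-known
        with advance? C p-seed a b (m+1+n≡o⇒m<o a+c≡k) p-known q-known
      ... | inj₁ p-known′ =
            sweep C p-seed q-seed (suc a) b c d (trans (sym (+-suc a c)) a+c≡k) b+d≡l
        p-known′ q-known
      sweep C p-seed q-seed a b (suc c) zero a+c≡k b+d≡l p-known q-known | inj₂ (_ , j , _ , _ , b≤j) =
        contradiction (subst (toℕ j <_) (trans (sym b+d≡l) (+-identityʳ b)) (toℕ<n j)) (≤⇒≯ b≤j)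
      sweep C p-seed q-seed a b (suc c) (suc d) a+c≡k b+d≡l p-known q-known
        | inj₂ (u , j , 1+u≡a , u~j , b≤j)
        with advance? (swap-paths C) q-seed b a (m+1+n≡o⇒m<o b+d≡l) q-known p-known
      ... | inj₁ q-known′ = sweep C p-seed q-seed a (suc b) (suc c) d a+c≡k
        (trans (sym (+-suc b d)) b+d≡l) p-known q-known′
      -- Both sides are blocked: the edges join index `a` - 1 to `j` and `i` to `b` - 1 with `a` ≤
      -- `i`, so monotonicity gives `j` ≤ `b` - 1, against `b` ≤ `j`.
      ... | inj₂ (v , i , 1+v≡b , v~i , a≤i) = contradiction
        (ordered C u~j (symmetric v~i) (≤-trans (≤-reflexive 1+u≡a) a≤i))
        (<⇒≱ (≤-trans (≤-reflexive 1+v≡b) b≤j))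

    paths⇒derived : ∀ {k l} (C : TwoPaths G ⊤ k l) →
      (∀ i → toℕ i ≡ 0 → S (p C i)) → (∀ j → toℕ j ≡ 0 → S (q C j)) → ∀ v → Derived G S v
    paths⇒derived {k} {l} C p-seed q-seed =
      sweep C (λ i → seed ∘ p-seed i) (λ j → seed ∘ q-seed j) 0 0 k l refl refl (λ _ ()) (λ _ ())

  paths⇒forcedBy1 : ∀ {k} → TwoPaths G ⊤ k 0 → ForcedBy G 1
  paths⇒forcedBy1 {zero}  C = [] , z≤n , paths⇒derived C (λ ()) (λ ())
  paths⇒forcedBy1 {suc k} C =
    p C zero ∷ [] , s≤s z≤n , paths⇒derived C (λ { zero _ → here refl }) (λ ())

  paths⇒forcedBy2 : ∀ {k l} → TwoPaths G ⊤ (suc k) (suc l) → ForcedBy G 2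
  paths⇒forcedBy2 C = p C zero ∷ q C zero ∷ [] , s≤s (s≤s z≤n) ,
    paths⇒derived C (λ { zero _ → here refl }) (λ { zero _ → there (here refl) })

  ≅P⇒paths : ∀ {k} → G ≅ P k → TwoPaths G ⊤ k 0
  ≅P⇒paths {k} (f , (f-inj , f-surj) , adj) = record
    { p = g ; q = λ ()
    ; p-injective = λ {i} {i′} eq → trans (sym (f∘g i)) (trans (cong f eq) (f∘g i′))
    ; q-injective = λ { {()} } ; apart = λ _ () ; p∈B = λ _ → ∈⊤ ; q∈B = λ _ → ∈⊤
    ; covers = λ {x} _ → inj₁ (f x , f-inj (f∘g (f x)))
    ; p-induced = λ i i′ → mk⇔
        (λ e → from (adj (g i) (g i′)) (subst₂ (Graph._~_ (P k)) (sym (f∘g i)) (sym (f∘g i′)) e))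
        (λ e → subst₂ (Graph._~_ (P k)) (f∘g i) (f∘g i′) (to (adj (g i) (g i′)) e))
    ; q-induced = λ () ; ordered = λ { {j = ()} } ; p-spent = λ _ _ → ∈⊤ ; q-spent = λ _ _ → ∈⊤ }
    where
    g : Fin k → Fin n
    g i = proj₁ (f-surj i)
    f∘g : ∀ i → f (g i) ≡ i
    f∘g i = proj₂ (f-surj i) refl

  paths⇒≅P : ∀ {k} → TwoPaths G ⊤ k 0 → G ≅ P n
  paths⇒≅P {k} C = subst (λ m → G ≅ P m) k≡n
    (proj₁ ∘ index , (index-injective , surj) , λ x y → mk⇔
      (λ e → from (p-induced C (proj₁ (index x)) (proj₁ (index y)))
        (subst₂ _~_ (sym (proj₂ (index x))) (sym (proj₂ (index y))) e))
      (λ e → subst₂ _~_ (proj₂ (index x)) (proj₂ (index y)) (to (p-induced C _ _) e)))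
    where
    index : ∀ x → ∃[ i ] p C i ≡ x
    index x with covers C (∈⊤ {x = x})
    ... | inj₁ found = found
    index-injective : Injective _≡_ _≡_ (proj₁ ∘ index)
    index-injective {x} {y} eq =
      trans (sym (proj₂ (index x))) (trans (cong (p C) eq) (proj₂ (index y)))
    surj : Surjective _≡_ _≡_ (proj₁ ∘ index)
    surj i = p C i , λ { refl → p-injective C (proj₂ (index (p C i))) }
    k≡n : k ≡ n
    k≡n = ≤-antisym (injective⇒≤ (p-injective C)) (injective⇒≤ index-injective)

  isPath⇔forcedBy1 : IsPath G ⇔ ForcedBy G 1
  isPath⇔forcedBy1 = mk⇔ (paths⇒forcedBy1 ∘ ≅P⇒paths) (paths⇒≅P ∘ proj₂ ∘ forcedBy1⇒paths)

-- Segments between two parallel lines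

0<q-p : ∀ {p q} → p ℚ.< q → 0ℚ ℚ.< q ℚ.- p
0<q-p {p} {q} p<q = subst (ℚ._< q ℚ.- p) (ℚ.+-inverseʳ p) (ℚ.+-monoˡ-< (ℚ.- p) p<q)

0≤q-p : ∀ {p q} → p ℚ.≤ q → 0ℚ ℚ.≤ q ℚ.- p
0≤q-p {p} {q} p≤q = subst (ℚ._≤ q ℚ.- p) (ℚ.+-inverseʳ p) (ℚ.+-monoˡ-≤ (ℚ.- p) p≤q)

*-nonNeg : ∀ {p q} → 0ℚ ℚ.≤ p → 0ℚ ℚ.≤ q → 0ℚ ℚ.≤ p ℚ.* q
*-nonNeg {p} {q} 0≤p 0≤q =
  subst (ℚ._≤ p ℚ.* q) (ℚ.*-zeroʳ p) (ℚ.*-monoˡ-≤-nonNeg p {{ℚ.nonNegative 0≤p}} 0≤q)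

*-pos : ∀ {p q} → 0ℚ ℚ.< p → 0ℚ ℚ.< q → 0ℚ ℚ.< p ℚ.* q
*-pos {p} {q} 0<p 0<q =
  subst (ℚ._< p ℚ.* q) (ℚ.*-zeroʳ p) (ℚ.*-monoʳ-<-pos p {{ℚ.positive 0<p}} 0<q)

combine : ∀ e c a b s t d →
  e ℚ.* (a ℚ.+ s ℚ.* d) ℚ.+ c ℚ.* (b ℚ.+ t ℚ.* d) ≡
  (e ℚ.* a ℚ.+ c ℚ.* b) ℚ.+ (e ℚ.* s ℚ.+ c ℚ.* t) ℚ.* d
combine = solve 7 (λ e c a b s t d →
  e :* (a :+ s :* d) :+ c :* (b :+ t :* d) :=
  (e :* a :+ c :* b) :+ (e :* s :+ c :* t) :* d) refl

-- Isolates the gap between the two segments at the common ratio `c`. Setting the gap to 0 and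
-- solving for `c` gives the ratio chosen in `segments-cross`.
balance : ∀ c s s′ t t′ →
  (1ℚ ℚ.- c) ℚ.* s ℚ.+ c ℚ.* t ≡
  ((1ℚ ℚ.- c) ℚ.* s′ ℚ.+ c ℚ.* t′) ℚ.+ (c ℚ.* ((s′ ℚ.- s) ℚ.+ (t ℚ.- t′)) ℚ.- (s′ ℚ.- s))
balance = solve 5 (λ c s s′ t t′ →
  (con 1ℚ :- c) :* s :+ c :* t :=
  ((con 1ℚ :- c) :* s′ :+ c :* t′) :+ (c :* ((s′ :- s) :+ (t :- t′)) :- (s′ :- s))) refl

-- The segments from s to t and from s′ to t′ divide at the ratio
-- (s′ - s) : (t - t′).
segments-cross : ∀ (a b d : Point) {s s′ t t′} → s ℚ.< s′ → t′ ℚ.< t →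
  ∃[ p ] OnSegment (a ⊕ (s ⊙ d)) (b ⊕ (t ⊙ d)) p × OnSegment (a ⊕ (s′ ⊙ d)) (b ⊕ (t′ ⊙ d)) p
segments-cross (a₁ , a₂) (b₁ , b₂) (d₁ , d₂) {s} {s′} {t} {t′} s<s′ t′<t =
  _ , (c , 0≤c , c≤1 , refl) , (c , 0≤c , c≤1 , cong₂ _,_ (same a₁ b₁ d₁) (same a₂ b₂ d₂))
  where
  α β γ : ℚ
  α = s′ ℚ.- s
  β = t ℚ.- t′
  γ = α ℚ.+ β
  0<γ : 0ℚ ℚ.< γ
  0<γ = ℚ.+-mono-< (0<q-p s<s′) (0<q-p t′<t)
  instance
    γ-positive : ℚ.Positive γ
    γ-positive = ℚ.positive 0<γ
    γ-nonZero : ℚ.NonZero γ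
    γ-nonZero = ℚ.pos⇒nonZero γ
  c : ℚ
  c = α ℚ.* ℚ.1/ γ
  cγ≡α : c ℚ.* γ ≡ α
  cγ≡α = trans (ℚ.*-assoc α (ℚ.1/ γ) γ) (trans (cong (α ℚ.*_) (ℚ.*-inverseˡ γ)) (ℚ.*-identityʳ α))
  0≤c : 0ℚ ℚ.≤ c
  0≤c = *-nonNeg (ℚ.<⇒≤ (0<q-p s<s′)) (ℚ.<⇒≤ (ℚ.positive⁻¹ (ℚ.1/ γ) {{ℚ.1/pos⇒pos γ}}))
  c≤1 : c ℚ.≤ 1ℚ
  c≤1 = ℚ.*-cancelʳ-≤-pos γ (subst₂ ℚ._≤_ (sym cγ≡α) (sym (ℚ.*-identityˡ γ))
    (subst (ℚ._≤ γ) (ℚ.+-identityʳ α) (ℚ.+-monoʳ-≤ α (ℚ.<⇒≤ (0<q-p t′<t)))))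
  level : (1ℚ ℚ.- c) ℚ.* s ℚ.+ c ℚ.* t ≡ (1ℚ ℚ.- c) ℚ.* s′ ℚ.+ c ℚ.* t′
  level = begin
    (1ℚ ℚ.- c) ℚ.* s ℚ.+ c ℚ.* t   ≡⟨ balance c s s′ t t′ ⟩
    R ℚ.+ (c ℚ.* γ ℚ.- α)          ≡⟨ cong (R ℚ.+_) (trans (cong (ℚ._- α) cγ≡α) (ℚ.+-inverseʳ α)) ⟩
    R ℚ.+ 0ℚ                       ≡⟨ ℚ.+-identityʳ R ⟩
    R                              ∎
    where
    open ≡-Reasoning
    R = (1ℚ ℚ.- c) ℚ.* s′ ℚ.+ c ℚ.* t′
  same : ∀ a b d → (1ℚ ℚ.- c) ℚ.* (a ℚ.+ s ℚ.* d) ℚ.+ c ℚ.* (b ℚ.+ t ℚ.* d) ≡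
                   (1ℚ ℚ.- c) ℚ.* (a ℚ.+ s′ ℚ.* d) ℚ.+ c ℚ.* (b ℚ.+ t′ ℚ.* d)
  same a b d = trans (combine (1ℚ ℚ.- c) c a b s t d)
    (trans (cong (λ x → (1ℚ ℚ.- c) ℚ.* a ℚ.+ c ℚ.* b ℚ.+ x ℚ.* d) level)
      (sym (combine (1ℚ ℚ.- c) c a b s′ t′ d)))

-- Rungs between the lines of height 0 and 1

ℕ⇒ℚ : ℕ → ℚ
ℕ⇒ℚ zero    = 0ℚ
ℕ⇒ℚ (suc m) = 1ℚ ℚ.+ ℕ⇒ℚ m

ℕ⇒ℚ<ℕ⇒ℚ-suc : ∀ m → ℕ⇒ℚ m ℚ.< ℕ⇒ℚ (suc m)
ℕ⇒ℚ<ℕ⇒ℚ-suc m = subst (ℚ._< ℕ⇒ℚ (suc m)) (ℚ.+-identityˡ _) (ℚ.+-monoˡ-< (ℕ⇒ℚ m) (ℚ.positive⁻¹ 1ℚ))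

ℕ⇒ℚ-mono-< : ∀ {m n} → m ℕ.< n → ℕ⇒ℚ m ℚ.< ℕ⇒ℚ n
ℕ⇒ℚ-mono-< {m} {suc n} (s≤s m≤n) with ℕ.m≤n⇒m<n∨m≡n m≤n
... | inj₁ m<n  = ℚ.<-trans (ℕ⇒ℚ-mono-< m<n) (ℕ⇒ℚ<ℕ⇒ℚ-suc n)
... | inj₂ refl = ℕ⇒ℚ<ℕ⇒ℚ-suc m

ℕ⇒ℚ-mono-≤ : ∀ {m n} → m ℕ.≤ n → ℕ⇒ℚ m ℚ.≤ ℕ⇒ℚ n
ℕ⇒ℚ-mono-≤ m≤n with ℕ.m≤n⇒m<n∨m≡n m≤n
... | inj₁ m<n  = ℚ.<⇒≤ (ℕ⇒ℚ-mono-< m<n)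
... | inj₂ refl = ℚ.≤-refl

-- Kept as base point plus multiple of the direction, so that the equations for points on the lines
-- in `StandardDrawing` need no arithmetic.
bottom top : ℚ → Point
bottom s = (0ℚ , 0ℚ) ⊕ (s ⊙ (1ℚ , 0ℚ))
top    t = (0ℚ , 1ℚ) ⊕ (t ⊙ (1ℚ , 0ℚ))

-- The height of a point on a rung is its ratio `c`, so two rungs can meet only at equal ratios.
on-rung : ∀ c s t → ((1ℚ ℚ.- c) ⊙ bottom s) ⊕ (c ⊙ top t) ≡ ((1ℚ ℚ.- c) ℚ.* s ℚ.+ c ℚ.* t , c)
on-rung c s t = cong₂ _,_
  (solve 3 (λ c s t → (con 1ℚ :- c) :* (con 0ℚ :+ s :* con 1ℚ) :+ c :* (con 0ℚ :+ t :* con 1ℚ) :=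
                      (con 1ℚ :- c) :* s :+ c :* t) refl c s t)
  (solve 3 (λ c s t → (con 1ℚ :- c) :* (con 0ℚ :+ s :* con 0ℚ) :+ c :* (con 1ℚ :+ t :* con 0ℚ) :=
                      c) refl c s t)

rung-bottom : ∀ s t → ((1ℚ ℚ.- 0ℚ) ⊙ bottom s) ⊕ (0ℚ ⊙ top t) ≡ bottom s
rung-bottom s t = trans (on-rung 0ℚ s t) (cong₂ _,_
  (solve 2 (λ s t → (con 1ℚ :- con 0ℚ) :* s :+ con 0ℚ :* t := con 0ℚ :+ s :* con 1ℚ) refl s t)
  (solve 1 (λ s → con 0ℚ := con 0ℚ :+ s :* con 0ℚ) refl s))

rung-top : ∀ s t → ((1ℚ ℚ.- 1ℚ) ⊙ bottom s) ⊕ (1ℚ ⊙ top t) ≡ top t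
rung-top s t = trans (on-rung 1ℚ s t) (cong₂ _,_
  (solve 2 (λ s t → (con 1ℚ :- con 1ℚ) :* s :+ con 1ℚ :* t := con 0ℚ :+ t :* con 1ℚ) refl s t)
  (solve 1 (λ t → con 1ℚ := con 1ℚ :+ t :* con 0ℚ) refl t))

≤∧≢⇒<ᵠ : ∀ {p q} → p ℚ.≤ q → p ≢ q → p ℚ.< q
≤∧≢⇒<ᵠ {p} {q} p≤q p≢q with ℚ.<-cmp p q
... | tri< p<q _ _ = p<q
... | tri≈ _ p≡q _ = contradiction p≡q p≢q
... | tri> _ _ q<p = contradiction (ℚ.<-≤-trans q<p p≤q) (ℚ.<-irrefl refl)

level-differences : ∀ c s s′ t t′ →
  (1ℚ ℚ.- c) ℚ.* (s′ ℚ.- s) ℚ.+ c ℚ.* (t′ ℚ.- t) ≡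
  ((1ℚ ℚ.- c) ℚ.* s′ ℚ.+ c ℚ.* t′) ℚ.- ((1ℚ ℚ.- c) ℚ.* s ℚ.+ c ℚ.* t)
level-differences = solve 5 (λ c s s′ t t′ →
  (con 1ℚ :- c) :* (s′ :- s) :+ c :* (t′ :- t) :=
  ((con 1ℚ :- c) :* s′ :+ c :* t′) :- ((con 1ℚ :- c) :* s :+ c :* t)) refl

-- The horizontal gap at height `c` combines s′ - s and t′ - t with the weights 1 - c and c, all
-- nonnegative. It is 0 only if both terms are, so different lower ends force c = 1 and different
-- upper ends force c = 0.
rungs-level : ∀ {c s s′ t t′} → 0ℚ ℚ.≤ c → c ℚ.≤ 1ℚ → s ℚ.≤ s′ → t ℚ.≤ t′ →
  (1ℚ ℚ.- c) ℚ.* s ℚ.+ c ℚ.* t ≡ (1ℚ ℚ.- c) ℚ.* s′ ℚ.+ c ℚ.* t′ →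
  (s ≡ s′ × t ≡ t′) ⊎ (s ≡ s′ × c ≡ 0ℚ) ⊎ (t ≡ t′ × c ≡ 1ℚ)
rungs-level {c} {s} {s′} {t} {t′} 0≤c c≤1 s≤s′ t≤t′ level = by-cases (s ℚ.≟ s′) (t ℚ.≟ t′)
  where
  sum≡0 : (1ℚ ℚ.- c) ℚ.* (s′ ℚ.- s) ℚ.+ c ℚ.* (t′ ℚ.- t) ≡ 0ℚ
  sum≡0 = trans (level-differences c s s′ t t′)
    (trans (cong (λ x → x ℚ.- ((1ℚ ℚ.- c) ℚ.* s ℚ.+ c ℚ.* t)) (sym level))
      (ℚ.+-inverseʳ ((1ℚ ℚ.- c) ℚ.* s ℚ.+ c ℚ.* t)))
  s≢s′⇒c≡1 : s ≢ s′ → c ≡ 1ℚ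
  s≢s′⇒c≡1 s≢s′ with c ℚ.≟ 1ℚ
  ... | yes c≡1 = c≡1
  ... | no  c≢1 = contradiction (sym sum≡0) (ℚ.<⇒≢
    (ℚ.+-mono-<-≤ (*-pos (0<q-p (≤∧≢⇒<ᵠ c≤1 c≢1)) (0<q-p (≤∧≢⇒<ᵠ s≤s′ s≢s′)))
                  (*-nonNeg 0≤c (0≤q-p t≤t′))))
  t≢t′⇒c≡0 : t ≢ t′ → c ≡ 0ℚ
  t≢t′⇒c≡0 t≢t′ with c ℚ.≟ 0ℚ
  ... | yes c≡0 = c≡0
  ... | no  c≢0 = contradiction (sym sum≡0) (ℚ.<⇒≢
    (ℚ.+-mono-≤-< (*-nonNeg (0≤q-p c≤1) (0≤q-p s≤s′))
                  (*-pos (≤∧≢⇒<ᵠ 0≤c (c≢0 ∘ sym)) (0<q-p (≤∧≢⇒<ᵠ t≤t′ t≢t′)))))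
  by-cases : Dec (s ≡ s′) → Dec (t ≡ t′) →
    (s ≡ s′ × t ≡ t′) ⊎ (s ≡ s′ × c ≡ 0ℚ) ⊎ (t ≡ t′ × c ≡ 1ℚ)
  by-cases (yes s≡s′) (yes t≡t′) = inj₁ (s≡s′ , t≡t′)
  by-cases (yes s≡s′) (no t≢t′)  = inj₂ (inj₁ (s≡s′ , t≢t′⇒c≡0 t≢t′))
  by-cases (no s≢s′)  (yes t≡t′) = inj₂ (inj₂ (t≡t′ , s≢s′⇒c≡1 s≢s′))
  by-cases (no s≢s′)  (no t≢t′)  =
    contradiction (trans (sym (t≢t′⇒c≡0 t≢t′)) (s≢s′⇒c≡1 s≢s′)) λ ()

rungs-meet : ∀ {s s′ t t′ p} → s ℚ.≤ s′ → t ℚ.≤ t′ →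
  OnSegment (bottom s) (top t) p → OnSegment (bottom s′) (top t′) p →
  (s ≡ s′ × t ≡ t′) ⊎ (s ≡ s′ × p ≡ bottom s) ⊎ (t ≡ t′ × p ≡ top t)
rungs-meet {s} {s′} {t} {t′} {p} s≤s′ t≤t′ (c , 0≤c , c≤1 , p≡) (c′ , _ , _ , p≡′) =
  [ inj₁ , inj₂ ∘ [ inj₁ ∘ at-bottom , inj₂ ∘ at-top ]′ ]′ (rungs-level 0≤c c≤1 s≤s′ t≤t′ level)
  where
  same : ((1ℚ ℚ.- c) ℚ.* s ℚ.+ c ℚ.* t , c) ≡ ((1ℚ ℚ.- c′) ℚ.* s′ ℚ.+ c′ ℚ.* t′ , c′)
  same = trans (sym (on-rung c s t)) (trans (sym p≡) (trans p≡′ (on-rung c′ s′ t′)))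
  level : (1ℚ ℚ.- c) ℚ.* s ℚ.+ c ℚ.* t ≡ (1ℚ ℚ.- c) ℚ.* s′ ℚ.+ c ℚ.* t′
  level = trans (cong proj₁ same)
    (cong (λ c → (1ℚ ℚ.- c) ℚ.* s′ ℚ.+ c ℚ.* t′) (sym (cong proj₂ same)))
  at-bottom : s ≡ s′ × c ≡ 0ℚ → s ≡ s′ × p ≡ bottom s
  at-bottom (s≡s′ , c≡0) = s≡s′ ,
    trans p≡ (trans (cong (λ c → ((1ℚ ℚ.- c) ⊙ bottom s) ⊕ (c ⊙ top t)) c≡0) (rung-bottom s t))
  at-top : t ≡ t′ × c ≡ 1ℚ → t ≡ t′ × p ≡ top t
  at-top (t≡t′ , c≡1) = t≡t′ ,
    trans p≡ (trans (cong (λ c → ((1ℚ ℚ.- c) ⊙ bottom s) ⊕ (c ⊙ top t)) c≡1) (rung-top s t))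

-- Standard drawings

module _ {n} {G : Graph n} where
  open Graph G
  open TwoPaths

  -- Edges in inverted order would meet, and in a standard drawing edges that meet share an end,
  -- whereas these have different ends on both lines.
  drawing⇒paths : (D : StandardDrawing G) →
    TwoPaths G ⊤ (StandardDrawing.k₁ D) (StandardDrawing.k₂ D)
  drawing⇒paths D = record
    { p = vertex path₁ ; q = vertex path₂
    ; p-injective = PathOrder.injective path₁ ; q-injective = PathOrder.injective path₂
    ; apart = λ i j eq → ∉⊥ (subst (vertex path₁ i ∈_) disjoint
        (x∈p∩q⁺ (∈V₁ i , subst (_∈ V₂) (sym eq) (∈V₂ j))))
    ; p∈B = λ _ → ∈⊤ ; q∈B = λ _ → ∈⊤
    ; covers = λ {x} x∈⊤ → Sum.map (to (PathOrder.image path₁ x)) (to (PathOrder.image path₂ x))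
        (x∈p∪q⁻ V₁ V₂ (subst (x ∈_) (sym cover) x∈⊤))
    ; p-induced = PathOrder.induced path₁ ; q-induced = PathOrder.induced path₂
    ; ordered = λ {i} {j} {i′} {j′} e e′ i<i′ → ℕ.≮⇒≥ (crossing e e′ i<i′)
    ; p-spent = λ _ _ → ∈⊤ ; q-spent = λ _ _ → ∈⊤
    }
    where
    open StandardDrawing D
    ∈V₁ : ∀ i → vertex path₁ i ∈ V₁
    ∈V₁ i = from (PathOrder.image path₁ _) (i , refl)
    ∈V₂ : ∀ j → vertex path₂ j ∈ V₂
    ∈V₂ j = from (PathOrder.image path₂ _) (j , refl)
    crossing : ∀ {i j i′ j′} → vertex path₁ i ~ vertex path₂ j → vertex path₁ i′ ~ vertex path₂ j′ →
      i F.< i′ → ¬ j′ F.< j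
    crossing {i} {j} {i′} {j′} e e′ i<i′ j′<j =
      meets (segments-cross a b d (s-increasing i<i′) (t-increasing j′<j))
      where
      x≢x′ : vertex path₁ i ≢ vertex path₁ i′
      x≢x′ eq = F.<⇒≢ i<i′ (PathOrder.injective path₁ eq)
      y≢y′ : vertex path₂ j ≢ vertex path₂ j′
      y≢y′ eq = F.<⇒≢ j′<j (sym (PathOrder.injective path₂ eq))
      meets : ¬ (∃[ pt ] OnSegment (a ⊕ (s i ⊙ d)) (b ⊕ (t j ⊙ d)) pt ×
                         OnSegment (a ⊕ (s i′ ⊙ d)) (b ⊕ (t j′ ⊙ d)) pt)
      meets (pt , on , on′) = [ x≢x′ ∘ proj₁ , y≢y′ ∘ proj₁ ]′
        (noncrossing (∈V₁ i) (∈V₂ j) (∈V₁ i′) (∈V₂ j′) e e′ (x≢x′ ∘ proj₁) pt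
          (subst₂ (λ x y → OnSegment x y pt) (sym (on-line₁ i)) (sym (on-line₂ j)) on)
          (subst₂ (λ x y → OnSegment x y pt) (sym (on-line₁ i′)) (sym (on-line₂ j′)) on′))

  -- Indices serve as abscissas. Monotone edges are ordered alike on both lines, up to exchanging
  -- the two edges, and this is the situation of `rungs-meet`.
  paths⇒drawing : ∀ {k l} → TwoPaths G ⊤ (suc k) (suc l) → StandardDrawing G
  paths⇒drawing {k} {l} C = record
    { V₁ = V₁ ; V₂ = V₂
    ; cover = ⊆-antisym ⊆⊤ λ x∈⊤ → x∈p∪q⁺
        (Sum.map (from (∈-tabulate in₁?)) (from (∈-tabulate in₂?)) (covers C x∈⊤))
    ; disjoint = ⊆-antisym (λ x∈ → contradiction (both x∈) λ ((i , p≡x) , (j , q≡x)) →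
        apart C i j (trans p≡x (sym q≡x))) ⊥⊆
    ; path₁ = record { vertex = p C ; nonempty = s≤s z≤n ; injective = p-injective C
                     ; image = λ x → ∈-tabulate in₁? ; induced = p-induced C }
    ; path₂ = record { vertex = q C ; nonempty = s≤s z≤n ; injective = q-injective C
                     ; image = λ x → ∈-tabulate in₂? ; induced = q-induced C }
    ; position = λ x → place (covers C (∈⊤ {x = x}))
    ; a = 0ℚ , 0ℚ ; b = 0ℚ , 1ℚ ; d = 1ℚ , 0ℚ
    ; distinct-lines = λ ()
    ; s = ℕ⇒ℚ ∘ toℕ ; t = ℕ⇒ℚ ∘ toℕ
    ; s-increasing = ℕ⇒ℚ-mono-< ; t-increasing = ℕ⇒ℚ-mono-<
    ; on-line₁ = on-line₁ ; on-line₂ = on-line₂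
    ; noncrossing = λ x∈ y∈ x′∈ y′∈ → noncrossing (to (∈-tabulate in₁?) x∈) (to (∈-tabulate in₂?) y∈)
        (to (∈-tabulate in₁?) x′∈) (to (∈-tabulate in₂?) y′∈)
    }
    where
    in₁? : Decidable (λ x → ∃[ i ] p C i ≡ x)
    in₁? x = any? (λ i → p C i ≟ᶠ x)
    in₂? : Decidable (λ x → ∃[ j ] q C j ≡ x)
    in₂? x = any? (λ j → q C j ≟ᶠ x)
    V₁ V₂ : Subset n
    V₁ = tabulate (does ∘ in₁?)
    V₂ = tabulate (does ∘ in₂?)
    both : ∀ {x} → x ∈ V₁ ∩ V₂ → (∃[ i ] p C i ≡ x) × (∃[ j ] q C j ≡ x)
    both x∈ with x∈₁ , x∈₂ ← x∈p∩q⁻ V₁ V₂ x∈ = to (∈-tabulate in₁?) x∈₁ , to (∈-tabulate in₂?) x∈₂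
    place : ∀ {x} → (∃[ i ] p C i ≡ x) ⊎ (∃[ j ] q C j ≡ x) → Point
    place (inj₁ (i , _)) = bottom (ℕ⇒ℚ (toℕ i))
    place (inj₂ (j , _)) = top (ℕ⇒ℚ (toℕ j))
    position : Fin n → Point
    position x = place (covers C (∈⊤ {x = x}))
    on-line₁ : ∀ i → position (p C i) ≡ bottom (ℕ⇒ℚ (toℕ i))
    on-line₁ i with covers C (∈⊤ {x = p C i})
    ... | inj₁ (i′ , eq) = cong (bottom ∘ ℕ⇒ℚ ∘ toℕ) (p-injective C eq)
    ... | inj₂ (j , eq)  = contradiction (sym eq) (apart C i j)
    on-line₂ : ∀ j → position (q C j) ≡ top (ℕ⇒ℚ (toℕ j))
    on-line₂ j with covers C (∈⊤ {x = q C j})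
    ... | inj₁ (i , eq)  = contradiction eq (apart C i j)
    ... | inj₂ (j′ , eq) = cong (top ∘ ℕ⇒ℚ ∘ toℕ) (q-injective C eq)
    ℕ⇒ℚ∘toℕ-injective : ∀ {m} {i i′ : Fin m} → ℕ⇒ℚ (toℕ i) ≡ ℕ⇒ℚ (toℕ i′) → i ≡ i′
    ℕ⇒ℚ∘toℕ-injective {m} {i} {i′} eq with F.<-cmp i i′
    ... | tri< i<i′ _ _ = contradiction eq (ℚ.<⇒≢ (ℕ⇒ℚ-mono-< i<i′))
    ... | tri≈ _ i≡i′ _ = i≡i′
    ... | tri> _ _ i′<i = contradiction (sym eq) (ℚ.<⇒≢ (ℕ⇒ℚ-mono-< i′<i))
    Meet : Fin (suc k) → Fin (suc l) → Fin (suc k) → Fin (suc l) → Set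
    Meet i j i′ j′ = ∀ pt → OnSegment (bottom (ℕ⇒ℚ (toℕ i))) (top (ℕ⇒ℚ (toℕ j))) pt →
       OnSegment (bottom (ℕ⇒ℚ (toℕ i′))) (top (ℕ⇒ℚ (toℕ j′))) pt →
       (i ≡ i′ × j ≡ j′) ⊎ (i ≡ i′ × pt ≡ bottom (ℕ⇒ℚ (toℕ i))) ⊎ (j ≡ j′ × pt ≡ top (ℕ⇒ℚ (toℕ j)))
    meet-≤ : ∀ {i j i′ j′} → i F.≤ i′ → j F.≤ j′ → Meet i j i′ j′
    meet-≤ i≤i′ j≤j′ pt on on′ =
      Sum.map (λ (eq , eq′) → ℕ⇒ℚ∘toℕ-injective eq , ℕ⇒ℚ∘toℕ-injective eq′)
        (Sum.map (λ (eq , pt≡) → ℕ⇒ℚ∘toℕ-injective eq , pt≡)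
                 (λ (eq , pt≡) → ℕ⇒ℚ∘toℕ-injective eq , pt≡))
        (rungs-meet (ℕ⇒ℚ-mono-≤ i≤i′) (ℕ⇒ℚ-mono-≤ j≤j′) on on′)
    meet-sym : ∀ {i j i′ j′} → Meet i′ j′ i j → Meet i j i′ j′
    meet-sym meet pt on on′ =
      Sum.map (λ (eq , eq′) → sym eq , sym eq′)
        (Sum.map (λ (eq , pt≡) → sym eq , trans pt≡ (cong (bottom ∘ ℕ⇒ℚ ∘ toℕ) eq))
                 (λ (eq , pt≡) → sym eq , trans pt≡ (cong (top ∘ ℕ⇒ℚ ∘ toℕ) eq)))
        (meet pt on′ on)
    meet : ∀ {i j i′ j′} → p C i ~ q C j → p C i′ ~ q C j′ → Meet i j i′ j′
    meet {i} {j} {i′} {j′} e e′ with F.<-cmp i i′ | F.≤-total j j′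
    ... | tri< i<i′ _ _ | _          = meet-≤ (ℕ.<⇒≤ i<i′) (ordered C e e′ i<i′)
    ... | tri> _ _ i′<i | _          = meet-sym (meet-≤ (ℕ.<⇒≤ i′<i) (ordered C e′ e i′<i))
    ... | tri≈ _ refl _ | inj₁ j≤j′  = meet-≤ ℕ.≤-refl j≤j′
    ... | tri≈ _ refl _ | inj₂ j′≤j  = meet-sym (meet-≤ ℕ.≤-refl j′≤j)
    noncrossing : ∀ {x y x′ y′} →
      (∃[ i ] p C i ≡ x) → (∃[ j ] q C j ≡ y) → (∃[ i ] p C i ≡ x′) → (∃[ j ] q C j ≡ y′) →
      x ~ y → x′ ~ y′ → ¬ (x ≡ x′ × y ≡ y′) →
      ∀ pt → OnSegment (position x) (position y) pt → OnSegment (position x′) (position y′) pt →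
      (x ≡ x′ × pt ≡ position x) ⊎ (y ≡ y′ × pt ≡ position y)
    noncrossing (i , refl) (j , refl) (i′ , refl) (j′ , refl) e e′ distinct pt on on′ =
      [ (λ (i≡i′ , j≡j′) → contradiction (cong (p C) i≡i′ , cong (q C) j≡j′) distinct)
      , Sum.map (λ (i≡i′ , pt≡) → cong (p C) i≡i′ , trans pt≡ (sym (on-line₁ i)))
                (λ (j≡j′ , pt≡) → cong (q C) j≡j′ , trans pt≡ (sym (on-line₂ j))) ]′
      (meet e e′ pt (subst₂ (λ x y → OnSegment x y pt) (on-line₁ i) (on-line₂ j) on)
                    (subst₂ (λ x y → OnSegment x y pt) (on-line₁ i′) (on-line₂ j′) on′))

-- Isolated vertices and twins

-- An embedding together with an isolated vertex, in place of an isomorphism with `H ∪K₁`: the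
-- deletion of a vertex and a given isomorphism then supply the same data.
record IsolatedExtension {m n} (H : Graph m) (G : Graph n) : Set where
  field
    apex        : Fin n
    embed       : Fin m → Fin n
    isolated    : ∀ x → ¬ (apex ~[ G ] x)
    injective   : Injective _≡_ _≡_ embed
    apex≢embed  : ∀ y → apex ≢ embed y
    covers      : ∀ x → apex ≡ x ⊎ (∃[ y ] embed y ≡ x)
    adjacent    : ∀ x y → (x ~[ H ] y) ⇔ (embed x ~[ G ] embed y)

  neighbour : ∀ {y x} → embed y ~[ G ] x → ∃[ y′ ] embed y′ ≡ x × y ~[ H ] y′
  neighbour {y} {x} e with covers x
  ... | inj₁ refl        = contradiction (Graph.symmetric G e) (isolated (embed y))
  ... | inj₂ (y′ , refl) = y′ , refl , from (adjacent y y′) e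

  derived-embed : ∀ {S T} → (∀ {y} → S y → T (embed y)) → ∀ {y} → Derived H S y →
    Derived G T (embed y)
  derived-embed S⇒T (seed Sy) = seed (S⇒T Sy)
  derived-embed {S} {T} S⇒T (forced {u} {w} d u~w rest) =
    forced (derived-embed S⇒T d) (to (adjacent u w) u~w) rest′
    where
    rest′ : ∀ x → embed u ~[ G ] x → x ≢ embed w → Derived G T x
    rest′ x e x≢w with neighbour e
    ... | y , refl , u~y = derived-embed S⇒T (rest y u~y (x≢w ∘ cong embed))

  -- Neighbours of embedded vertices are embedded, so the derivation never leaves the image of `H`.
  -- The equation for `x` lets the induction run over derivations in `G`.
  derived-restrict : ∀ {S T} → (∀ {y} → T (embed y) → S y) → ∀ {y x} → Derived G T x → x ≡ embed y →
    Derived H S y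
  derived-restrict T⇒S (seed Tx) refl = seed (T⇒S Tx)
  derived-restrict {S} T⇒S {y} (forced d u~w rest) refl with neighbour (Graph.symmetric G u~w)
  ... | u , refl , w~u = forced (derived-restrict T⇒S d refl) (Graph.symmetric H w~u)
    λ x u~x x≢y → derived-restrict T⇒S (rest (embed x) (to (adjacent u x) u~x) (x≢y ∘ injective)) refl

  forcedBy-embed : ∀ {k} → ForcedBy H k → ForcedBy G (suc k)
  forcedBy-embed (ys , ≤k , all) =
    apex ∷ List.map embed ys , s≤s (subst (_≤ _) (sym (length-map embed ys)) ≤k) , derived
    where
    derived : ∀ x → Derived G (_∈ˡ apex ∷ List.map embed ys) x
    derived x with covers x
    ... | inj₁ refl       = seed (here refl)
    ... | inj₂ (y , refl) = derived-embed (there ∘ ∈-map⁺ embed) (all y)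

  private
    preimage : ∀ xs → ∃[ ys ] length ys ≤ length xs × (apex ∈ˡ xs → length ys < length xs) ×
                              (∀ {y} → embed y ∈ˡ xs → y ∈ˡ ys)
    preimage [] = [] , z≤n , (λ ()) , λ ()
    preimage (x ∷ xs) with preimage xs | covers x
    ... | ys , ≤xs , <xs , complete | inj₁ refl = ys , m≤n⇒m≤1+n ≤xs , (λ _ → s≤s ≤xs) , λ where
      (here eq)  → contradiction (sym eq) (apex≢embed _)
      (there y∈) → complete y∈
    ... | ys , ≤xs , <xs , complete | inj₂ (y , refl) = y ∷ ys , s≤s ≤xs ,
      (λ { (here eq) → contradiction eq (apex≢embed y) ; (there v∈) → s≤s (<xs v∈) }) , λ where
      (here eq)  → here (injective eq)
      (there y∈) → there (complete y∈)

    apex-seed : ∀ {S} → Derived G S apex → S apex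
    apex-seed (seed S-apex)     = S-apex
    apex-seed (forced _ u~v _) = contradiction (Graph.symmetric G u~v) (isolated _)

  -- Nothing can force an isolated vertex, so `apex` is itself a seed, and pulling the seeds back to
  -- `H` drops at least one of them.
  forcedBy-restrict : ∀ {k} → ForcedBy G (suc k) → ForcedBy H k
  forcedBy-restrict (xs , ≤1+k , all) with ys , _ , <xs , complete ← preimage xs =
    ys , s≤s⁻¹ (≤-trans (<xs (apex-seed (all apex))) ≤1+k) ,
    λ y → derived-restrict complete (all (embed y)) refl

  fortOf1 : FortOf G 1
  fortOf1 = apex ∷ [] , s≤s z≤n , (apex , here refl) , λ where
    _ (here refl) v~apex → contradiction (Graph.symmetric G v~apex) (isolated _)

  ≅∪K₁ : G ≅ H ∪K₁
  ≅∪K₁ = (λ x → label (covers x)) , ((λ {x} {y} → inj (covers x) (covers y)) , surj) ,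
         λ x y → adj (covers x) (covers y)
    where
    label : ∀ {x} → apex ≡ x ⊎ (∃[ y ] embed y ≡ x) → Fin (suc m)
    label (inj₁ _)       = zero
    label (inj₂ (y , _)) = suc y
    inj : ∀ {x y} (c : apex ≡ x ⊎ (∃[ z ] embed z ≡ x)) (d : apex ≡ y ⊎ (∃[ z ] embed z ≡ y)) →
      label c ≡ label d → x ≡ y
    inj (inj₁ refl) (inj₁ refl) _ = refl
    inj (inj₂ (y , refl)) (inj₂ (.y , refl)) refl = refl
    surj : Surjective _≡_ _≡_ (λ x → label (covers x))
    surj zero = apex , λ { refl → helper (covers apex) }
      where
      helper : (c : apex ≡ apex ⊎ (∃[ z ] embed z ≡ apex)) → label c ≡ zero
      helper (inj₁ _) = refl
      helper (inj₂ (z , eq)) = contradiction (sym eq) (apex≢embed z)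
    surj (suc y) = embed y , λ { refl → helper (covers (embed y)) }
      where
      helper : (c : apex ≡ embed y ⊎ (∃[ z ] embed z ≡ embed y)) → label c ≡ suc y
      helper (inj₁ eq) = contradiction eq (apex≢embed y)
      helper (inj₂ (z , eq)) = cong suc (injective eq)
    adj : ∀ {x y} (c : apex ≡ x ⊎ (∃[ z ] embed z ≡ x)) (d : apex ≡ y ⊎ (∃[ z ] embed z ≡ y)) →
      (x ~[ G ] y) ⇔ (label c ~[ H ∪K₁ ] label d)
    adj (inj₁ refl) _ = mk⇔ (isolated _) (λ ())
    adj (inj₂ _) (inj₁ refl) = mk⇔ (isolated _ ∘ Graph.symmetric G) (λ ())
    adj (inj₂ (x , refl)) (inj₂ (y , refl)) = mk⇔ (from (adjacent x y)) (to (adjacent x y))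

open IsolatedExtension using (≅∪K₁; forcedBy-embed; forcedBy-restrict; fortOf1)

≅∪K₁⇒isolatedExtension : ∀ {m n} {H : Graph m} {G : Graph n} → G ≅ H ∪K₁ → IsolatedExtension H G
≅∪K₁⇒isolatedExtension {m} {n} {H} {G} (f , (f-inj , f-surj) , adj) = record
  { apex = g zero ; embed = g ∘ suc
  ; isolated = λ x e → subst (λ y → y ~[ H ∪K₁ ] f x) (f∘g zero) (to (adj (g zero) x) e)
  ; injective = λ eq → case trans (sym (f∘g _)) (trans (cong f eq) (f∘g _)) of λ { refl → refl }
  ; apex≢embed = λ y eq → case trans (sym (f∘g _)) (trans (cong f eq) (f∘g _)) of λ ()
  ; covers = λ x → classify x (f x) refl
  ; adjacent = λ x y → mk⇔
      (λ e → from (adj _ _) (subst₂ (Graph._~_ (H ∪K₁)) (sym (f∘g (suc x))) (sym (f∘g (suc y))) e))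
      (λ e → subst₂ (Graph._~_ (H ∪K₁)) (f∘g (suc x)) (f∘g (suc y)) (to (adj _ _) e))
  }
  where
  g : Fin (suc m) → Fin n
  g i = proj₁ (f-surj i)
  f∘g : ∀ i → f (g i) ≡ i
  f∘g i = proj₂ (f-surj i) refl
  classify : ∀ x i → f x ≡ i → g zero ≡ x ⊎ (∃[ y ] g (suc y) ≡ x)
  classify x zero    eq = inj₁ (f-inj (trans (f∘g zero) (sym eq)))
  classify x (suc y) eq = inj₂ (y , f-inj (trans (f∘g (suc y)) (sym eq)))

delete : ∀ {m} → Graph (suc m) → Fin (suc m) → Graph m
delete G v = record
  { _~_ = λ x y → punchIn v x ~ punchIn v y
  ; _~?_ = λ x y → punchIn v x ~? punchIn v y
  ; symmetric = symmetric
  ; irreflexive = irreflexive ∘ cong (punchIn v)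
  }
  where open Graph G

delete-isolatedExtension : ∀ {m} {G : Graph (suc m)} {v} → (∀ x → ¬ (v ~[ G ] x)) →
  IsolatedExtension (delete G v) G
delete-isolatedExtension {G = G} {v} isolated = record
  { apex = v ; embed = punchIn v ; isolated = isolated
  ; injective = punchIn-injective v _ _
  ; apex≢embed = λ y → punchInᵢ≢i v y ∘ sym
  ; covers = λ x → case v ≟ᶠ x of λ where
      (yes v≡x) → inj₁ v≡x
      (no  v≢x) → inj₂ (punchOut v≢x , punchIn-punchOut v≢x)
  ; adjacent = λ _ _ → mk⇔ id id
  }

-- Adjacency between `u` and `w` is left open, so true and false twins are treated together. This is
-- why the forms come in variants with and without that edge.
Twins : ∀ {n} → Graph n → Fin n → Fin n → Set
Twins G u w = ∀ x → x ≢ u → x ≢ w → (u ~[ G ] x) ⇔ (w ~[ G ] x)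

twins-sym : ∀ {n} (G : Graph n) {u w} → Twins G u w → Twins G w u
twins-sym G tw x x≢w x≢u = mk⇔ (from (tw x x≢u x≢w)) (to (tw x x≢u x≢w))

module _ {n} {G : Graph n} where
  open Graph G

  fortOf1⇔isolated : FortOf G 1 ⇔ (∃[ v ] (∀ x → ¬ v ~ x))
  fortOf1⇔isolated = mk⇔ f g
    where
    f : FortOf G 1 → ∃[ v ] (∀ x → ¬ v ~ x)
    f ([] , _ , (_ , ()) , _)
    f (_ ∷ _ ∷ _ , s≤s () , _)
    f (v ∷ [] , _ , _ , two) = v , λ x v~x →
      case two {x} (λ { (here refl) → irreflexive refl v~x }) (here refl) (symmetric v~x) of λ where
        (_ , x≢v , here refl , _) → x≢v refl
    g : ∃[ v ] (∀ x → ¬ v ~ x) → FortOf G 1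
    g (v , isolated) = v ∷ [] , s≤s z≤n , (v , here refl) , λ where
      _ (here refl) x~v → contradiction (symmetric x~v) (isolated _)

  fort-dedupe : ∀ {u} → Fort G (_∈ˡ u ∷ u ∷ []) → Fort G (_∈ˡ u ∷ [])
  fort-dedupe {u} (_ , two) = (u , here refl) , two′
    where
    two′ : ∀ {v w} → ¬ v ∈ˡ u ∷ [] → w ∈ˡ u ∷ [] → v ~ w → ∃[ x ] x ≢ w × x ∈ˡ u ∷ [] × v ~ x
    two′ v∉ w∈ v~w with x , x≢w , x∈ , v~x ← two (v∉ ∘ dedupe) (there w∈) v~w =
      x , x≢w , dedupe x∈ , v~x

  -- An outside vertex that meets one member of a two-element fort needs a second neighbour in it,
  -- and only the other member is available. Shorter lists and repetitions would be forts of size 1.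
  fortOf2⇒twins : ¬ FortOf G 1 → FortOf G 2 → ∃[ u ] ∃[ w ] u ≢ w × Twins G u w
  fortOf2⇒twins ¬1 ([] , _ , (_ , ()) , _)
  fortOf2⇒twins ¬1 (u ∷ [] , _ , fort) = contradiction (u ∷ [] , s≤s z≤n , fort) ¬1
  fortOf2⇒twins ¬1 (_ ∷ _ ∷ _ ∷ _ , s≤s (s≤s ()) , _)
  fortOf2⇒twins ¬1 (u ∷ w ∷ [] , _ , fort@(nonempty , two)) with u ≟ᶠ w
  ... | yes refl = contradiction (u ∷ [] , s≤s z≤n , fort-dedupe fort) ¬1
  ... | no u≢w = u , w , u≢w , λ x x≢u x≢w → mk⇔ (f x x≢u x≢w) (g x x≢u x≢w)
    where
    out : ∀ {x} → x ≢ u → x ≢ w → ¬ x ∈ˡ u ∷ w ∷ []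
    out x≢u x≢w (here eq)         = x≢u eq
    out x≢u x≢w (there (here eq)) = x≢w eq
    f : ∀ x → x ≢ u → x ≢ w → u ~ x → w ~ x
    f x x≢u x≢w u~x with two (out x≢u x≢w) (here refl) (symmetric u~x)
    ... | _ , y≢u , here refl , _ = contradiction refl y≢u
    ... | _ , _ , there (here refl) , x~w = symmetric x~w
    g : ∀ x → x ≢ u → x ≢ w → w ~ x → u ~ x
    g x x≢u x≢w w~x with two (out x≢u x≢w) (there (here refl)) (symmetric w~x)
    ... | _ , _ , here refl , x~u = symmetric x~u
    ... | _ , y≢w , there (here refl) , _ = contradiction refl y≢w

  twins⇒fortOf2 : ∀ {u w} → u ≢ w → Twins G u w → FortOf G 2
  twins⇒fortOf2 {u} {w} u≢w tw = u ∷ w ∷ [] , s≤s (s≤s z≤n) , (u , here refl) , λ where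
    x∉ (here refl) x~u → w , u≢w ∘ sym , there (here refl) ,
      symmetric (to (tw _ (x∉ ∘ here) (x∉ ∘ there ∘ here)) (symmetric x~u))
    x∉ (there (here refl)) x~w → u , u≢w , here refl ,
      symmetric (from (tw _ (x∉ ∘ here) (x∉ ∘ there ∘ here)) (symmetric x~w))

-- Forts of paths

≅-sym : ∀ {m n} {G : Graph m} {H : Graph n} → G ≅ H → H ≅ G
≅-sym {m} {n} {G} {H} (f , (f-inj , f-surj) , adj) =
  g , ((λ {x} {y} eq → trans (sym (f∘g x)) (trans (cong f eq) (f∘g y))) ,
       (λ x → f x , λ { refl → f-inj (f∘g (f x)) })) ,
  λ x y → mk⇔ (λ e → from (adj (g x) (g y)) (subst₂ (Graph._~_ H) (sym (f∘g x)) (sym (f∘g y)) e))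
              (λ e → subst₂ (Graph._~_ H) (f∘g x) (f∘g y) (to (adj (g x) (g y)) e))
  where
  g : Fin n → Fin m
  g i = proj₁ (f-surj i)
  f∘g : ∀ i → f (g i) ≡ i
  f∘g i = proj₂ (f-surj i) refl

fortOf-≅ : ∀ {m n} {G : Graph m} {H : Graph n} {k} → G ≅ H → FortOf G k → FortOf H k
fortOf-≅ {G = G} {H} (f , (f-inj , f-surj) , adj) (ws , ≤k , (w , w∈) , two) =
  List.map f ws , subst (_≤ _) (sym (length-map f ws)) ≤k , (f w , ∈-map⁺ f w∈) , two′
  where
  two′ : ∀ {v w} → ¬ v ∈ˡ List.map f ws → w ∈ˡ List.map f ws → v ~[ H ] w →
         ∃[ x ] x ≢ w × x ∈ˡ List.map f ws × v ~[ H ] x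
  two′ {v} v∉ w∈ v~w with ∈-map⁻ f w∈ | f-surj v
  ... | w′ , w′∈ , refl | v′ , fv′≡v with refl ← fv′≡v refl
    with x , x≢w , x∈ , v~x ← two (v∉ ∘ ∈-map⁺ f) w′∈ (from (adj v′ w′) v~w) =
    f x , x≢w ∘ f-inj , ∈-map⁺ f x∈ , to (adj v′ x) v~x

private module _ {n : ℕ} where

  -- Labels start at 1, so that the two ends of the path are the pairs (0 , 1)
  -- and (n , 1 + n) of consecutive labels and need no separate treatment.
  Label : List (Fin n) → ℕ → Set
  Label ws i = ∃[ x ] x ∈ˡ ws × suc (toℕ x) ≡ i

  label? : ∀ ws i → Dec (Label ws i)
  label? ws i = any? λ x → (x ∈ˡ? ws) ×-dec (suc (toℕ x) ℕ.≟ i)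
    where open DecMembership (_≟ᶠ_ {n}) using () renaming (_∈?_ to _∈ˡ?_)

  -- A device for lower bounds on forts: as the threshold `a` rises past a block of labels that
  -- meets the list, the count drops. Disjoint blocks thus add up, without any argument about
  -- distinct list entries.
  above : ℕ → List (Fin n) → ℕ
  above a []       = 0
  above a (x ∷ ws) with a ℕ.≤? suc (toℕ x)
  ... | yes _ = suc (above a ws)
  ... | no _  = above a ws

  above≤length : ∀ a ws → above a ws ≤ length ws
  above≤length a []       = z≤n
  above≤length a (x ∷ ws) with a ℕ.≤? suc (toℕ x)
  ... | yes _ = s≤s (above≤length a ws)
  ... | no _  = m≤n⇒m≤1+n (above≤length a ws)

  above-anti : ∀ {a b} ws → a ≤ b → above b ws ≤ above a ws
  above-anti []       a≤b = z≤n
  above-anti {a} {b} (x ∷ ws) a≤b with a ℕ.≤? suc (toℕ x) | b ℕ.≤? suc (toℕ x)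
  ... | yes _   | yes _   = s≤s (above-anti ws a≤b)
  ... | yes _   | no _    = m≤n⇒m≤1+n (above-anti ws a≤b)
  ... | no  a≰x | yes b≤x = contradiction (≤-trans a≤b b≤x) a≰x
  ... | no _    | no _    = above-anti ws a≤b

  label⇒above< : ∀ {a i} ws → Label ws i → a ≤ i → above (suc i) ws < above a ws
  label⇒above< {a} (x ∷ ws) (.x , here refl , refl) a≤i
    with a ℕ.≤? suc (toℕ x) | suc (suc (toℕ x)) ℕ.≤? suc (toℕ x)
  ... | yes _   | no _    = s≤s (above-anti ws (m≤n⇒m≤1+n a≤i))
  ... | _       | yes x<x = contradiction x<x ℕ.1+n≰n
  ... | no  a≰x | _       = contradiction a≤i a≰x
  label⇒above< {a} {i} (x ∷ ws) (y , there y∈ , eq) a≤i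
    with a ℕ.≤? suc (toℕ x) | suc i ℕ.≤? suc (toℕ x)
  ... | yes _   | yes _   = s≤s (label⇒above< ws (y , y∈ , eq) a≤i)
  ... | yes _   | no _    = m≤n⇒m≤1+n (label⇒above< ws (y , y∈ , eq) a≤i)
  ... | no  a≰x | yes i<x = contradiction (≤-trans a≤i (≤-trans (n≤1+n i) i<x)) a≰x
  ... | no _    | no _    = label⇒above< ws (y , y∈ , eq) a≤i

  module _ {ws : List (Fin n)} (fort : Fort (P n) (_∈ˡ ws)) where

    -- The vertex labelled `1 + i` is outside the fort, and its possible neighbours carry the labels
    -- `i` and `2 + i`; it cannot see just one of them in the fort.
    no-label-up : ∀ i → ¬ Label ws i → ¬ Label ws (suc i) → ¬ Label ws (suc (suc i))
    no-label-up i ¬i ¬1+i (w , w∈ , eq) =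
      case proj₂ fort {v} (λ v∈ → ¬1+i (v , v∈ , cong suc v≡i)) w∈
             (inj₁ (trans w≡1+i (cong suc (sym v≡i)))) of λ where
        (x , x≢w , x∈ , inj₁ x≡1+v) → x≢w (toℕ-injective (trans x≡1+v (trans (cong suc v≡i) (sym w≡1+i))))
        (x , x≢w , x∈ , inj₂ v≡1+x) → ¬i (x , x∈ , trans (sym v≡1+x) v≡i)
      where
      w≡1+i : toℕ w ≡ suc i
      w≡1+i = suc-injective eq
      i<n : i < n
      i<n = ℕ.<-trans (≤-reflexive (sym w≡1+i)) (toℕ<n w)
      v : Fin n
      v = fromℕ< i<n
      v≡i : toℕ v ≡ i
      v≡i = toℕ-fromℕ< i<n

    no-label-down : ∀ i → i < n → ¬ Label ws (suc i) → ¬ Label ws (suc (suc i)) → ¬ Label ws i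
    no-label-down i i<n ¬1+i ¬2+i (w , w∈ , eq) =
      case proj₂ fort {v} (λ v∈ → ¬1+i (v , v∈ , cong suc v≡i)) w∈ (inj₂ (trans v≡i (sym eq))) of λ where
        (x , x≢w , x∈ , inj₁ x≡1+v) → ¬2+i (x , x∈ , cong suc (trans x≡1+v (cong suc v≡i)))
        (x , x≢w , x∈ , inj₂ v≡1+x) →
          x≢w (toℕ-injective (suc-injective (trans (sym v≡1+x) (trans v≡i (sym eq)))))
      where
      v : Fin n
      v = fromℕ< i<n
      v≡i : toℕ v ≡ i
      v≡i = toℕ-fromℕ< i<n

    no-labels-up : ∀ i → ¬ Label ws i → ¬ Label ws (suc i) → ∀ d → ¬ Label ws (d + i)
    no-labels-up i ¬i ¬1+i zero          = ¬i
    no-labels-up i ¬i ¬1+i (suc zero)    = ¬1+i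
    no-labels-up i ¬i ¬1+i (suc (suc d)) =
      no-label-up (d + i) (no-labels-up i ¬i ¬1+i d) (no-labels-up i ¬i ¬1+i (suc d))

    -- The gap is pushed down to the labels 0 and 1 and from there spreads upward over all labels.
    no-label-pair : ∀ i → i ≤ n → ¬ Label ws i → ¬ Label ws (suc i) → ∀ j → ¬ Label ws j
    no-label-pair zero i≤n ¬i ¬1+i j =
      subst (¬_ ∘ Label ws) (ℕ.+-identityʳ j) (no-labels-up 0 ¬i ¬1+i j)
    no-label-pair (suc i) i≤n ¬i ¬1+i j =
      no-label-pair i (≤-trans (n≤1+n i) i≤n) (no-label-down i i≤n ¬i ¬1+i) ¬i j

    label-pair : ∀ i → i ≤ n → Label ws i ⊎ Label ws (suc i)
    label-pair i i≤n with label? ws i | label? ws (suc i)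
    ... | yes l | _     = inj₁ l
    ... | no _  | yes l = inj₂ l
    ... | no ¬i | no ¬1+i with w , w∈ ← proj₁ fort =
      contradiction (w , w∈ , refl) (no-label-pair i i≤n ¬i ¬1+i (suc (toℕ w)))

    -- One of the labels `i` and `1 + i` is in the fort, and both leave the count when the threshold
    -- rises from `a` to `2 + i`.
    next-label : ∀ a i → a ≤ i → i ≤ n → above (2 + i) ws < above a ws
    next-label a i a≤i i≤n with label-pair i i≤n
    ... | inj₁ l = ℕ.<-≤-trans (s≤s (above-anti ws (n≤1+n (suc i)))) (label⇒above< ws l a≤i)
    ... | inj₂ l = label⇒above< ws l (m≤n⇒m≤1+n a≤i)

    first-label : above 2 ws < length ws
    first-label with label-pair 0 z≤n
    ... | inj₂ l = ≤-trans (label⇒above< ws l z≤n) (above≤length 0 ws)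

    last-label : ∀ a → a ≤ n → 1 ≤ above a ws
    last-label a a≤n with label-pair n ≤-refl
    ... | inj₁ l = ≤-trans (s≤s z≤n) (label⇒above< ws l a≤n)
    ... | inj₂ (w , _ , eq) = contradiction (toℕ<n w) (ℕ.<-irrefl (suc-injective eq))

-- The fort contains label 1, one of the labels 2 and 3, and label n, which is at least 4.
fortOf-P⇒3≤ : ∀ {n k} → 4 ≤ n → FortOf (P n) k → 3 ≤ k
fortOf-P⇒3≤ 4≤n (ws , ≤k , fort) = ≤-trans
  (≤-trans (s≤s (≤-trans (s≤s (last-label fort 4 4≤n))
    (next-label fort 2 2 ≤-refl (≤-trans (s≤s (s≤s z≤n)) 4≤n))))
    (first-label fort)) ≤k

-- As before, with the further pair of labels 4 and 5 below n ≥ 6.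
fortOf-P⇒4≤ : ∀ {n k} → 6 ≤ n → FortOf (P n) k → 4 ≤ k
fortOf-P⇒4≤ 6≤n (ws , ≤k , fort) = ≤-trans
  (≤-trans (s≤s (≤-trans (s≤s (≤-trans (s≤s (last-label fort 6 6≤n))
    (next-label fort 4 4 ≤-refl (≤-trans (s≤s (s≤s (s≤s (s≤s z≤n)))) 6≤n))))
    (next-label fort 2 2 ≤-refl (≤-trans (s≤s (s≤s z≤n)) 6≤n))))
    (first-label fort)) ≤k

fortOf-P1 : FortOf (P 1) 1
fortOf-P1 = 0F ∷ [] , ≤-refl , (0F , here refl) , λ
  { {0F} v∉ → contradiction (here refl) v∉
  }

fortOf-P2 : FortOf (P 2) 2
fortOf-P2 = 0F ∷ 1F ∷ [] , ≤-refl , (0F , here refl) , λ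
  { {0F} v∉ → contradiction (here refl) v∉
  ; {1F} v∉ → contradiction (there (here refl)) v∉
  }

fortOf-P3 : FortOf (P 3) 2
fortOf-P3 = 0F ∷ 2F ∷ [] , ≤-refl , (0F , here refl) , λ
  { {0F} v∉ → contradiction (here refl) v∉
  ; {1F} _ (here refl) _         → 2F , (λ ()) , there (here refl) , inj₁ refl
  ; {1F} _ (there (here refl)) _ → 0F , (λ ()) , here refl , inj₂ refl
  ; {2F} v∉ → contradiction (there (here refl)) v∉
  }

fortOf-P4 : FortOf (P 4) 3
fortOf-P4 = 0F ∷ 2F ∷ 3F ∷ [] , ≤-refl , (0F , here refl) , λ
  { {0F} v∉ → contradiction (here refl) v∉
  ; {1F} _ (here refl) _         → 2F , (λ ()) , there (here refl) , inj₁ refl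
  ; {1F} _ (there (here refl)) _ → 0F , (λ ()) , here refl , inj₂ refl
  ; {1F} _ (there (there (here refl))) (inj₁ ())
  ; {1F} _ (there (there (here refl))) (inj₂ ())
  ; {2F} v∉ → contradiction (there (here refl)) v∉
  ; {3F} v∉ → contradiction (there (there (here refl))) v∉
  }

fortOf-P5 : FortOf (P 5) 3
fortOf-P5 = 0F ∷ 2F ∷ 4F ∷ [] , ≤-refl , (0F , here refl) , λ
  { {0F} v∉ → contradiction (here refl) v∉
  ; {1F} _ (here refl) _         → 2F , (λ ()) , there (here refl) , inj₁ refl
  ; {1F} _ (there (here refl)) _ → 0F , (λ ()) , here refl , inj₂ refl
  ; {1F} _ (there (there (here refl))) (inj₁ ())
  ; {1F} _ (there (there (here refl))) (inj₂ ())
  ; {2F} v∉ → contradiction (there (here refl)) v∉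
  ; {3F} _ (here refl) (inj₁ ())
  ; {3F} _ (here refl) (inj₂ ())
  ; {3F} _ (there (here refl)) _         → 4F , (λ ()) , there (there (here refl)) , inj₁ refl
  ; {3F} _ (there (there (here refl))) _ → 2F , (λ ()) , there (here refl) , inj₂ refl
  ; {4F} v∉ → contradiction (there (there (here refl))) v∉
  }

-- From twins to the forms

vertex∈ : ∀ {n} {G : Graph n} {V k} (q : PathOrder G V k) j → vertex q j ∈ V
vertex∈ q j = from (PathOrder.image q _) (j , refl)

index : ∀ {n} {G : Graph n} {V k} (q : PathOrder G V k) {x} → x ∈ V → ∃[ j ] vertex q j ≡ x
index q = to (PathOrder.image q _)

∈∪-pair : ∀ {n} {x u w : Fin n} → x ∈ ⁅ u ⁆ ∪ ⁅ w ⁆ ⇔ (x ≡ u ⊎ x ≡ w)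
∈∪-pair {x = x} {u} {w} = mk⇔
  (Sum.map (x∈⁅y⁆⇒x≡y u) (x∈⁅y⁆⇒x≡y w) ∘ x∈p∪q⁻ ⁅ u ⁆ ⁅ w ⁆)
  (x∈p∪q⁺ ∘ Sum.map (λ { refl → x∈⁅x⁆ u }) (λ { refl → x∈⁅x⁆ w }))

∈∪-triple : ∀ {n} {x u v w : Fin n} → x ∈ ⁅ u ⁆ ∪ ⁅ v ⁆ ∪ ⁅ w ⁆ ⇔ (x ≡ u ⊎ x ≡ v ⊎ x ≡ w)
∈∪-triple {x = x} {u} {v} {w} = mk⇔
  (Sum.map (x∈⁅y⁆⇒x≡y u) (to ∈∪-pair) ∘ x∈p∪q⁻ ⁅ u ⁆ (⁅ v ⁆ ∪ ⁅ w ⁆))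
  (x∈p∪q⁺ ∘ Sum.map (λ { refl → x∈⁅x⁆ u }) (from ∈∪-pair))

P-next : ∀ {k} (i : Fin k) → suc (toℕ i) < k → ∃[ i′ ] toℕ i′ ≡ suc (toℕ i)
P-next i 1+i<k = fromℕ< 1+i<k , toℕ-fromℕ< 1+i<k

P-previous : ∀ {k m} (i : Fin k) → toℕ i ≡ suc m → ∃[ i′ ] toℕ i ≡ suc (toℕ i′)
P-previous {m = m} i i≡1+m = fromℕ< m<k , trans i≡1+m (cong suc (sym (toℕ-fromℕ< m<k)))
  where
  m<k = ℕ.<-trans (≤-reflexive (sym i≡1+m)) (toℕ<n i)

-- A predecessor of `a` would also be adjacent to `b`, which lies too far right, and likewise `b`
-- has no successor. So the twins are the ends, and the successor of `a`, unless it is `b`, is next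
-- to both.
twins-P : ∀ {k} {a b : Fin k} → Twins (P k) a b → a F.< b →
  (k ≡ 2) ⊎ (k ≡ 3 × toℕ a ≡ 0 × toℕ b ≡ 2)
twins-P {k} {a} {b} tw a<b = conclude (toℕ b) refl
  where
  a≢1+ : ∀ {m} → toℕ a ≢ suc m
  a≢1+ eq with i , a≡1+i ← P-previous a eq =
    case to (tw i (F.<⇒≢ (i<a i a≡1+i)) (F.<⇒≢ (ℕ.<-trans (i<a i a≡1+i) a<b))) (inj₂ a≡1+i) of λ where
      (inj₁ i≡1+b) → contradiction (ℕ.<-trans (i<a i a≡1+i) a<b) (ℕ.<⇒≯ (≤-reflexive (sym i≡1+b)))
      (inj₂ b≡1+i) → contradiction (trans a≡1+i (sym b≡1+i)) (ℕ.<⇒≢ a<b)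
    where
    i<a : ∀ (i : Fin k) → toℕ a ≡ suc (toℕ i) → toℕ i < toℕ a
    i<a i a≡1+i = ≤-reflexive (sym a≡1+i)
  a≡0 : toℕ a ≡ 0
  a≡0 = ℕ.n<1⇒n≡0 (ℕ.≰⇒> λ 1≤a → a≢1+ (sym (ℕ.suc-pred _ {{ℕ.>-nonZero 1≤a}})))
  b-last : suc (toℕ b) ≡ k
  b-last with suc (toℕ b) ℕ.≟ k
  ... | yes eq = eq
  ... | no  ne with i , i≡1+b ← P-next b (ℕ.≤∧≢⇒< (toℕ<n b) ne) =
    case from (tw i (F.<⇒≢ (ℕ.<-trans a<b (b<i i i≡1+b)) ∘ sym) (F.<⇒≢ (b<i i i≡1+b) ∘ sym))
           (inj₁ i≡1+b) of λ where
      (inj₁ i≡1+a) → contradiction (suc-injective (trans (sym i≡1+a) i≡1+b)) (ℕ.<⇒≢ a<b)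
      (inj₂ a≡1+i) → contradiction (trans (sym a≡0) a≡1+i) λ ()
    where
    b<i : ∀ i → toℕ i ≡ suc (toℕ b) → toℕ b < toℕ i
    b<i i i≡1+b = ≤-reflexive (sym i≡1+b)
  conclude : ∀ m → toℕ b ≡ m → (k ≡ 2) ⊎ (k ≡ 3 × toℕ a ≡ 0 × toℕ b ≡ 2)
  conclude zero          b≡0   = contradiction (subst (toℕ a <_) b≡0 a<b) λ ()
  conclude (suc zero)    b≡1   = inj₁ (trans (sym b-last) (cong suc b≡1))
  conclude (suc (suc m)) b≡2+m
    with i , i≡1+a ← P-next a (≤-trans (s≤s a<b) (toℕ<n b)) =
    case to (tw i (λ { refl → ℕ.1+n≢n (sym i≡1+a) }) (i≢b i i≡1+a)) (inj₁ i≡1+a) of λ where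
      (inj₁ i≡1+b) → contradiction (suc-injective (trans (sym i≡1+b) i≡1+a)) (ℕ.<⇒≢ a<b ∘ sym)
      (inj₂ b≡1+i) → inj₂ (trans (sym b-last) (cong suc (b≡2 i i≡1+a b≡1+i)) , a≡0 , b≡2 i i≡1+a b≡1+i)
    where
    i≢b : ∀ i → toℕ i ≡ suc (toℕ a) → i ≢ b
    i≢b i i≡1+a refl = case trans (sym b≡2+m) (trans i≡1+a (cong suc a≡0)) of λ ()
    b≡2 : ∀ (i : Fin k) → toℕ i ≡ suc (toℕ a) → toℕ b ≡ suc (toℕ i) → toℕ b ≡ 2
    b≡2 i i≡1+a b≡1+i = trans b≡1+i (cong suc (trans i≡1+a (cong suc a≡0)))

-- Used when the twin of a single vertex is the last vertex of the other path, because `FormA` lets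
-- that end come first.
reverse : ∀ {n} {G : Graph n} {V k} → PathOrder G V k → PathOrder G V k
reverse {k = k} q = record
  { vertex    = vertex q ∘ opposite
  ; nonempty  = PathOrder.nonempty q
  ; injective = λ {i} {j} eq → trans (sym (opposite-involutive i))
      (trans (cong opposite (PathOrder.injective q eq)) (opposite-involutive j))
  ; image     = λ x → mk⇔
      (λ x∈ → let i , eq = index q x∈ in opposite i , trans (cong (vertex q) (opposite-involutive i)) eq)
      (λ (i , eq) → from (PathOrder.image q x) (opposite i , eq))
  ; induced   = λ i j → mk⇔
      (λ e → to (PathOrder.induced q (opposite i) (opposite j)) (opposite-adjacent i j e))
      (λ e → subst₂ (Graph._~_ (P k)) (opposite-involutive i) (opposite-involutive j)
        (opposite-adjacent (opposite i) (opposite j) (from (PathOrder.induced q _ _) e)))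
  }
  where
  opposite-successor : ∀ (i j : Fin k) → toℕ j ≡ suc (toℕ i) →
    toℕ (opposite i) ≡ suc (toℕ (opposite j))
  opposite-successor i j j≡1+i = begin
    toℕ (opposite i)             ≡⟨ opposite-prop i ⟩
    k ℕ.∸ suc (toℕ i)            ≡⟨ cong (k ℕ.∸_) j≡1+i ⟨
    k ℕ.∸ toℕ j                  ≡⟨ ℕ.suc-pred _ {{ℕ.>-nonZero (ℕ.m<n⇒0<n∸m (toℕ<n j))}} ⟨
    suc (ℕ.pred (k ℕ.∸ toℕ j))   ≡⟨ cong suc (ℕ.pred[m∸n]≡m∸[1+n] k (toℕ j)) ⟩
    suc (k ℕ.∸ suc (toℕ j))      ≡⟨ cong suc (opposite-prop j) ⟨
    suc (toℕ (opposite j))       ∎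
    where open ≡-Reasoning
  opposite-adjacent : ∀ i j → i ~[ P k ] j → opposite i ~[ P k ] opposite j
  opposite-adjacent i j (inj₁ j≡1+i) = inj₂ (opposite-successor i j j≡1+i)
  opposite-adjacent i j (inj₂ i≡1+j) = inj₁ (opposite-successor j i i≡1+j)

module _ {n} {G : Graph n} where
  open Graph G

  ∈N : ∀ {x y} → y ∈ N G x ⇔ x ~ y
  ∈N {x} = ∈-tabulate (x ~?_)

  N-≡ : ∀ {x S} → (∀ y → (x ~ y) ⇔ (y ∈ S)) → N G x ≡ S
  N-≡ iff = ⊆-antisym (λ {y} y∈ → to (iff y) (to ∈N y∈)) (λ {y} y∈ → from ∈N (from (iff y) y∈))

  twins-restrict : ∀ {V k} (q : PathOrder G V k) {a b} → Twins G (vertex q a) (vertex q b) →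
    Twins (P k) a b
  twins-restrict q tw i i≢a i≢b = mk⇔ (from (induced _ i) ∘ to there′ ∘ to (induced _ i))
                                     (from (induced _ i) ∘ from there′ ∘ to (induced _ i))
    where
    open PathOrder q using (induced; injective)
    there′ = tw (vertex q i) (i≢a ∘ injective) (i≢b ∘ injective)

  -- What remains of a drawing for locating twins: the vertex sets and path orders that the forms
  -- mention, and monotone edges instead of coordinates.
  record Aligned (V₁ V₂ : Subset n) (k l : ℕ) : Set where
    field
      cover    : ∀ x → x ∈ V₁ ⊎ x ∈ V₂
      disjoint : ∀ {x} → x ∈ V₁ → x ∉ V₂
      path₁    : PathOrder G V₁ k
      path₂    : PathOrder G V₂ l
      ordered  : ∀ {i j i′ j′} → vertex path₁ i ~ vertex path₂ j → vertex path₁ i′ ~ vertex path₂ j′ →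
                 i F.< i′ → j F.≤ j′

    p : Fin k → Fin n
    p = vertex path₁
    q : Fin l → Fin n
    q = vertex path₂
    p≢q : ∀ {i j} → p i ≢ q j
    p≢q {i} {j} eq = disjoint (vertex∈ path₁ i) (subst (_∈ V₂) (sym eq) (vertex∈ path₂ j))

  swap-aligned : ∀ {V₁ V₂ k l} → Aligned V₁ V₂ k l → Aligned V₂ V₁ l k
  swap-aligned A = record
    { cover = Sum.swap ∘ cover ; disjoint = λ x∈V₂ x∈V₁ → disjoint x∈V₁ x∈V₂
    ; path₁ = path₂ ; path₂ = path₁
    ; ordered = λ e e′ j<j′ → ℕ.≮⇒≥ λ i′<i → ℕ.<⇒≱ j<j′ (ordered (symmetric e′) (symmetric e) i′<i)
    }
    where open Aligned A

  lonely : ∀ {V l x y} → l ≡ 1 → PathOrder G V l → x ∈ V → y ∈ V → ¬ x ~ y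
  lonely refl q x∈ y∈ x~y with index q x∈ | index q y∈
  ... | 0F , refl | 0F , refl = irreflexive refl x~y

  module _ (somewhere : ∀ x → ∃[ y ] x ~ y) where

    formB : ∀ {V₁ V₂ l} (A : Aligned V₁ V₂ 2 l) → Twins G (Aligned.p A 0F) (Aligned.p A 1F) →
      FormB G V₁ V₂
    formB {V₁} {V₂} {l} A tw = path₁ , l , path₂ ,
      ⊆-antisym (sub (λ y → to ∘ other y)) (sub (λ y → from ∘ other y)) , single
      where
      open Aligned A
      other : ∀ y → y ∈ V₂ → (p 0F ~ y) ⇔ (p 1F ~ y)
      other y y∈ =
        tw y (λ { refl → disjoint (vertex∈ path₁ 0F) y∈ }) (λ { refl → disjoint (vertex∈ path₁ 1F) y∈ })
      sub : ∀ {u v} → (∀ y → y ∈ V₂ → u ~ y → v ~ y) → ∀ {y} → y ∈ N G u ∩ V₂ → y ∈ N G v ∩ V₂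
      sub imp y∈ with y∈N , y∈V₂ ← x∈p∩q⁻ (N G _) V₂ y∈ =
        x∈p∩q⁺ (from ∈N (imp _ y∈V₂ (to ∈N y∈N)) , y∈V₂)
      -- The only vertex of `V₂` is not isolated, so it meets one of the twins and therefore both.
      single : l ≡ 1 → ∀ x → x ∈ V₂ → p 0F ~ x × p 1F ~ x
      single l≡1 x x∈ with y , x~y ← somewhere x with cover y
      ... | inj₂ y∈ = contradiction x~y (lonely l≡1 path₂ x∈ y∈)
      ... | inj₁ y∈ with index path₁ y∈
      ...   | 0F , refl = symmetric x~y , to (other x x∈) (symmetric x~y)
      ...   | 1F , refl = from (other x x∈) (symmetric x~y) , symmetric x~y

    formC : ∀ {V₁ V₂ l} (A : Aligned V₁ V₂ 3 l) → Twins G (Aligned.p A 0F) (Aligned.p A 2F) →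
      FormC G V₁ V₂
    formC {V₁} {V₂} {l} A tw = path₁ , l , path₂ , forms (any? (λ j → p 0F ~? q j))
      where
      open Aligned A
      other : ∀ {j} → (p 0F ~ q j) ⇔ (p 2F ~ q j)
      other {j} = tw (q j) (p≢q ∘ sym) (p≢q ∘ sym)
      0~1 : p 0F ~ p 1F
      0~1 = to (PathOrder.induced path₁ 0F 1F) (inj₁ refl)
      2~1 : p 2F ~ p 1F
      2~1 = to (PathOrder.induced path₁ 2F 1F) (inj₂ refl)
      ends : ∀ {S} → p 1F ∈ S → (∀ {j} → p 0F ~ q j → q j ∈ S) →
        (∀ {y} → y ∈ S → y ≡ p 1F ⊎ p 0F ~ y × y ∈ V₂) →
        N G (p 0F) ≡ S × N G (p 2F) ≡ S
      ends {S} 1∈ 0~⇒∈ ∈⇒ =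
        N-≡ (λ y → mk⇔ (at-0 y) (of-0 y ∘ ∈⇒)) , N-≡ (λ y → mk⇔ (at-2 y) (of-2 y ∘ ∈⇒))
        where
        at-0 : ∀ y → p 0F ~ y → y ∈ S
        at-0 y e with cover y
        ... | inj₂ y∈ with _ , refl ← index path₂ y∈ = 0~⇒∈ e
        ... | inj₁ y∈ with index path₁ y∈
        ...   | 0F , refl = contradiction e (irreflexive refl)
        ...   | 1F , refl = 1∈
        ...   | 2F , refl =
              case from (PathOrder.induced path₁ 0F 2F) e of λ { (inj₁ ()) ; (inj₂ ()) }
        at-2 : ∀ y → p 2F ~ y → y ∈ S
        at-2 y e with cover y
        ... | inj₂ y∈ with _ , refl ← index path₂ y∈ = 0~⇒∈ (from other e)
        ... | inj₁ y∈ with index path₁ y∈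
        ...   | 0F , refl =
              case from (PathOrder.induced path₁ 2F 0F) e of λ { (inj₁ ()) ; (inj₂ ()) }
        ...   | 1F , refl = 1∈
        ...   | 2F , refl = contradiction e (irreflexive refl)
        of-0 : ∀ y → y ≡ p 1F ⊎ p 0F ~ y × y ∈ V₂ → p 0F ~ y
        of-0 y (inj₁ refl)    = 0~1
        of-0 y (inj₂ (e , _)) = e
        of-2 : ∀ y → y ≡ p 1F ⊎ p 0F ~ y × y ∈ V₂ → p 2F ~ y
        of-2 y (inj₁ refl)     = 2~1
        of-2 y (inj₂ (e , y∈)) with _ , refl ← index path₂ y∈ = to other e
      forms : Dec (∃[ j ] p 0F ~ q j) → _ ⊎ _
      forms (yes (j , 0~j)) = inj₂ (q j , vertex∈ path₂ j ,
        ends (from ∈∪-pair (inj₁ refl)) (from ∈∪-pair ∘ inj₂ ∘ cong q ∘ unique)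
          (Sum.map₂ (λ { refl → 0~j , vertex∈ path₂ j }) ∘ to ∈∪-pair))
        where
        -- Being twins, both ends of the three-vertex path are adjacent to `q j` and `q j′`;
        -- monotonicity between the indices 0 and 2 gives both inequalities.
        unique : ∀ {j′} → p 0F ~ q j′ → j′ ≡ j
        unique {j′} 0~j′ =
          F.≤-antisym (ordered 0~j′ (to other 0~j) (s≤s z≤n)) (ordered 0~j (to other 0~j′) (s≤s z≤n))
      forms (no none) = inj₁ (proj₁ both , proj₂ both , single)
        where
        both = ends (x∈⁅x⁆ (p 1F)) (λ {j} e → contradiction (j , e) none) (inj₁ ∘ x∈⁅y⁆⇒x≡y (p 1F))
        -- The only vertex of `V₂` has a neighbour, and `none` keeps that neighbour away from the
        -- two ends.
        single : l ≡ 1 → ∀ x → x ∈ V₂ → p 1F ~ x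
        single l≡1 x x∈ with y , x~y ← somewhere x with cover y
        ... | inj₂ y∈ = contradiction x~y (lonely l≡1 path₂ x∈ y∈)
        ... | inj₁ y∈ with index path₁ y∈ | index path₂ x∈
        ...   | 0F , refl | j , refl = contradiction (j , symmetric x~y) none
        ...   | 1F , refl | _        = symmetric x~y
        ...   | 2F , refl | j , refl = contradiction (j , from other (symmetric x~y)) none

    form-same-path : ∀ {V₁ V₂ k l} (A : Aligned V₁ V₂ k l) {a b} →
      Twins G (Aligned.p A a) (Aligned.p A b) →
      a F.< b → Form G V₁ V₂
    form-same-path A tw a<b with twins-P (twins-restrict (Aligned.path₁ A) tw) a<b
    ... | inj₁ refl = inj₂ (inj₁ (only-pair tw a<b))
      where
      only-pair : ∀ {a b : Fin 2} → Twins G (Aligned.p A a) (Aligned.p A b) → a F.< b → FormB G _ _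
      only-pair {0F} {1F} tw _        = formB A tw
      only-pair {1F} {1F} tw (s≤s ())
    ... | inj₂ (refl , a≡0 , b≡2) = inj₂ (inj₂ (inj₁ (formC A
      (subst₂ (λ a b → Twins G (Aligned.p A a) (Aligned.p A b))
        (toℕ-injective {j = 0F} a≡0) (toℕ-injective {j = 2F} b≡2) tw))))

    module _ {V₁ V₂ : Subset n} (only : ∀ {x y} → x ∈ V₁ → y ∈ V₁ → x ≡ y)
             (cover : ∀ x → x ∈ V₁ ⊎ x ∈ V₂) where

      -- Apart from its twin, `x` has the same neighbours as the end vertex. The edge between the
      -- twins is unconstrained and decides between the alternatives, as it does in `formA-inner`.
      formA-end : ∀ {m x} (q : PathOrder G V₂ (suc (suc (suc m)))) → x ∈ V₁ → x ∉ V₂ →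
        Twins G x (vertex q 0F) →
        N G x ≡ ⁅ vertex q 1F ⁆ ⊎ N G x ≡ ⁅ vertex q 0F ⁆ ∪ ⁅ vertex q 1F ⁆
      formA-end {x = x} q x∈ x∉ tw = forms (x ~? vertex q 0F)
        where
        x≢ : ∀ {j} → vertex q j ≢ x
        x≢ {j} eq = x∉ (subst (_∈ V₂) eq (vertex∈ q j))
        x~1 : x ~ vertex q 1F
        x~1 =
          from (tw _ x≢ (λ eq → case PathOrder.injective q eq of λ ()))
               (to (PathOrder.induced q 0F 1F) (inj₁ refl))
        at : ∀ y → x ~ y → y ≡ vertex q 0F ⊎ y ≡ vertex q 1F
        at y e with cover y
        ... | inj₁ y∈ = contradiction e (irreflexive (only x∈ y∈))
        ... | inj₂ y∈ with index q y∈
        ...   | 0F , refl = inj₁ refl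
        ...   | j@(suc j′) , refl with from (PathOrder.induced q 0F j)
                  (to (tw (vertex q j) x≢ (λ eq → case PathOrder.injective q eq of λ ())) e)
        ...     | inj₁ j≡1 = inj₂ (cong (vertex q) (toℕ-injective j≡1))
        forms : Dec (x ~ vertex q 0F) → _
        forms (yes x~0) =
          inj₂ (N-≡ λ y → mk⇔ (from ∈∪-pair ∘ at y) (λ y∈ → case to ∈∪-pair y∈ of λ where
          (inj₁ refl) → x~0
          (inj₂ refl) → x~1))
        forms (no x≁0) = inj₁ (N-≡ λ y → mk⇔
          (λ e → case at y e of λ where
            (inj₁ refl) → contradiction e x≁0
            (inj₂ refl) → x∈⁅x⁆ y)
          (λ y∈ → subst (x ~_) (sym (x∈⁅y⁆⇒x≡y _ y∈)) x~1))

      formA-inner : ∀ {m x} (q : PathOrder G V₂ (suc (suc (suc m)))) (i : Fin (suc m)) → x ∈ V₁ →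
        x ∉ V₂ →
        let u = vertex q (inject₁ (inject₁ i))
            v = vertex q (inject₁ (suc i))
            w = vertex q (suc (suc i)) in
        Twins G x v → N G x ≡ ⁅ u ⁆ ∪ ⁅ w ⁆ ⊎ N G x ≡ ⁅ u ⁆ ∪ ⁅ v ⁆ ∪ ⁅ w ⁆
      formA-inner {x = x} q i x∈ x∉ tw = forms (x ~? v)
        where
        u = vertex q (inject₁ (inject₁ i))
        v = vertex q (inject₁ (suc i))
        w = vertex q (suc (suc i))
        u-index : toℕ (inject₁ (inject₁ i)) ≡ toℕ i
        u-index = trans (toℕ-inject₁ (inject₁ i)) (toℕ-inject₁ i)
        v-index : toℕ (inject₁ (suc i)) ≡ suc (toℕ i)
        v-index = toℕ-inject₁ (suc i)
        x≢ : ∀ {j} → vertex q j ≢ x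
        x≢ {j} eq = x∉ (subst (_∈ V₂) eq (vertex∈ q j))
        via-v : ∀ j → inject₁ (suc i) ~[ P _ ] j → x ~ vertex q j
        via-v j e =
          from (tw _ x≢ (λ eq → Graph.irreflexive (P _) (sym (PathOrder.injective q eq)) e))
          (to (PathOrder.induced q _ j) e)
        x~u : x ~ u
        x~u = via-v _ (inj₂ (trans v-index (cong suc (sym u-index))))
        x~w : x ~ w
        x~w = via-v _ (inj₁ (cong suc (sym v-index)))
        at : ∀ y → x ~ y → y ≡ u ⊎ y ≡ v ⊎ y ≡ w
        at y e with cover y
        ... | inj₁ y∈ = contradiction e (irreflexive (only x∈ y∈))
        ... | inj₂ y∈ with j , refl ← index q y∈ with j ≟ᶠ inject₁ (suc i)
        ...   | yes refl = inj₂ (inj₁ refl)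
        ...   | no j≢v with from (PathOrder.induced q _ j)
                              (to (tw (vertex q j) x≢ (j≢v ∘ PathOrder.injective q)) e)
        ...     | inj₁ j≡1+v =
              inj₂ (inj₂ (cong (vertex q) (toℕ-injective (trans j≡1+v (cong suc v-index)))))
        ...     | inj₂ v≡1+j = inj₁ (cong (vertex q) (toℕ-injective
                    (trans (suc-injective (trans (sym v≡1+j) v-index)) (sym u-index))))
        forms : Dec (x ~ v) → _
        forms (yes x~v) =
          inj₂ (N-≡ λ y → mk⇔ (from ∈∪-triple ∘ at y) (λ y∈ → case to ∈∪-triple y∈ of λ where
          (inj₁ refl)        → x~u
          (inj₂ (inj₁ refl)) → x~v
          (inj₂ (inj₂ refl)) → x~w))
        forms (no x≁v) = inj₁ (N-≡ λ y → mk⇔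
          (λ e → case at y e of λ where
            (inj₁ refl)        → from ∈∪-pair (inj₁ refl)
            (inj₂ (inj₁ refl)) → contradiction e x≁v
            (inj₂ (inj₂ refl)) → from ∈∪-pair (inj₂ refl))
          (λ y∈ → case to ∈∪-pair y∈ of λ where
            (inj₁ refl) → x~u
            (inj₂ refl) → x~w))

    formA : ∀ {V₁ V₂ m} (A : Aligned V₁ V₂ 1 (suc (suc (suc m)))) {b} →
      Twins G (Aligned.p A 0F) (Aligned.q A b) → FormA G V₁ V₂
    formA {V₁} {V₂} {m} A tw = by-position _ tw
      where
      open Aligned A
      x = p 0F
      x∈ : x ∈ V₁
      x∈ = vertex∈ path₁ 0F
      only : ∀ {y z} → y ∈ V₁ → z ∈ V₁ → y ≡ z
      only y∈ z∈ with 0F , refl ← index path₁ y∈ | 0F , refl ← index path₁ z∈ = refl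
      V₁≡⁅x⁆ : V₁ ≡ ⁅ x ⁆
      V₁≡⁅x⁆ =
        ⊆-antisym (λ y∈ → subst (_∈ ⁅ x ⁆) (only x∈ y∈) (x∈⁅x⁆ x))
                  (λ y∈ → subst (_∈ V₁) (sym (x∈⁅y⁆⇒x≡y x y∈)) x∈)
      end : (r : PathOrder G V₂ (suc (suc (suc m)))) → Twins G x (vertex r 0F) → FormA G V₁ V₂
      end r tw′ = x , V₁≡⁅x⁆ , m , r , inj₂ (formA-end only cover r x∈ (disjoint x∈) tw′)
      by-position : ∀ b → Twins G x (q b) → FormA G V₁ V₂
      by-position 0F      tw = end path₂ tw
      by-position (suc b) tw with view b
      ... | ‵fromℕ     = end (reverse path₂) tw
      ... | ‵inject₁ i =
            x , V₁≡⁅x⁆ , m , path₂ , inj₁ (i , formA-inner only cover path₂ i x∈ (disjoint x∈) tw)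

module _ {n} {G : Graph n} where
  open Graph G

  -- The path neighbour of each twin is adjacent to the other twin, which gives the two edges common
  -- to all alternatives. Twinship and monotonicity confine the other edges to the two remaining
  -- pairs of this corner, and those two edges would cross each other.
  formD : ∀ {V₁ V₂ k l} (A : Aligned {G = G} V₁ V₂ (suc (suc k)) (suc (suc l))) →
    Twins G (Aligned.p A (fromℕ (suc k))) (Aligned.q A 0F) → FormD G V₁ V₂
  formD {V₁} {V₂} {k} {l} A tw = k , l , path₁ , path₂ , forms (p last ~? q 0F) (p penult ~? q 1F)
    where
    open Aligned A
    penult last : Fin (suc (suc k))
    penult = inject₁ (fromℕ k)
    last   = fromℕ (suc k)
    penult-index : toℕ penult ≡ k
    penult-index = trans (toℕ-inject₁ (fromℕ k)) (toℕ-fromℕ k)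
    last-index : toℕ last ≡ suc k
    last-index = toℕ-fromℕ (suc k)
    last~penult : last ~[ P _ ] penult
    last~penult = inj₂ (trans last-index (cong suc (sym penult-index)))
    penult<last : penult F.< last
    penult<last = ≤-reflexive (sym (trans last-index (cong suc (sym penult-index))))
    penult~0 : p penult ~ q 0F
    penult~0 = symmetric (to (tw (p penult) (F.<⇒≢ penult<last ∘ PathOrder.injective path₁) p≢q)
      (to (PathOrder.induced path₁ last penult) last~penult))
    last~1 : p last ~ q 1F
    last~1 = from (tw (q 1F) (p≢q ∘ sym) (λ eq → case PathOrder.injective path₂ eq of λ ()))
      (to (PathOrder.induced path₂ 0F 1F) (inj₁ refl))
    at-0 : ∀ {i} → i ≢ last → p i ~ q 0F → i ≡ penult
    at-0 {i} i≢last e with from (PathOrder.induced path₁ last i)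
      (from (tw (p i) (i≢last ∘ PathOrder.injective path₁) p≢q) (symmetric e))
    ... | inj₁ i≡1+last =
          contradiction (toℕ<n i) (ℕ.≤⇒≯ (≤-reflexive (trans (cong suc (sym last-index)) (sym i≡1+last))))
    ... | inj₂ last≡1+i =
          toℕ-injective (trans (suc-injective (trans (sym last≡1+i) last-index)) (sym penult-index))
    at-last : ∀ {j} → p last ~ q (suc j) → j ≡ 0F
    at-last {j} e with from (PathOrder.induced path₂ 0F (suc j))
      (to (tw (q (suc j)) (p≢q ∘ sym) (λ eq → case PathOrder.injective path₂ eq of λ ())) e)
    ... | inj₁ j≡1 = toℕ-injective (suc-injective j≡1)
    edge : ∀ i j → p i ~ q j →
      (i ≡ penult × j ≡ 0F) ⊎ (i ≡ last × j ≡ 1F) ⊎ (i ≡ penult × j ≡ 1F) ⊎ (i ≡ last × j ≡ 0F)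
    edge i j e with i ≟ᶠ last
    edge i 0F      e | yes refl = inj₂ (inj₂ (inj₂ (refl , refl)))
    edge i (suc j) e | yes refl = inj₂ (inj₁ (refl , cong suc (at-last e)))
    edge i 0F      e | no i≢last = inj₁ (at-0 i≢last e , refl)
    edge i (suc j) e | no i≢last with F.<-cmp i penult
    ... | tri< i<penult _ _ = case ordered e penult~0 i<penult of λ ()
    ... | tri≈ _ refl _ = inj₂ (inj₂ (inj₁ (refl ,
            F.≤-antisym (ordered e last~1 penult<last) (s≤s z≤n))))
    ... | tri> _ _ penult<i = contradiction
            (toℕ-injective (ℕ.≤-antisym (ℕ.≤-pred (subst (toℕ i <_) (cong suc (sym last-index)) (toℕ<n i)))
              (subst (_≤ toℕ i) (trans (cong suc penult-index) (sym last-index)) penult<i))) i≢last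
    forms : Dec (p last ~ q 0F) → Dec (p penult ~ q 1F) → _ ⊎ _ ⊎ _
    forms (yes e) (yes e′) = case ordered e′ e penult<last of λ ()
    forms (no ¬e) (no ¬e′) = inj₁ λ i j → mk⇔
      (λ e → case edge i j e of λ where
        (inj₁ (refl , refl)) → here refl
        (inj₂ (inj₁ (refl , refl))) → there (here refl)
        (inj₂ (inj₂ (inj₁ (refl , refl)))) → contradiction e ¬e′
        (inj₂ (inj₂ (inj₂ (refl , refl)))) → contradiction e ¬e)
      (λ where
        (here refl) → penult~0
        (there (here refl)) → last~1)
    forms (no ¬e) (yes e′) = inj₂ (inj₁ λ i j → mk⇔
      (λ e → case edge i j e of λ where
        (inj₁ (refl , refl)) → here refl
        (inj₂ (inj₁ (refl , refl))) → there (here refl)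
        (inj₂ (inj₂ (inj₁ (refl , refl)))) → there (there (here refl))
        (inj₂ (inj₂ (inj₂ (refl , refl)))) → contradiction e ¬e)
      (λ where
        (here refl) → penult~0
        (there (here refl)) → last~1
        (there (there (here refl))) → e′))
    forms (yes e₀) (no ¬e′) = inj₂ (inj₂ λ i j → mk⇔
      (λ e → case edge i j e of λ where
        (inj₁ (refl , refl)) → here refl
        (inj₂ (inj₁ (refl , refl))) → there (here refl)
        (inj₂ (inj₂ (inj₁ (refl , refl)))) → contradiction e ¬e′
        (inj₂ (inj₂ (inj₂ (refl , refl)))) → there (there (here refl)))
      (λ where
        (here refl) → penult~0
        (there (here refl)) → last~1
        (there (there (here refl))) → e₀))

  -- The path neighbours of each twin are adjacent to the other twin. If both twins had a successor,
  -- or both a predecessor, two of these edges would cross; hence they lie at opposite ends.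
  twins-corner : ∀ {V₁ V₂ k l} (A : Aligned {G = G} V₁ V₂ k l) {a b} →
    Twins G (Aligned.p A a) (Aligned.q A b) →
    2 ≤ k → 2 ≤ l → (toℕ a ≡ 0 × suc (toℕ b) ≡ l) ⊎ (suc (toℕ a) ≡ k × toℕ b ≡ 0)
  twins-corner {k = k} {l} A {a} {b} tw 2≤k 2≤l = corner (toℕ a ℕ.≟ 0) (toℕ b ℕ.≟ 0)
    where
    open Aligned A
    along₁ : ∀ {i} → a ~[ P k ] i → p i ~ q b
    along₁ {i} e =
      symmetric (to (tw (p i) (λ eq → ~⇒≢ {G = P k} e (sym (PathOrder.injective path₁ eq))) p≢q)
      (to (PathOrder.induced path₁ a i) e))
    along₂ : ∀ {j} → b ~[ P l ] j → p a ~ q j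
    along₂ {j} e =
      from (tw (q j) (p≢q ∘ sym) (λ eq → ~⇒≢ {G = P l} e (sym (PathOrder.injective path₂ eq))))
      (to (PathOrder.induced path₂ b j) e)
    not-both-next : suc (toℕ a) < k → ¬ suc (toℕ b) < l
    not-both-next 1+a<k 1+b<l with i , i≡1+a ← P-next a 1+a<k | j , j≡1+b ← P-next b 1+b<l =
      ℕ.<⇒≱ (≤-reflexive (sym j≡1+b))
        (ordered (along₂ (inj₁ j≡1+b)) (along₁ (inj₁ i≡1+a)) (≤-reflexive (sym i≡1+a)))
    not-both-previous : toℕ a ≢ 0 → toℕ b ≡ 0
    not-both-previous a≢0 with toℕ a in a-index | toℕ b in b-index
    ... | _     | zero  = refl
    ... | zero  | suc _ = contradiction refl a≢0
    ... | suc _ | suc _ with i , a≡1+i ← P-previous a a-index | j , b≡1+j ← P-previous b b-index =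
      contradiction (ordered (along₁ (inj₂ a≡1+i)) (along₂ (inj₂ b≡1+j)) (≤-reflexive (sym a≡1+i)))
        (ℕ.<⇒≱ (≤-reflexive (sym b≡1+j)))
    corner : Dec (toℕ a ≡ 0) → Dec (toℕ b ≡ 0) → _ ⊎ _
    corner (yes a≡0) _ = inj₁ (a≡0 , ℕ.≤-antisym (toℕ<n b)
      (ℕ.≮⇒≥ (not-both-next (≤-trans (s≤s (s≤s (≤-reflexive a≡0))) 2≤k))))
    corner (no a≢0) (no b≢0) = contradiction (not-both-previous a≢0) b≢0
    corner (no a≢0) (yes b≡0) = inj₂ (ℕ.≤-antisym (toℕ<n a)
      (ℕ.≮⇒≥ λ 1+a<k → not-both-next 1+a<k (≤-trans (s≤s (s≤s (≤-reflexive b≡0))) 2≤l)) , b≡0)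

  module _ (somewhere : ∀ x → ∃[ y ] x ~ y) (¬forcedBy1 : ¬ ForcedBy G 1) where

    -- Two vertices of which none is isolated form an edge, and one seed forces it.
    ¬aligned-1-1 : ∀ {V₁ V₂} → ¬ Aligned {G = G} V₁ V₂ 1 1
    ¬aligned-1-1 A = ¬forcedBy1 (p 0F ∷ [] , s≤s z≤n , derived)
      where
      open Aligned A
      vertices : ∀ x → x ≡ p 0F ⊎ x ≡ q 0F
      vertices x with cover x
      ... | inj₁ x∈ with 0F , refl ← index path₁ x∈ = inj₁ refl
      ... | inj₂ x∈ with 0F , refl ← index path₂ x∈ = inj₂ refl
      0~0 : p 0F ~ q 0F
      0~0 with y , e ← somewhere (p 0F) with vertices y
      ... | inj₁ refl = contradiction e (irreflexive refl)
      ... | inj₂ refl = e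
      derived : ∀ x → Derived G (_∈ˡ p 0F ∷ []) x
      derived x with vertices x
      ... | inj₁ refl = seed (here refl)
      ... | inj₂ refl = forced (seed (here refl)) 0~0 λ y e y≢x → case vertices y of λ where
        (inj₁ refl) → contradiction e (irreflexive refl)
        (inj₂ refl) → contradiction refl y≢x

    -- Adjacent twins make a triangle, which has form (b) with the paths exchanged. Otherwise the
    -- graph is a path with middle vertex `q c`, forced from `q b` alone. The variables `b` and `c`
    -- let one argument serve both ends of the edge.
    form-single-2 : ∀ {V₁ V₂} (A : Aligned {G = G} V₁ V₂ 1 2) b c → b ≢ c → (∀ j → j ≡ b ⊎ j ≡ c) →
      b ~[ P 2 ] c → Twins G (Aligned.p A 0F) (Aligned.q A b) → Form G V₂ V₁
    form-single-2 {V₁} {V₂} A b c b≢c which b~c tw = by-edge (p 0F ~? q b)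
      where
      open Aligned A
      qb~qc : q b ~ q c
      qb~qc = to (PathOrder.induced path₂ b c) b~c
      p~qc : p 0F ~ q c
      p~qc = from (tw (q c) (p≢q ∘ sym) (b≢c ∘ sym ∘ PathOrder.injective path₂)) qb~qc
      vertices : ∀ x → x ≡ p 0F ⊎ x ≡ q b ⊎ x ≡ q c
      vertices x with cover x
      ... | inj₁ x∈ with 0F , refl ← index path₁ x∈ = inj₁ refl
      ... | inj₂ x∈ with j , refl ← index path₂ x∈ = inj₂ (Sum.map (cong q) (cong q) (which j))
      by-edge : Dec (p 0F ~ q b) → Form G V₂ V₁
      by-edge (yes p~qb) =
        form-same-path somewhere (swap-aligned A) {0F} {1F} all-adjacent (s≤s z≤n)
        where
        p~ : ∀ j → q j ~ p 0F
        p~ j with which j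
        ... | inj₁ refl = symmetric p~qb
        ... | inj₂ refl = symmetric p~qc
        all-adjacent : Twins G (q 0F) (q 1F)
        all-adjacent y y≢0 y≢1 with cover y
        ... | inj₁ y∈ with 0F , refl ← index path₁ y∈ = mk⇔ (λ _ → p~ 1F) (λ _ → p~ 0F)
        ... | inj₂ y∈ with index path₂ y∈
        ...   | 0F , refl = contradiction refl y≢0
        ...   | 1F , refl = contradiction refl y≢1
      by-edge (no p≁qb) = contradiction (q b ∷ [] , s≤s z≤n , derived) ¬forcedBy1
        where
        derived-c : Derived G (_∈ˡ q b ∷ []) (q c)
        derived-c = forced (seed (here refl)) qb~qc λ y e y≢ → case vertices y of λ where
          (inj₁ refl)        → contradiction (symmetric e) p≁qb
          (inj₂ (inj₁ refl)) → seed (here refl)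
          (inj₂ (inj₂ refl)) → contradiction refl y≢
        derived : ∀ x → Derived G (_∈ˡ q b ∷ []) x
        derived x with vertices x
        ... | inj₂ (inj₁ refl) = seed (here refl)
        ... | inj₂ (inj₂ refl) = derived-c
        ... | inj₁ refl = forced derived-c (symmetric p~qc) λ y e y≢ → case vertices y of λ where
          (inj₁ refl)        → contradiction refl y≢
          (inj₂ (inj₁ refl)) → seed (here refl)
          (inj₂ (inj₂ refl)) → derived-c

    form-single : ∀ {V₁ V₂ l} (A : Aligned {G = G} V₁ V₂ 1 l) {b} →
      Twins G (Aligned.p A 0F) (Aligned.q A b) →
      Form G V₁ V₂ ⊎ Form G V₂ V₁
    form-single {l = 1} A _ = contradiction A ¬aligned-1-1
    form-single {l = 2} A {0F} tw =
      inj₂ (form-single-2 A 0F 1F (λ ()) (λ { 0F → inj₁ refl ; 1F → inj₂ refl }) (inj₁ refl) tw)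
    form-single {l = 2} A {1F} tw =
      inj₂ (form-single-2 A 1F 0F (λ ()) (λ { 0F → inj₂ refl ; 1F → inj₁ refl }) (inj₂ refl) tw)
    form-single {l = suc (suc (suc _))} A tw = inj₁ (inj₁ (formA somewhere A tw))

    form-distinct-paths : ∀ {V₁ V₂ k l} (A : Aligned {G = G} V₁ V₂ k l) {a b} →
      Twins G (Aligned.p A a) (Aligned.q A b) → Form G V₁ V₂ ⊎ Form G V₂ V₁
    form-distinct-paths {k = 1} A {0F} tw = form-single A tw
    form-distinct-paths {l = 1} A {b = 0F} tw =
      Sum.swap (form-single (swap-aligned A) (twins-sym G tw))
    form-distinct-paths {k = suc (suc k)} {suc (suc l)} A {a} {b} tw
      with twins-corner A tw (s≤s (s≤s z≤n)) (s≤s (s≤s z≤n))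
    ... | inj₁ (a≡0 , b-last) = inj₂ (inj₂ (inj₂ (inj₂ (formD (swap-aligned A)
      (twins-sym G (subst₂ (λ a b → Twins G (Aligned.p A a) (Aligned.q A b)) (toℕ-injective {j = 0F} a≡0)
        (toℕ-injective (trans (suc-injective b-last) (sym (toℕ-fromℕ (suc l))))) tw))))))
    ... | inj₂ (a-last , b≡0) = inj₁ (inj₂ (inj₂ (inj₂ (formD A
      (subst₂ (λ a b → Twins G (Aligned.p A a) (Aligned.q A b))
        (toℕ-injective (trans (suc-injective a-last) (sym (toℕ-fromℕ (suc k)))))
        (toℕ-injective {j = 0F} b≡0) tw)))))

    form-along : ∀ {V₁ V₂ k l} (A : Aligned {G = G} V₁ V₂ k l) → ∀ {u w} → u ∈ V₁ → w ∈ V₁ → u ≢ w →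
      Twins G u w → Form G V₁ V₂
    form-along A u∈ w∈ u≢w tw
      with a , refl ← index (Aligned.path₁ A) u∈ | b , refl ← index (Aligned.path₁ A) w∈
      with F.<-cmp a b
    ... | tri< a<b _ _  = form-same-path somewhere A tw a<b
    ... | tri≈ _ refl _ = contradiction refl u≢w
    ... | tri> _ _ b<a  = form-same-path somewhere A (twins-sym G tw) b<a

    twins⇒form : ∀ {V₁ V₂ k l} → Aligned {G = G} V₁ V₂ k l → ∀ {u w} → u ≢ w → Twins G u w →
      Form G V₁ V₂ ⊎ Form G V₂ V₁
    twins⇒form A {u} {w} u≢w tw with Aligned.cover A u | Aligned.cover A w
    ... | inj₁ u∈ | inj₂ w∈
      with a , refl ← index (Aligned.path₁ A) u∈ | b , refl ← index (Aligned.path₂ A) w∈ =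
      form-distinct-paths A tw
    ... | inj₂ u∈ | inj₁ w∈
      with b , refl ← index (Aligned.path₂ A) u∈ | a , refl ← index (Aligned.path₁ A) w∈ =
      form-distinct-paths A (twins-sym G tw)
    ... | inj₁ u∈ | inj₁ w∈ = inj₁ (form-along A u∈ w∈ u≢w tw)
    ... | inj₂ u∈ | inj₂ w∈ = inj₂ (form-along (swap-aligned A) u∈ w∈ u≢w tw)

-- From the forms to twins

module _ {n} {G : Graph n} where
  open Graph G

  path-neighbour : ∀ {V k x} → PathOrder G V (suc (suc k)) → x ∈ V → ∃[ y ] x ~ y
  path-neighbour q x∈ with index q x∈
  ... | 0F , refl    = vertex q 1F , to (PathOrder.induced q 0F 1F) (inj₁ refl)
  ... | suc i , refl = vertex q (inject₁ i) ,
    to (PathOrder.induced q (suc i) (inject₁ i)) (inj₂ (cong suc (sym (toℕ-inject₁ i))))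

  ~⇔∈ : ∀ {x S} → N G x ≡ S → ∀ y → (x ~ y) ⇔ (y ∈ S)
  ~⇔∈ eq y = mk⇔ (subst (y ∈_) eq ∘ from (∈N {G = G})) (to (∈N {G = G}) ∘ subst (y ∈_) (sym eq))

  -- Equivalent to b = 2: twins are a fort of size 2, and the absence of isolated vertices excludes
  -- size 1.
  TwinsWithoutIsolated : Set
  TwinsWithoutIsolated = (∃[ u ] ∃[ w ] u ≢ w × Twins G u w) × (∀ x → ∃[ y ] x ~ y)

  module _ {V₁ V₂ : Subset n} (cover : ∀ x → x ∈ V₁ ⊎ x ∈ V₂)
           (disjoint : ∀ {x} → x ∈ V₁ → x ∉ V₂) where

    formA⇒ : FormA G V₁ V₂ → TwinsWithoutIsolated
    formA⇒ (x , refl , m , q , shape) = twins shape , somewhere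
      where
      x≢ : ∀ j → x ≢ vertex q j
      x≢ j eq = disjoint (x∈⁅x⁆ x) (subst (_∈ V₂) (sym eq) (vertex∈ q j))
      twins : _ → ∃[ u ] ∃[ w ] u ≢ w × Twins G u w
      twins (inj₁ (i , Nx)) = x , vertex q (inject₁ (suc i)) , x≢ _ , tw
        where
        v-index : toℕ (inject₁ (suc i)) ≡ suc (toℕ i)
        v-index = toℕ-inject₁ (suc i)
        u-index : toℕ (inject₁ (inject₁ i)) ≡ toℕ i
        u-index = trans (toℕ-inject₁ (inject₁ i)) (toℕ-inject₁ i)
        -- The two alternatives for the neighbourhood differ only at `v`, the twin itself, and agree
        -- on every other vertex.
        at : ∀ y → y ≢ vertex q (inject₁ (suc i)) →
          (x ~ y) ⇔ (y ≡ vertex q (inject₁ (inject₁ i)) ⊎ y ≡ vertex q (suc (suc i)))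
        at y y≢v = case Nx of λ where
          (inj₁ eq) → mk⇔ (to ∈∪-pair ∘ to (~⇔∈ eq y)) (from (~⇔∈ eq y) ∘ from ∈∪-pair)
          (inj₂ eq) → mk⇔
            (λ e → case to ∈∪-triple (to (~⇔∈ eq y) e) of λ where
              (inj₁ y≡u)        → inj₁ y≡u
              (inj₂ (inj₁ y≡v)) → contradiction y≡v y≢v
              (inj₂ (inj₂ y≡w)) → inj₂ y≡w)
            (from (~⇔∈ eq y) ∘ from ∈∪-triple ∘ Sum.map₂ inj₂)
        tw : Twins G x (vertex q (inject₁ (suc i)))
        tw y y≢x y≢v with cover y
        ... | inj₁ y∈ = contradiction (x∈⁅y⁆⇒x≡y x y∈) y≢x
        ... | inj₂ y∈ with j , refl ← index q y∈ = mk⇔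
          (λ e → to (PathOrder.induced q _ j) (case to (at y y≢v) e of λ where
            (inj₁ y≡u) → inj₂ (trans v-index (cong suc (trans (sym u-index)
              (cong toℕ (sym (PathOrder.injective q y≡u))))))
            (inj₂ y≡w) → inj₁ (trans (cong toℕ (PathOrder.injective q y≡w)) (cong suc (sym v-index)))))
          (λ e → from (at y y≢v) (case from (PathOrder.induced q _ j) e of λ where
            (inj₁ j≡1+v) → inj₂ (cong (vertex q) (toℕ-injective (trans j≡1+v (cong suc v-index))))
            (inj₂ v≡1+j) → inj₁ (cong (vertex q) (toℕ-injective
              (trans (suc-injective (trans (sym v≡1+j) v-index)) (sym u-index))))))
      twins (inj₂ Nx) = x , vertex q 0F , x≢ _ , tw
        where
        at : ∀ y → y ≢ vertex q 0F → (x ~ y) ⇔ (y ≡ vertex q 1F)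
        at y y≢0 = case Nx of λ where
          (inj₁ eq) → mk⇔ (x∈⁅y⁆⇒x≡y _ ∘ to (~⇔∈ eq y)) (λ { refl → from (~⇔∈ eq y) (x∈⁅x⁆ y) })
          (inj₂ eq) → mk⇔
            (λ e → case to ∈∪-pair (to (~⇔∈ eq y) e) of λ where
              (inj₁ y≡0) → contradiction y≡0 y≢0
              (inj₂ y≡1) → y≡1)
            (from (~⇔∈ eq y) ∘ from ∈∪-pair ∘ inj₂)
        tw : Twins G x (vertex q 0F)
        tw y y≢x y≢0 with cover y
        ... | inj₁ y∈ = contradiction (x∈⁅y⁆⇒x≡y x y∈) y≢x
        ... | inj₂ y∈ with j , refl ← index q y∈ = mk⇔
          (λ e → to (PathOrder.induced q 0F j) (inj₁ (cong toℕ (PathOrder.injective q (to (at y y≢0) e)))))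
          (λ e → from (at y y≢0) (case from (PathOrder.induced q 0F j) e of λ where
            (inj₁ j≡1) → cong (vertex q) (toℕ-injective j≡1)))
      x-neighbour : _ → ∃[ y ] x ~ y
      x-neighbour (inj₁ (i , inj₁ eq)) = _ , from (~⇔∈ eq _) (from ∈∪-pair (inj₁ refl))
      x-neighbour (inj₁ (i , inj₂ eq)) = _ , from (~⇔∈ eq _) (from ∈∪-triple (inj₁ refl))
      x-neighbour (inj₂ (inj₁ eq))     = _ , from (~⇔∈ eq _) (x∈⁅x⁆ _)
      x-neighbour (inj₂ (inj₂ eq))     = _ , from (~⇔∈ eq _) (from ∈∪-pair (inj₂ refl))
      somewhere : ∀ y → ∃[ z ] y ~ z
      somewhere y with cover y
      ... | inj₁ y∈ with refl ← x∈⁅y⁆⇒x≡y x y∈ = x-neighbour shape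
      ... | inj₂ y∈ = path-neighbour q y∈

    formB⇒ : FormB G V₁ V₂ → TwinsWithoutIsolated
    formB⇒ (p , k , q , same , single) =
      (vertex p 0F , vertex p 1F , (λ eq → case PathOrder.injective p eq of λ ()) , tw) , somewhere k q single
      where
      tw : Twins G (vertex p 0F) (vertex p 1F)
      tw y y≢0 y≢1 with cover y
      ... | inj₂ y∈ = mk⇔
        (λ e → to (∈N {G = G}) (proj₁ (x∈p∩q⁻ _ V₂ (subst (y ∈_) same (x∈p∩q⁺ (from (∈N {G = G}) e , y∈))))))
        (λ e → to (∈N {G = G}) (proj₁ (x∈p∩q⁻ _ V₂ (subst (y ∈_) (sym same) (x∈p∩q⁺ (from (∈N {G = G}) e , y∈))))))
      ... | inj₁ y∈ with index p y∈
      ...   | 0F , refl = contradiction refl y≢0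
      ...   | 1F , refl = contradiction refl y≢1
      somewhere : ∀ k → PathOrder G V₂ k → (k ≡ 1 → ∀ x → x ∈ V₂ → _ × _) → ∀ y → ∃[ z ] y ~ z
      somewhere k q single y with cover y
      somewhere k             q single y | inj₁ y∈ = path-neighbour p y∈
      somewhere 0             q single y | inj₂ y∈ = case index q y∈ of λ ()
      -- A path on one vertex offers no neighbour of its own; the clause for `k ≡ 1` supplies one.
      somewhere 1             q single y | inj₂ y∈ =
        vertex p 0F , symmetric (proj₁ (single refl y y∈))
      somewhere (suc (suc k)) q single y | inj₂ y∈ = path-neighbour q y∈

    formC⇒ : FormC G V₁ V₂ → TwinsWithoutIsolated
    formC⇒ (p , k , q , shape) =
      (vertex p 0F , vertex p 2F , (λ eq → case PathOrder.injective p eq of λ ()) , tw shape) , somewhere k q shape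
      where
      same-N : ∀ {S} → N G (vertex p 0F) ≡ S → N G (vertex p 2F) ≡ S →
        Twins G (vertex p 0F) (vertex p 2F)
      same-N eq eq′ y _ _ =
        mk⇔ (from (~⇔∈ eq′ y) ∘ to (~⇔∈ eq y)) (from (~⇔∈ eq y) ∘ to (~⇔∈ eq′ y))
      tw : _ → Twins G (vertex p 0F) (vertex p 2F)
      tw (inj₁ (eq , eq′ , _))         = same-N eq eq′
      tw (inj₂ (_ , _ , eq , eq′)) = same-N eq eq′
      somewhere : ∀ k → PathOrder G V₂ k →
        (N G (vertex p 0F) ≡ ⁅ vertex p 1F ⁆ × N G (vertex p 2F) ≡ ⁅ vertex p 1F ⁆ ×
          (k ≡ 1 → ∀ x → x ∈ V₂ → vertex p 1F ~ x)) ⊎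
        (∃[ x ] x ∈ V₂ × N G (vertex p 0F) ≡ ⁅ vertex p 1F ⁆ ∪ ⁅ x ⁆ ×
          N G (vertex p 2F) ≡ ⁅ vertex p 1F ⁆ ∪ ⁅ x ⁆) →
        ∀ y → ∃[ z ] y ~ z
      somewhere k q shape y with cover y
      somewhere k             q shape y | inj₁ y∈ = path-neighbour p y∈
      somewhere 0             q shape y | inj₂ y∈ = case index q y∈ of λ ()
      somewhere 1             q (inj₁ (_ , _ , single)) y | inj₂ y∈ =
        vertex p 1F , symmetric (single refl y y∈)
      somewhere 1             q (inj₂ (x , x∈ , eq , _)) y | inj₂ y∈ with index q x∈ | index q y∈
      ... | 0F , refl | 0F , refl =
            vertex p 0F , symmetric (from (~⇔∈ eq y) (from ∈∪-pair (inj₂ refl)))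
      somewhere (suc (suc k)) q shape y | inj₂ y∈ = path-neighbour q y∈

    formD⇒ : FormD G V₁ V₂ → TwinsWithoutIsolated
    formD⇒ (k , l , p , q , shape) =
      (vertex p last , vertex q 0F , p≢q , tw (edges shape)) , somewhere
      where
      penult last : Fin (suc (suc k))
      penult = inject₁ (fromℕ k)
      last   = fromℕ (suc k)
      penult-index : toℕ penult ≡ k
      penult-index = trans (toℕ-inject₁ (fromℕ k)) (toℕ-fromℕ k)
      last-index : toℕ last ≡ suc k
      last-index = toℕ-fromℕ (suc k)
      p≢q : ∀ {i j} → vertex p i ≢ vertex q j
      p≢q {i} {j} eq = disjoint (vertex∈ p i) (subst (_∈ V₂) (sym eq) (vertex∈ q j))
      -- The common content of the three alternatives: the two edges that create the twins, and the
      -- confinement of all edges between the paths to one corner.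
      Edges : Set
      Edges = vertex p penult ~ vertex q 0F × vertex p last ~ vertex q 1F ×
        (∀ i j → vertex p i ~ vertex q j → (i ≡ penult ⊎ i ≡ last) × (j ≡ 0F ⊎ j ≡ 1F))
      edges : _ → Edges
      edges (inj₁ iff) = from (iff _ _) (here refl) , from (iff _ _) (there (here refl)) ,
        λ i j e → case to (iff i j) e of λ where
          (here refl)         → inj₁ refl , inj₁ refl
          (there (here refl)) → inj₂ refl , inj₂ refl
      edges (inj₂ (inj₁ iff)) = from (iff _ _) (here refl) , from (iff _ _) (there (here refl)) ,
        λ i j e → case to (iff i j) e of λ where
          (here refl)                 → inj₁ refl , inj₁ refl
          (there (here refl))         → inj₂ refl , inj₂ refl
          (there (there (here refl))) → inj₁ refl , inj₂ refl
      edges (inj₂ (inj₂ iff)) = from (iff _ _) (here refl) , from (iff _ _) (there (here refl)) ,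
        λ i j e → case to (iff i j) e of λ where
          (here refl)                 → inj₁ refl , inj₁ refl
          (there (here refl))         → inj₂ refl , inj₂ refl
          (there (there (here refl))) → inj₂ refl , inj₁ refl
      tw : Edges → Twins G (vertex p last) (vertex q 0F)
      tw (e₁ , e₂ , corner) y y≢last y≢0 with cover y
      ... | inj₁ y∈ with i , refl ← index p y∈ = mk⇔
        (λ e → case from (PathOrder.induced p last i) e of λ where
          (inj₁ i≡1+last) → contradiction (toℕ<n i)
            (ℕ.≤⇒≯ (≤-reflexive (trans (cong suc (sym last-index)) (sym i≡1+last))))
          (inj₂ last≡1+i) → symmetric (subst (λ i → vertex p i ~ vertex q 0F)
            (toℕ-injective (trans penult-index (suc-injective (trans (sym last-index) last≡1+i)))) e₁))
        (λ e → case proj₁ (corner i 0F (symmetric e)) of λ where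
          (inj₁ refl) → to (PathOrder.induced p last penult) (inj₂ (trans last-index (cong suc (sym penult-index))))
          (inj₂ refl) → contradiction refl y≢last)
      ... | inj₂ y∈ with j , refl ← index q y∈ = mk⇔
        (λ e → case proj₂ (corner last j e) of λ where
          (inj₁ refl) → contradiction refl y≢0
          (inj₂ refl) → to (PathOrder.induced q 0F 1F) (inj₁ refl))
        (λ e → case from (PathOrder.induced q 0F j) e of λ where
          (inj₁ j≡1) → subst (λ j → vertex p last ~ vertex q j) (toℕ-injective (sym j≡1)) e₂)
      somewhere : ∀ y → ∃[ z ] y ~ z
      somewhere y with cover y
      ... | inj₁ y∈ = path-neighbour p y∈
      ... | inj₂ y∈ = path-neighbour q y∈

    form⇒ : Form G V₁ V₂ → TwinsWithoutIsolated
    form⇒ = [ formA⇒ , [ formB⇒ , [ formC⇒ , formD⇒ ]′ ]′ ]′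

-- Values of z and b, and the three cases

Jumps : (ℕ → Set) → ℕ → Set
Jumps Q k = ¬ Q k × Q (suc k)

jumps⇔ : ∀ {Q z} → (∀ k → Q k ⇔ z ≤ k) → ∀ k → Jumps Q k ⇔ (z ≡ suc k)
jumps⇔ iff k = mk⇔
  (λ (¬Qk , Q1+k) → ℕ.≤-antisym (to (iff (suc k)) Q1+k) (ℕ.≰⇒> (¬Qk ∘ from (iff k))))
  (λ { refl → ℕ.1+n≰n ∘ to (iff k) , from (iff (suc k)) ≤-refl })

z+b≡4-cases : ∀ {z b} → 1 ≤ z → 1 ≤ b → z + b ≡ 4 →
  (z ≡ 3 × b ≡ 1) ⊎ (z ≡ 1 × b ≡ 3) ⊎ (z ≡ 2 × b ≡ 2)
z+b≡4-cases {1} _ _ refl = inj₂ (inj₁ (refl , refl))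
z+b≡4-cases {2} _ _ refl = inj₂ (inj₂ (refl , refl))
z+b≡4-cases {3} _ _ refl = inj₁ (refl , refl)
z+b≡4-cases {4} {suc _} _ _ ()
z+b≡4-cases {suc (suc (suc (suc (suc _))))} _ _ ()

module _ {n} {G : Graph n} where
  open Graph G

  -- For a property with a threshold, `Jumps Q k` places the threshold at `1 + k`. The indices (2,
  -- 0), (0, 2) and (1, 1) thus stand for (z, b) = (3, 1), (1, 3) and (2, 2).
  span+3≡n⇔jumps : 1 ≤ n → (span G + 3 ≡ n) ⇔
    ((Jumps (ForcedBy G) 2 × Jumps (FortOf G) 0) ⊎
     (Jumps (ForcedBy G) 0 × Jumps (FortOf G) 2) ⊎
     (Jumps (ForcedBy G) 1 × Jumps (FortOf G) 1))
  span+3≡n⇔jumps 1≤n = mk⇔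
    (Sum.map (at 2 0) (Sum.map (at 0 2) (at 1 1)) ∘
      z+b≡4-cases (1≤z G 1≤n) (1≤b G 1≤n) ∘ to (span+3≡n⇔z+b≡4 G 1≤n))
    (from (span+3≡n⇔z+b≡4 G 1≤n) ∘ [ sum 2 0 , [ sum 0 2 , sum 1 1 ]′ ]′)
    where
    at : ∀ i j → minForcing G 1≤n ≡ suc i × minFort G 1≤n ≡ suc j →
      Jumps (ForcedBy G) i × Jumps (FortOf G) j
    at i j (z≡ , b≡) = from (jumps⇔ (forcedBy⇔z≤ G 1≤n) i) z≡ , from (jumps⇔ (fortOf⇔b≤ G 1≤n) j) b≡
    sum : ∀ i j → Jumps (ForcedBy G) i × Jumps (FortOf G) j →
      minForcing G 1≤n + minFort G 1≤n ≡ suc i + suc j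
    sum i j (z-jump , b-jump) =
      cong₂ _+_ (to (jumps⇔ (forcedBy⇔z≤ G 1≤n) i) z-jump) (to (jumps⇔ (fortOf⇔b≤ G 1≤n) j) b-jump)

  fortOf-mono : ∀ {j k} → j ≤ k → FortOf G j → FortOf G k
  fortOf-mono j≤k (ws , ≤j , fort) = ws , ≤-trans ≤j j≤k , fort

  -- The paths of a drawing are nonempty, and their first vertices are the two seeds. Conversely,
  -- the two chains are both nonempty, since otherwise one seed would be enough.
  twoParallelPaths⇔ : TwoParallelPaths G ⇔ Jumps (ForcedBy G) 1
  twoParallelPaths⇔ = mk⇔
    (λ (¬path , D) → ¬path ∘ from isPath⇔forcedBy1 ,
      forcedBy2 (PathOrder.nonempty (StandardDrawing.path₁ D))
                (PathOrder.nonempty (StandardDrawing.path₂ D)) (drawing⇒paths D))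
    (λ (¬1 , 2-forced) → ¬1 ∘ to isPath⇔forcedBy1 , drawing ¬1 (proj₂ (proj₂ (forcedBy2⇒paths 2-forced))))
    where
    forcedBy2 : ∀ {k l} → 1 ≤ k → 1 ≤ l → TwoPaths G ⊤ k l → ForcedBy G 2
    forcedBy2 (s≤s _) (s≤s _) = paths⇒forcedBy2
    drawing : ¬ ForcedBy G 1 → ∀ {k l} → TwoPaths G ⊤ k l → StandardDrawing G
    drawing ¬1 {k}     {zero}  C = contradiction (paths⇒forcedBy1 C) ¬1
    drawing ¬1 {zero}  {suc l} C = contradiction (paths⇒forcedBy1 (swap-paths C)) ¬1
    drawing ¬1 {suc k} {suc l} C = paths⇒drawing C

  somewhere⇔ : (¬ FortOf G 1) ⇔ (∀ x → ∃[ y ] x ~ y)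
  somewhere⇔ = mk⇔ f g
    where
    f : ¬ FortOf G 1 → ∀ x → ∃[ y ] x ~ y
    f ¬1 x with any? (x ~?_)
    ... | yes found = found
    ... | no  none  =
          contradiction (from (fortOf1⇔isolated {G = G}) (x , λ y x~y → none (y , x~y))) ¬1
    g : (∀ x → ∃[ y ] x ~ y) → ¬ FortOf G 1
    g somewhere 1-fort with v , isolated ← to (fortOf1⇔isolated {G = G}) 1-fort
      with y , v~y ← somewhere v = isolated y v~y

  drawing⇒aligned : (D : StandardDrawing G) →
    Aligned {G = G} (StandardDrawing.V₁ D) (StandardDrawing.V₂ D) (StandardDrawing.k₁ D) (StandardDrawing.k₂ D)
  drawing⇒aligned D = record
    { cover    = λ x → x∈p∪q⁻ V₁ V₂ (subst (x ∈_) (sym cover) ∈⊤)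
    ; disjoint = λ {x} x∈V₁ x∈V₂ → ∉⊥ (subst (x ∈_) disjoint (x∈p∩q⁺ (x∈V₁ , x∈V₂)))
    ; path₁    = path₁
    ; path₂    = path₂
    ; ordered  = TwoPaths.ordered (drawing⇒paths D)
    }
    where open StandardDrawing D

  hasForm : Jumps (ForcedBy G) 1 → Jumps (FortOf G) 1 → ∀ D → HasForm {G = G} D
  hasForm (¬forcedBy1 , _) (¬fortOf1 , 2-fort) D
    with u , w , u≢w , tw ← fortOf2⇒twins {G = G} ¬fortOf1 2-fort =
    twins⇒form (to somewhere⇔ ¬fortOf1) ¬forcedBy1 (drawing⇒aligned D) u≢w tw

  hasForm⇒ : ∀ D → HasForm {G = G} D → Jumps (FortOf G) 1
  hasForm⇒ D form =
    let (_ , _ , u≢w , tw) , somewhere =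
          [ form⇒ cover disjoint
          , form⇒ (Sum.swap ∘ cover) (λ x∈₂ x∈₁ → disjoint x∈₁ x∈₂) ]′ form
    in from somewhere⇔ somewhere , twins⇒fortOf2 {G = G} u≢w tw
    where open Aligned (drawing⇒aligned D)

  -- Paths on at most three vertices have forts of size at most 2, and paths on six or more have
  -- none of size 3. The order is split through a separate variable `k`, so that `G` stays fixed.
  short-path : 1 ≤ n → G ≅ P n → Jumps (FortOf G) 2 → G ≅ P 4 ⊎ G ≅ P 5
  short-path 1≤n G≅P (¬2 , 3-fort) = by-order n G≅P 1≤n
    where
    by-order : ∀ k → G ≅ P k → 1 ≤ k → G ≅ P 4 ⊎ G ≅ P 5
    by-order 1 iso _ =
      contradiction (fortOf-mono (s≤s z≤n) (fortOf-≅ {G = P 1} {G} (≅-sym {G = G} {P 1} iso) fortOf-P1)) ¬2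
    by-order 2 iso _ = contradiction (fortOf-≅ {G = P 2} {G} (≅-sym {G = G} {P 2} iso) fortOf-P2) ¬2
    by-order 3 iso _ = contradiction (fortOf-≅ {G = P 3} {G} (≅-sym {G = G} {P 3} iso) fortOf-P3) ¬2
    by-order 4 iso _ = inj₁ iso
    by-order 5 iso _ = inj₂ iso
    by-order (suc (suc (suc (suc (suc (suc k)))))) iso _ = contradiction
      (fortOf-P⇒4≤ (s≤s (s≤s (s≤s (s≤s (s≤s (s≤s z≤n)))))) (fortOf-≅ {G = G} {P _} iso 3-fort)) (ℕ.<-irrefl refl)

  short-path⇒ : ∀ {k} → ¬ ForcedBy G 0 → 4 ≤ k → FortOf (P k) 3 → G ≅ P k →
    Jumps (ForcedBy G) 0 × Jumps (FortOf G) 2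
  short-path⇒ {k} ¬0 4≤k 3-fort iso =
    (¬0 , paths⇒forcedBy1 (≅P⇒paths iso)) ,
    ((λ 2-fort → ℕ.<-irrefl refl (fortOf-P⇒3≤ 4≤k (fortOf-≅ {G = G} {P _} iso 2-fort))) ,
     fortOf-≅ {G = P k} {G} (≅-sym {G = G} {P k} iso) 3-fort)

module _ {n} {G : Graph n} where

  isolated⇒∪K₁ : 1 ≤ n → Jumps (ForcedBy G) 2 → FortOf G 1 →
    ∃[ m ] ∃[ H ] TwoParallelPaths {m} H × G ≅ H ∪K₁
  isolated⇒∪K₁ (s≤s _) (¬2 , 3-forced) 1-fort with v , isolated ← to (fortOf1⇔isolated {G = G}) 1-fort =
    _ , delete G v , from twoParallelPaths⇔ (¬2 ∘ forcedBy-embed ext , forcedBy-restrict ext 3-forced) , ≅∪K₁ ext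
    where ext = delete-isolatedExtension {G = G} isolated

  ∪K₁⇒ : ∀ {m} {H : Graph m} → TwoParallelPaths H → G ≅ H ∪K₁ → Jumps (ForcedBy G) 2 × FortOf G 1
  ∪K₁⇒ {H = H} tpp iso with ¬1 , 2-forced ← to twoParallelPaths⇔ tpp =
    (¬1 ∘ forcedBy-restrict ext , forcedBy-embed ext 2-forced) , fortOf1 ext
    where ext = ≅∪K₁⇒isolatedExtension {H = H} {G} iso

theorem17 : ∀ (n : ℕ) → 1 ≤ n → (G : Graph n) →
    (span G + 3 ≡ n) ⇔
    ( (∃[ m ] ∃[ H ] TwoParallelPaths {m} H × G ≅ H ∪K₁)
    ⊎ (G ≅ P 4 ⊎ G ≅ P 5)
    ⊎ (TwoParallelPaths G × (∀ (D : StandardDrawing G) → HasForm D)))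
theorem17 n 1≤n G = mk⇔
  (Sum.map
    (λ (z-jump , (_ , 1-fort)) → isolated⇒∪K₁ 1≤n z-jump 1-fort)
    (Sum.map
      (λ ((_ , 1-forced) , b-jump) → short-path {G = G} 1≤n (from isPath⇔forcedBy1 1-forced) b-jump)
      (λ (z-jump , b-jump) → from twoParallelPaths⇔ z-jump , hasForm z-jump b-jump))
  ∘ to (span+3≡n⇔jumps 1≤n))
  (from (span+3≡n⇔jumps 1≤n) ∘ Sum.map
    (λ (_ , _ , tpp , iso) → let z-jump , 1-fort = ∪K₁⇒ tpp iso in z-jump , ¬fortOf0 , 1-fort)
    (Sum.map
      [ short-path⇒ ¬forcedBy0 ≤-refl fortOf-P4 , short-path⇒ ¬forcedBy0 (n≤1+n 4) fortOf-P5 ]′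
      -- One drawing is enough here, namely the one contained in `TwoParallelPaths`: its form
      -- already determines b.
      (λ (tpp@(_ , D) , form) → to twoParallelPaths⇔ tpp , hasForm⇒ D (form D))))
  where
  ¬fortOf0 : ¬ FortOf G 0
  ¬fortOf0 = ℕ.<⇒≱ (1≤b G 1≤n) ∘ to (fortOf⇔b≤ G 1≤n 0)
  ¬forcedBy0 : ¬ ForcedBy G 0
  ¬forcedBy0 = ℕ.<⇒≱ (1≤z G 1≤n) ∘ to (forcedBy⇔z≤ G 1≤n 0)
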